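{- Let $P$ be a convex polytope in $\mathbb{R}^D$ with vertices in $\mathbb{Z}^D$, and let $s,d\in\mathbb{N}_0$ be given. There exists a constant $c_{s,d} > 0$ such that, for all sufficiently large $n$, at least $c_{s,d}\cdot 2^{|L(nP)|}$ of the subsets $A \subset L(nP)$ satisfy $$|(L(nP)+L(nP)) \setminus (A+A)| = s \quad\text{and}\quad |(L(nP)-L(nP)) \setminus (A-A)| \ge 2d.$$
   Context: For $S \subset \mathbb{R}^D$, $L(S) = S \cap \mathbb{Z}^D$ denotes the set of lattice points in $S$, and $nS$ denotes the dilation of $S$ by the factor $n$ about the origin. For finite sets $X,Y$, $X+Y=\{x+y: x\in X, y \in Y\}$ and $X-Y=\{x-y: x\in X,y\in Y\}$.
   Formalization: The polytope P is assumed to have at least two distinct points; for a single point L(nP) has one element, so at most one sum and one difference can be missing and the claim fails, for example for s = 2. -}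

module Defs where

open import Data.Nat as ℕ using (ℕ; _⊔_)
import Data.Nat.Properties as ℕ
open import Data.Integer as ℤ using (ℤ)
open import Data.Rational as ℚ using (ℚ; 0ℚ; 1ℚ; ½)
import Data.Rational.Properties as ℚ
open import Data.Rational.Solver using (module +-*-Solver)
open import Data.Fin.Base using (Fin)
open import Data.Fin.Subset using (Subset)
open import Data.Fin.Subset.Properties using () renaming (_∈?_ to _∈ˢ?_)
open import Data.List.Base as List
  using (List; length; filter; map; deduplicate; cartesianProductWith; allFin)
import Data.List.Membership.DecPropositional as DecMembership
open import Data.List.Membership.Propositional using (_∈_)
open import Data.List.Relation.Unary.Unique.Propositional using (Unique)
open import Data.Product.Base using (∃-syntax; _×_; _,_)
open import Data.Vec.Base as Vec using (Vec)
open import Data.Vec.Properties using (≡-dec)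
open import Data.Vec.Functional using (foldr)
open import Function.Base using (_∘_)
open import Function.Bundles using (_⇔_)
open import Level using (0ℓ)
open import Relation.Binary.Core using (Rel)
open import Relation.Binary.Definitions using (DecidableEquality)
open import Relation.Binary.PropositionalEquality using (_≡_; refl; cong; sym; trans; subst)
open import Relation.Nullary.Decidable using (¬?)
open import Relation.Unary using (Pred)

ℤ→ℚ : ℤ → ℚ
ℤ→ℚ z = z ℚ./ 1

ℕ→ℚ : ℕ → ℚ
ℕ→ℚ n = ℤ→ℚ (ℤ.+ n)

-- Real numbers as Cauchy sequences of rationals, compared with the setoid
-- equality _≈_.

Cauchy : (ℕ → ℚ) → Set
Cauchy x = ∀ ε → 0ℚ ℚ.< ε →
  ∃[ N ] ∀ m n → N ℕ.≤ m → N ℕ.≤ n → ℚ.∣ x m ℚ.- x n ∣ ℚ.< ε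

record ℝ : Set where
  constructor mkℝ
  field
    seq    : ℕ → ℚ
    cauchy : Cauchy seq

open ℝ public

infix  4 _≈_ _≤_
infixl 6 _+_
infixr 7 _·_

_≈_ : Rel ℝ 0ℓ
x ≈ y = ∀ ε → 0ℚ ℚ.< ε →
  ∃[ N ] ∀ n → N ℕ.≤ n → ℚ.∣ seq x n ℚ.- seq y n ∣ ℚ.< ε

_≤_ : Rel ℝ 0ℓ
x ≤ y = ∀ ε → 0ℚ ℚ.< ε →
  ∃[ N ] ∀ n → N ℕ.≤ n → seq x n ℚ.< seq y n ℚ.+ ε

fromℚ : ℚ → ℝ
fromℚ q = mkℝ (λ _ → q) λ ε 0<ε →
  0 , λ _ _ _ _ → subst (ℚ._< ε) (cong ℚ.∣_∣ (sym (ℚ.+-inverseʳ q))) 0<ε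

fromℤ : ℤ → ℝ
fromℤ z = fromℚ (ℤ→ℚ z)

private
  open +-*-Solver

  +-interchange : ∀ a b c d → (a ℚ.+ b) ℚ.- (c ℚ.+ d) ≡ (a ℚ.- c) ℚ.+ (b ℚ.- d)
  +-interchange = solve 4 (λ a b c d → (a :+ b) :- (c :+ d) := (a :- c) :+ (b :- d)) refl

  *-distrib-− : ∀ q a b → q ℚ.* a ℚ.- q ℚ.* b ≡ q ℚ.* (a ℚ.- b)
  *-distrib-− = solve 3 (λ q a b → q :* a :- q :* b := q :* (a :- b)) refl

  ½+½ : ∀ ε → ½ ℚ.* ε ℚ.+ ½ ℚ.* ε ≡ ε
  ½+½ ε = trans (sym (ℚ.*-distribʳ-+ ε ½ ½)) (ℚ.*-identityˡ ε)

_+_ : ℝ → ℝ → ℝ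
x + y = mkℝ (λ n → seq x n ℚ.+ seq y n) λ ε 0<ε →
  let 0<½ε   = subst (ℚ._< ½ ℚ.* ε) (ℚ.*-zeroʳ ½) (ℚ.*-monoʳ-<-pos ½ 0<ε)
      M , hM = cauchy x (½ ℚ.* ε) 0<½ε
      N , hN = cauchy y (½ ℚ.* ε) 0<½ε
  in M ⊔ N , λ m n m≥ n≥ →
    let open ℚ.≤-Reasoning
        M≤ : ∀ {k} → M ⊔ N ℕ.≤ k → M ℕ.≤ k
        M≤ = ℕ.≤-trans (ℕ.m≤m⊔n M N)
        N≤ : ∀ {k} → M ⊔ N ℕ.≤ k → N ℕ.≤ k
        N≤ = ℕ.≤-trans (ℕ.m≤n⊔m M N)
        a = seq x m ; b = seq y m ; c = seq x n ; d = seq y n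
    in begin-strict
      ℚ.∣ (a ℚ.+ b) ℚ.- (c ℚ.+ d) ∣      ≡⟨ cong ℚ.∣_∣ (+-interchange a b c d) ⟩
      ℚ.∣ (a ℚ.- c) ℚ.+ (b ℚ.- d) ∣      ≤⟨ ℚ.∣p+q∣≤∣p∣+∣q∣ (a ℚ.- c) (b ℚ.- d) ⟩
      ℚ.∣ a ℚ.- c ∣ ℚ.+ ℚ.∣ b ℚ.- d ∣    <⟨ ℚ.+-mono-< (hM m n (M≤ m≥) (M≤ n≥)) (hN m n (N≤ m≥) (N≤ n≥)) ⟩
      ½ ℚ.* ε ℚ.+ ½ ℚ.* ε                ≡⟨ ½+½ ε ⟩
      ε                                  ∎

_·_ : ℚ → ℝ → ℝ
q · x = mkℝ (λ n → q ℚ.* seq x n) λ ε 0<ε →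
  let k      = ℚ.∣ q ∣ ℚ.+ 1ℚ
      instance
        k>0 : ℚ.Positive k
        k>0 = ℚ.positive (ℚ.+-mono-≤-< (ℚ.0≤∣p∣ q) (ℚ.positive⁻¹ 1ℚ))
        k≢0 : ℚ.NonZero k
        k≢0 = ℚ.pos⇒nonZero k
        k⁻¹>0 : ℚ.Positive (ℚ.1/ k)
        k⁻¹>0 = ℚ.1/pos⇒pos k
        ∣q∣≥0 : ℚ.NonNegative ℚ.∣ q ∣
        ∣q∣≥0 = ℚ.∣-∣-nonNeg q
      δ      = ℚ.1/ k ℚ.* ε
      0<δ    = subst (ℚ._< δ) (ℚ.*-zeroʳ (ℚ.1/ k)) (ℚ.*-monoʳ-<-pos (ℚ.1/ k) 0<ε)
      N , hN = cauchy x δ 0<δ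
  in N , λ m n m≥ n≥ →
    let open ℚ.≤-Reasoning
        a = seq x m ; b = seq x n
        instance
          δ>0 : ℚ.Positive δ
          δ>0 = ℚ.positive 0<δ
    in begin-strict
      ℚ.∣ q ℚ.* a ℚ.- q ℚ.* b ∣    ≡⟨ cong ℚ.∣_∣ (*-distrib-− q a b) ⟩
      ℚ.∣ q ℚ.* (a ℚ.- b) ∣        ≡⟨ ℚ.∣p*q∣≡∣p∣*∣q∣ q (a ℚ.- b) ⟩
      ℚ.∣ q ∣ ℚ.* ℚ.∣ a ℚ.- b ∣    ≤⟨ ℚ.*-monoˡ-≤-nonNeg ℚ.∣ q ∣ (ℚ.<⇒≤ (hN m n m≥ n≥)) ⟩
      ℚ.∣ q ∣ ℚ.* δ                <⟨ ℚ.*-monoˡ-<-pos δ (subst (ℚ._< k) (ℚ.+-identityʳ ℚ.∣ q ∣) (ℚ.+-monoʳ-< ℚ.∣ q ∣ (ℚ.positive⁻¹ 1ℚ))) ⟩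
      k ℚ.* δ                      ≡⟨ ℚ.*-assoc k (ℚ.1/ k) ε ⟨
      (k ℚ.* ℚ.1/ k) ℚ.* ε         ≡⟨ cong (ℚ._* ε) (ℚ.*-inverseʳ k) ⟩
      1ℚ ℚ.* ε                     ≡⟨ ℚ.*-identityˡ ε ⟩
      ε                            ∎

∑ : ∀ {k} → (Fin k → ℝ) → ℝ
∑ = foldr _+_ (fromℚ 0ℚ)

ℝ^_ : ℕ → Set
ℝ^ D = Fin D → ℝ

ℤ^_ : ℕ → Set
ℤ^ D = Vec ℤ D

-- The convex hull of a finite set of lattice points, i.e. a convex polytope whose
-- vertices are lattice points.
conv : ∀ {D} → List (ℤ^ D) → Pred (ℝ^ D) 0ℓ
conv V x = ∃[ w ]
  (∀ i → fromℚ 0ℚ ≤ w i) ×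
  ∑ w ≈ fromℚ 1ℚ ×
  (∀ j → x j ≈ ∑ {length V} (λ i → ℤ→ℚ (Vec.lookup (List.lookup V i) j) · w i))

dilate : ∀ {D} → ℕ → Pred (ℝ^ D) 0ℓ → Pred (ℝ^ D) 0ℓ
dilate n S y = ∃[ x ] S x × (∀ j → y j ≈ ℕ→ℚ n · x j)

L : ∀ {D} → Pred (ℝ^ D) 0ℓ → Pred (ℤ^ D) 0ℓ
L S z = S (fromℤ ∘ Vec.lookup z)

Enumerates : ∀ {D} → List (ℤ^ D) → Pred (ℤ^ D) 0ℓ → Set
Enumerates X S = Unique X × (∀ z → z ∈ X ⇔ S z)

-- Below, a list of lattice points stands for the finite set of its entries;
-- repetitions are harmless because ∣_∣ counts distinct entries.

module _ {D : ℕ} where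

  infixl 6 _⊕_ _⊖_
  infixl 5 _∖_

  _≟_ : DecidableEquality (ℤ^ D)
  _≟_ = ≡-dec ℤ._≟_

  open DecMembership _≟_ using (_∈?_)

  ∣_∣ : List (ℤ^ D) → ℕ
  ∣ X ∣ = length (deduplicate _≟_ X)

  _⊕_ _⊖_ _∖_ : List (ℤ^ D) → List (ℤ^ D) → List (ℤ^ D)
  X ⊕ Y = cartesianProductWith (Vec.zipWith ℤ._+_) X Y
  X ⊖ Y = cartesianProductWith (Vec.zipWith ℤ._-_) X Y
  X ∖ Y = filter (λ z → ¬? (z ∈? Y)) X

  elements : (X : List (ℤ^ D)) → Subset (length X) → List (ℤ^ D)
  elements X A = map (List.lookup X) (filter (_∈ˢ? A) (allFin (length X)))

  MissingSumsDiffs : (X : List (ℤ^ D)) (s d : ℕ) → Pred (Subset (length X)) 0ℓ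
  MissingSumsDiffs X s d A =
    ∣ (X ⊕ X) ∖ (A′ ⊕ A′) ∣ ≡ s ×
    2 ℕ.* d ℕ.≤ ∣ (X ⊖ X) ∖ (A′ ⊖ A′) ∣
    where A′ = elements X A

{-# OPTIONS --safe #-}

module Submission where

-- Choose an injective linear functional on the vertices, with minimum at u and maximum at v. The level of a point of
-- nP is its distance from the supporting hyperplane at nu (or nv). Near all other nw with w ∈ V, a random set A is
-- required to contain every lattice point. Near nu it omits the s lowest points other than nu, which makes exactly
-- their sums with nu unattainable, and the points in certain gaps of levels; near nv it omits other gaps. The
-- two systems of gaps are such that every element of a gap, added to nu or nv, is still a sum of two points outside,
-- but (n - j)(v - u) is not a difference for d consecutive values of j.
--
-- All other sums have to be attained. Write such a sum as a sum of 2 (n - k) vertices plus a bounded remainder, and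
-- group the vertices into T pairs of different vertices and pairs of copies of a single vertex w. If T is bounded, the
-- sum is nw plus a point near nw. Otherwise exchanging the elements of one pair after the other yields T + 1
-- representations with different levels, and the sum is missed with probability at most exponentially small in T.
-- The sum of these probabilities over all vectors of vertex multiplicities is a product of geometric series, and its
-- tail is at most 1/2. Hence a proportion of at least 1/2 of the choices away from the vertices is good.
--
-- The lattice points of nP are found with Fourier–Motzkin elimination, which decides membership.

open import Defs hiding (_+_; _≤_; _≈_; _·_)
open import Algebra.Bundles using (AbelianGroup)
import Algebra.Properties.CommutativeMonoid.Mult as Mult
import Algebra.Properties.Group as GroupProperties
import Algebra.Solver.CommutativeMonoid as CommutativeMonoidSolver
open import Data.Bool.Base using (Bool; true; false; if_then_else_; _∧_; not)
open import Data.Empty using (⊥; ⊥-elim)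
open import Data.Fin.Base using (Fin; zero; suc)
open import Data.Fin.Subset using (Subset)
open import Data.Integer.Base as ℤ using (ℤ; 0ℤ)
import Data.Integer.Properties as ℤ
open import Data.Integer.Tactic.RingSolver using () renaming (solve-∀ to solve-∀ᶻ)
open import Data.List.Base as List using (List; []; _∷_; _++_; length; map; filter; replicate; concatMap; cartesianProductWith; deduplicate; upTo)
import Data.List.Extrema as Extrema
import Data.List.Properties as List
import Data.List.Membership.DecPropositional as DecMembership
open import Data.List.Membership.Propositional using (_∈_; _∉_; find)
open import Data.List.Membership.Propositional.Properties using (∈-++⁺ˡ; ∈-++⁺ʳ; ∈-++⁻; ∈-∃++; ∈-map⁺; ∈-map⁻; ∈-filter⁺; ∈-filter⁻; ∈-lookup; ∈-cartesianProductWith⁺; ∈-cartesianProductWith⁻; ∈-deduplicate⁺; ∈-deduplicate⁻; ∈-upTo⁺; ∈-allFin; ∈-applyUpTo⁻)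
open import Data.List.Relation.Binary.Subset.Propositional using (_⊆_)
open import Data.List.Relation.Unary.All as All using (All; []; _∷_)
import Data.List.Relation.Unary.All.Properties as All
open import Data.List.Relation.Unary.AllPairs as AllPairs using (AllPairs; []; _∷_)
import Data.List.Relation.Unary.AllPairs.Properties as AllPairs
open import Data.List.Relation.Unary.Any as Any using (Any; here; there)
import Data.List.Relation.Unary.Any.Properties as Any
open import Data.List.Relation.Unary.Unique.Propositional using (Unique)
import Data.List.Relation.Unary.Unique.Propositional.Properties as Unique
import Data.List.Relation.Unary.Unique.DecPropositional.Properties as UniqueDec
open import Data.Maybe.Base using (Maybe; just; nothing)
open import Data.Nat.Base as ℕ using (ℕ; zero; suc; _+_; _*_; _∸_; _^_; _≤_; _<_; _⊔_; z≤n; s≤s; NonZero)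
open import Data.Nat.DivMod using (_/_; _%_; m≡m%n+[m/n]*n; m%n<n; m/n*n≤m; m*n/n≡m; m<n*o⇒m/o<n)
import Data.Nat.DivMod as DivMod
open import Data.Nat.ListAction using () renaming (sum to Σℕ)
open import Data.Nat.ListAction.Properties using (sum-++)
open import Data.Nat.Properties renaming (_≟_ to _≟ⁿ_)
open import Data.Nat.Divisibility using (∣-refl)
open import Data.Nat.Tactic.RingSolver using (solve-∀)
open import Data.Product.Base using (∃-syntax; _×_; _,_; proj₁; proj₂)
open import Data.Rational.Base as ℚ using (ℚ; 0ℚ; 1ℚ)
import Data.Rational.Properties as ℚ
open import Data.Rational.Solver using (module +-*-Solver)
import Data.Rational.Unnormalised.Base as ℚᵘ
import Data.Rational.Unnormalised.Properties as ℚᵘ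
open import Data.Sum.Base using (_⊎_; inj₁; inj₂; [_,_]′)
open import Data.Vec.Base as Vec using (Vec; []; _∷_; lookup)
import Data.Vec.Properties as Vec
open import Data.Vec.Functional using (foldr)
open import Function.Base using (_∘_; id; case_of_)
open import Function.Bundles using (mk⇔)
open import Relation.Binary.Definitions using (DecidableEquality; tri<; tri≈; tri>)
open import Relation.Binary.PropositionalEquality using (_≡_; _≢_; isEquivalence; refl; sym; ≢-sym; trans; cong; cong₂; subst; subst₂; module ≡-Reasoning)
open import Relation.Nullary using (¬_; Dec; yes; no; does; contradiction)
open import Relation.Nullary.Decidable using (¬?; _×-dec_; _⊎-dec_; map′; from-yes)

-- A difference close to n(v - u) forces one point near nv and the other near nu, whereas a sum
-- close to 2nu or 2nv involves points near one pole only. So a gap system has to be harmless for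
-- sums at its own pole alone, and it takes both systems together to block a difference. One pair of
-- poles is enough, since every blocked difference comes with its negative.
--
-- The least spread that is left to chance is a constant, while the number of sums grows with n. A
-- bound uniform over all sums would therefore not survive the summation. Up to boundedly many
-- choices a sum is determined by the multiplicities in its pairs, and the bound used decays in each
-- of them.
--
-- All prescribed points lie within distances independent of n from the points nw, so that
-- prescribing them costs a constant factor. Levels are read in blocks because exchanges move a
-- level in bounded steps, and no step jumps over a block that is longer.
--
-- Membership in L(nP) speaks of Cauchy reals, whose order is undecidable, so rational weights have
-- to be recovered from real ones.

Unique⇒⊆⇒length≤ : ∀ {a} {A : Set a} {xs ys : List A} → Unique xs → xs ⊆ ys → length xs ≤ length ys
Unique⇒⊆⇒length≤ [] _ = z≤n
Unique⇒⊆⇒length≤ {xs = x ∷ xs} (x∉ ∷ u) xs⊆ys with ys₁ , ys₂ , refl ← ∈-∃++ (xs⊆ys (here refl)) =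
  ≤-trans (s≤s (Unique⇒⊆⇒length≤ u xs⊆)) (≤-reflexive eq)
  where
  xs⊆ : xs ⊆ ys₁ ++ ys₂
  xs⊆ y∈ with ∈-++⁻ ys₁ (xs⊆ys (there y∈))
  ... | inj₁ p = ∈-++⁺ˡ p
  ... | inj₂ (here refl) = contradiction refl (All.lookup x∉ y∈)
  ... | inj₂ (there p) = ∈-++⁺ʳ ys₁ p
  eq : suc (length (ys₁ ++ ys₂)) ≡ length (ys₁ ++ x ∷ ys₂)
  eq = begin
    suc (length (ys₁ ++ ys₂))  ≡⟨ cong suc (List.length-++ ys₁) ⟩
    suc (length ys₁ + length ys₂)  ≡⟨ +-suc (length ys₁) (length ys₂) ⟨
    length ys₁ + suc (length ys₂)  ≡⟨ List.length-++ ys₁ ⟨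
    length (ys₁ ++ x ∷ ys₂)  ∎
    where open ≡-Reasoning

+-interchange : ∀ a b c d → a + b + (c + d) ≡ a + c + (b + d)
+-interchange = solve-∀

-- Lattice vectors, additive functions and integer combinations

infixl 6 _+ᵥ_ _-ᵥ_

_+ᵥ_ _-ᵥ_ : ∀ {D} → ℤ^ D → ℤ^ D → ℤ^ D
_+ᵥ_ = Vec.zipWith ℤ._+_
_-ᵥ_ = Vec.zipWith ℤ._-_

0ᵥ : ∀ {D} → ℤ^ D
0ᵥ = Vec.replicate _ 0ℤ

+ᵥ-abelianGroup : ℕ → AbelianGroup _ _
+ᵥ-abelianGroup D = record
  { Carrier = ℤ^ D ; _≈_ = _≡_ ; _∙_ = _+ᵥ_ ; ε = 0ᵥ ; _⁻¹ = Vec.map (λ z → ℤ.- z)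
  ; isAbelianGroup = record
    { isGroup = record
      { isMonoid = record
        { isSemigroup = record
          { isMagma = record
            { isEquivalence = isEquivalence
            ; ∙-cong = cong₂ _+ᵥ_ }
          ; assoc = Vec.zipWith-assoc ℤ.+-assoc }
        ; identity = Vec.zipWith-identityˡ ℤ.+-identityˡ , Vec.zipWith-identityʳ ℤ.+-identityʳ }
      ; inverse = Vec.zipWith-inverseˡ ℤ.+-inverseˡ , Vec.zipWith-inverseʳ ℤ.+-inverseʳ
      ; ⁻¹-cong = cong (Vec.map (λ z → ℤ.- z)) }
    ; comm = Vec.zipWith-comm ℤ.+-comm } }

module +ᵥ {D : ℕ} where
  open AbelianGroup (+ᵥ-abelianGroup D) public using (assoc; comm; identityˡ; identityʳ; commutativeMonoid)
  open GroupProperties (AbelianGroup.group (+ᵥ-abelianGroup D)) public using () renaming (∙-cancelˡ to cancelˡ; ∙-cancelʳ to cancelʳ)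
  open Mult commutativeMonoid public using (×-homo-+; ×-assocˡ; ×-distrib-+; ×-homo-1) renaming (_×_ to _×ᵥ_)
  open CommutativeMonoidSolver commutativeMonoid public using (solve; _⊜_) renaming (_⊕_ to _⊞_)

open +ᵥ using (_×ᵥ_; _⊞_; _⊜_) public

+ᵥ-interchange : ∀ {D} (a b c d : ℤ^ D) → a +ᵥ b +ᵥ (c +ᵥ d) ≡ a +ᵥ c +ᵥ (b +ᵥ d)
+ᵥ-interchange = +ᵥ.solve 4 (λ a b c d → (a ⊞ b) ⊞ (c ⊞ d) ⊜ (a ⊞ c) ⊞ (b ⊞ d)) refl

-ᵥ-+ᵥ : ∀ {D} (x y : ℤ^ D) → (x -ᵥ y) +ᵥ y ≡ x
-ᵥ-+ᵥ [] [] = refl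
-ᵥ-+ᵥ (a ∷ x) (b ∷ y) = cong₂ _∷_
  (trans (ℤ.+-assoc a (ℤ.- b) b) (trans (cong (ℤ._+_ a) (ℤ.+-inverseˡ b)) (ℤ.+-identityʳ a)))
  (-ᵥ-+ᵥ x y)

+ᵥ⇒-ᵥ : ∀ {D} {x y z : ℤ^ D} → x +ᵥ y ≡ z → z -ᵥ y ≡ x
+ᵥ⇒-ᵥ {x = x} {y} {z} e = +ᵥ.cancelʳ y (z -ᵥ y) x (trans (-ᵥ-+ᵥ z y) (sym e))

-ᵥ⇒+ᵥ : ∀ {D} {x y z : ℤ^ D} → z ≡ x -ᵥ y → z +ᵥ y ≡ x
-ᵥ⇒+ᵥ {x = x} {y} refl = -ᵥ-+ᵥ x y

Additive : ∀ {D} → (ℤ^ D → ℤ) → Set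
Additive φ = ∀ x y → φ (x +ᵥ y) ≡ φ x ℤ.+ φ y

module _ {D} (φ : ℤ^ D → ℤ) (φ-+ : Additive φ) where

  additive-0 : φ 0ᵥ ≡ 0ℤ
  additive-0 = GroupProperties.identityˡ-unique (AbelianGroup.group ℤ.+-0-abelianGroup) (φ 0ᵥ) (φ 0ᵥ) (trans (sym (φ-+ 0ᵥ 0ᵥ)) (cong φ (+ᵥ.identityˡ 0ᵥ)))

  additive-× : ∀ n x → φ (n ×ᵥ x) ≡ ℤ.+ n ℤ.* φ x
  additive-× zero x = trans additive-0 (sym (ℤ.*-zeroˡ (φ x)))
  additive-× (suc n) x = trans (φ-+ x (n ×ᵥ x)) (trans (cong (ℤ._+_ (φ x)) (additive-× n x)) (sym (ℤ.suc-* (ℤ.+ n) (φ x))))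

coord : ∀ {D} → Fin D → ℤ^ D → ℤ
coord j x = lookup x j

coord-additive : ∀ {D} (j : Fin D) → Additive (coord j)
coord-additive j x y = Vec.lookup-zipWith ℤ._+_ j x y

lookup-ext : ∀ {D} {x y : ℤ^ D} → (∀ j → lookup x j ≡ lookup y j) → x ≡ y
lookup-ext {x = []} {[]} h = refl
lookup-ext {x = a ∷ x} {b ∷ y} h = cong₂ _∷_ (h zero) (lookup-ext (h ∘ suc))

×ᵥ-cancelˡ : ∀ {D} q {x y : ℤ^ D} → suc q ×ᵥ x ≡ suc q ×ᵥ y → x ≡ y
×ᵥ-cancelˡ q {x} {y} e = lookup-ext λ j → ℤ.*-cancelˡ-≡ (ℤ.+ suc q) (lookup x j) (lookup y j)
  (trans (sym (additive-× (coord j) (coord-additive j) (suc q) x)) (trans (cong (coord j) e) (additive-× (coord j) (coord-additive j) (suc q) y)))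

Σᵥ : ∀ {D} → List (ℤ^ D) → ℤ^ D
Σᵥ = List.foldr _+ᵥ_ 0ᵥ

Σᵥ-++ : ∀ {D} (xs ys : List (ℤ^ D)) → Σᵥ (xs ++ ys) ≡ Σᵥ xs +ᵥ Σᵥ ys
Σᵥ-++ [] ys = sym (+ᵥ.identityˡ (Σᵥ ys))
Σᵥ-++ (x ∷ xs) ys = trans (cong (x +ᵥ_) (Σᵥ-++ xs ys)) (sym (+ᵥ.assoc x (Σᵥ xs) (Σᵥ ys)))

Σᵥ-replicate : ∀ {D} n (x : ℤ^ D) → Σᵥ (replicate n x) ≡ n ×ᵥ x
Σᵥ-replicate zero x = refl
Σᵥ-replicate (suc n) x = cong (x +ᵥ_) (Σᵥ-replicate n x)

combination : ∀ {D} (V : List (ℤ^ D)) → Vec ℕ (length V) → ℤ^ D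
combination [] [] = 0ᵥ
combination (v ∷ V) (a ∷ as) = a ×ᵥ v +ᵥ combination V as

module _ {D : ℕ} where

  combination-scale : ∀ (V : List (ℤ^ D)) n a → combination V (Vec.map (n *_) a) ≡ n ×ᵥ combination V a
  combination-scale [] n [] = lookup-ext λ j → sym (trans (additive-× (coord j) (coord-additive j) n 0ᵥ)
    (trans (cong (ℤ._*_ (ℤ.+ n)) (additive-0 (coord j) (coord-additive j))) (trans (ℤ.*-zeroʳ (ℤ.+ n)) (sym (additive-0 (coord j) (coord-additive j))))))
  combination-scale (v ∷ V) n (a ∷ as) = trans (cong₂ _+ᵥ_ (sym (+ᵥ.×-assocˡ v n a)) (combination-scale V n as))
    (sym (+ᵥ.×-distrib-+ (a ×ᵥ v) (combination V as) n))

  combination-+ : ∀ (V : List (ℤ^ D)) a b → combination V (Vec.zipWith _+_ a b) ≡ combination V a +ᵥ combination V b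
  combination-+ [] [] [] = sym (+ᵥ.identityˡ 0ᵥ)
  combination-+ (v ∷ V) (a ∷ as) (b ∷ bs) = trans (cong₂ _+ᵥ_ (+ᵥ.×-homo-+ v a b) (combination-+ V as bs))
    (+ᵥ-interchange (a ×ᵥ v) (b ×ᵥ v) (combination V as) (combination V bs))

sum-scale : ∀ {k} n (a : Vec ℕ k) → Vec.sum (Vec.map (n *_) a) ≡ n * Vec.sum a
sum-scale n [] = sym (*-zeroʳ n)
sum-scale n (a ∷ as) = trans (cong (n * a +_) (sum-scale n as)) (sym (*-distribˡ-+ n a (Vec.sum as)))

sum-+ : ∀ {k} (a b : Vec ℕ k) → Vec.sum (Vec.zipWith _+_ a b) ≡ Vec.sum a + Vec.sum b
sum-+ [] [] = refl
sum-+ (a ∷ as) (b ∷ bs) = trans (cong (a + b +_) (sum-+ as bs)) (+-interchange a b (Vec.sum as) (Vec.sum bs))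

-- The lattice points of n · conv V, with the rational weights cleared of denominators.
InDilate : ∀ {D} → List (ℤ^ D) → ℕ → ℤ^ D → Set
InDilate V n x = ∃[ q ] ∃[ a ] combination V a ≡ suc q ×ᵥ x × Vec.sum a ≡ suc q * n

-- Points of dilates and their integer parts

module Dilates {D : ℕ} (V : List (ℤ^ D)) where

  infix 4 _∈[_]

  _∈[_] : ℤ^ D → ℕ → Set
  x ∈[ n ] = InDilate V n x

  k : ℕ
  k = length V

  ∈[]-+ : ∀ {m n x y} → x ∈[ m ] → y ∈[ n ] → x +ᵥ y ∈[ m + n ]
  ∈[]-+ {m} {n} {x} {y} (p , a , ea , sa) (q , b , eb , sb) =
    -- The common denominator is `suc p * suc q`, which is the successor of this number by
    -- computation.
    q + p * suc q , Vec.zipWith _+_ (Vec.map (suc q *_) a) (Vec.map (suc p *_) b) ,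
    (begin
      combination V (Vec.zipWith _+_ (Vec.map (suc q *_) a) (Vec.map (suc p *_) b))
        ≡⟨ combination-+ V (Vec.map (suc q *_) a) (Vec.map (suc p *_) b) ⟩
      combination V (Vec.map (suc q *_) a) +ᵥ combination V (Vec.map (suc p *_) b)
        ≡⟨ cong₂ _+ᵥ_ (combination-scale V (suc q) a) (combination-scale V (suc p) b) ⟩
      suc q ×ᵥ combination V a +ᵥ suc p ×ᵥ combination V b
        ≡⟨ cong₂ (λ u v → suc q ×ᵥ u +ᵥ suc p ×ᵥ v) ea eb ⟩
      suc q ×ᵥ (suc p ×ᵥ x) +ᵥ suc p ×ᵥ (suc q ×ᵥ y)
        ≡⟨ cong₂ _+ᵥ_ (+ᵥ.×-assocˡ x (suc q) (suc p)) (+ᵥ.×-assocˡ y (suc p) (suc q)) ⟩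
      (suc q * suc p) ×ᵥ x +ᵥ (suc p * suc q) ×ᵥ y
        ≡⟨ cong (λ r → r ×ᵥ x +ᵥ (suc p * suc q) ×ᵥ y) (*-comm (suc q) (suc p)) ⟩
      (suc p * suc q) ×ᵥ x +ᵥ (suc p * suc q) ×ᵥ y
        ≡⟨ +ᵥ.×-distrib-+ x y (suc p * suc q) ⟨
      (suc p * suc q) ×ᵥ (x +ᵥ y) ∎) ,
    (begin
      Vec.sum (Vec.zipWith _+_ (Vec.map (suc q *_) a) (Vec.map (suc p *_) b))
        ≡⟨ sum-+ (Vec.map (suc q *_) a) (Vec.map (suc p *_) b) ⟩
      Vec.sum (Vec.map (suc q *_) a) + Vec.sum (Vec.map (suc p *_) b)
        ≡⟨ cong₂ _+_ (sum-scale (suc q) a) (sum-scale (suc p) b) ⟩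
      suc q * Vec.sum a + suc p * Vec.sum b
        ≡⟨ cong₂ (λ u v → suc q * u + suc p * v) sa sb ⟩
      suc q * (suc p * m) + suc p * (suc q * n)
        ≡⟨ rearrange p q m n ⟩
      suc p * suc q * (m + n) ∎)
    where
    open ≡-Reasoning
    rearrange : ∀ p q m n → suc q * (suc p * m) + suc p * (suc q * n) ≡ suc p * suc q * (m + n)
    rearrange = solve-∀

  private
    unit : ∀ {W : List (ℤ^ D)} {w} → w ∈ W → Vec ℕ (length W)
    unit {_ ∷ W} (here _) = 1 ∷ Vec.replicate _ 0
    unit (there i) = 0 ∷ unit i

    combination-0 : ∀ (W : List (ℤ^ D)) → combination W (Vec.replicate _ 0) ≡ 0ᵥ
    combination-0 [] = refl
    combination-0 (w ∷ W) = trans (+ᵥ.identityˡ _) (combination-0 W)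

    sum-0 : ∀ m → Vec.sum (Vec.replicate m 0) ≡ 0
    sum-0 zero = refl
    sum-0 (suc m) = sum-0 m

    combination-unit : ∀ {W : List (ℤ^ D)} {w} (i : w ∈ W) → combination W (unit i) ≡ w
    combination-unit {x ∷ W} (here refl) = trans (cong₂ _+ᵥ_ (+ᵥ.×-homo-1 x) (combination-0 W)) (+ᵥ.identityʳ x)
    combination-unit {x ∷ W} (there i) = trans (+ᵥ.identityˡ _) (combination-unit i)

    sum-unit : ∀ {W : List (ℤ^ D)} {w} (i : w ∈ W) → Vec.sum (unit i) ≡ 1
    sum-unit {x ∷ W} (here _) = cong suc (sum-0 (length W))
    sum-unit (there i) = sum-unit i

  ∈[0] : 0ᵥ ∈[ 0 ]
  ∈[0] = 0 , Vec.replicate _ 0 , trans (combination-0 V) (sym (+ᵥ.×-homo-1 0ᵥ)) , sum-0 k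

  ∈[1] : ∀ {w} → w ∈ V → w ∈[ 1 ]
  ∈[1] {w} i = 0 , unit i , trans (combination-unit i) (sym (+ᵥ.×-homo-1 w)) , sum-unit i

  ∈[]-Σ : ∀ {ws} → All (_∈ V) ws → Σᵥ ws ∈[ length ws ]
  ∈[]-Σ [] = ∈[0]
  ∈[]-Σ (w∈ ∷ ws∈) = ∈[]-+ (∈[1] w∈) (∈[]-Σ ws∈)

  -- Forgets the order of the vertices, because the later union bound runs over multiplicity vectors
  -- and not over lists.
  coefficients : ∀ {ws} → All (_∈ V) ws → ∃[ m ] combination V m ≡ Σᵥ ws × Vec.sum m ≡ length ws
  coefficients [] = Vec.replicate _ 0 , combination-0 V , sum-0 k
  coefficients (w∈ ∷ ws∈) with m , em , sm ← coefficients ws∈ = Vec.zipWith _+_ (unit w∈) m ,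
    trans (combination-+ V (unit w∈) m) (cong₂ _+ᵥ_ (combination-unit w∈) em) ,
    trans (sum-+ (unit w∈) m) (cong₂ _+_ (sum-unit w∈) sm)

  ∈[]-× : ∀ {w} → w ∈ V → ∀ n → n ×ᵥ w ∈[ n ]
  ∈[]-× w∈ zero = ∈[0]
  ∈[]-× w∈ (suc n) = ∈[]-+ (∈[1] w∈) (∈[]-× w∈ n)

  private
    divide : ∀ (W : List (ℤ^ D)) q (a : Vec ℕ (length W)) → ∃[ ws ] ∃[ r ] All (_∈ W) ws ×
      combination W a ≡ suc q ×ᵥ Σᵥ ws +ᵥ combination W r ×
      Vec.sum a ≡ suc q * length ws + Vec.sum r × Vec.sum r ≤ q * length W
    divide [] q [] = [] , [] , [] ,
      trans (combination-scale [] (suc q) []) (sym (+ᵥ.identityʳ _)) ,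
      sym (trans (+-identityʳ _) (*-zeroʳ (suc q))) , z≤n
    divide (w ∷ W) q (a ∷ as) with ws , r , ws∈ , ec , es , r≤ ← divide W q as =
      replicate m w ++ ws , a % suc q ∷ r , All.++⁺ (All.replicate⁺ m (here refl)) (All.map there ws∈) ,
      (begin
        a ×ᵥ w +ᵥ combination W as
          ≡⟨ cong₂ _+ᵥ_ (cong (_×ᵥ w) (m≡m%n+[m/n]*n a (suc q))) ec ⟩
        (b + m * suc q) ×ᵥ w +ᵥ (suc q ×ᵥ Σᵥ ws +ᵥ combination W r)
          ≡⟨ cong (_+ᵥ (suc q ×ᵥ Σᵥ ws +ᵥ combination W r)) (+ᵥ.×-homo-+ w b (m * suc q)) ⟩
        b ×ᵥ w +ᵥ (m * suc q) ×ᵥ w +ᵥ (suc q ×ᵥ Σᵥ ws +ᵥ combination W r)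
          ≡⟨ +ᵥ.solve 4 (λ p q r s → (p ⊞ q) ⊞ (r ⊞ s) ⊜ (q ⊞ r) ⊞ (p ⊞ s)) refl
               (b ×ᵥ w) ((m * suc q) ×ᵥ w) (suc q ×ᵥ Σᵥ ws) (combination W r) ⟩
        (m * suc q) ×ᵥ w +ᵥ suc q ×ᵥ Σᵥ ws +ᵥ (b ×ᵥ w +ᵥ combination W r)
          ≡⟨ cong (λ y → y +ᵥ suc q ×ᵥ Σᵥ ws +ᵥ (b ×ᵥ w +ᵥ combination W r))
               (trans (cong (_×ᵥ w) (*-comm m (suc q))) (sym (+ᵥ.×-assocˡ w (suc q) m))) ⟩
        suc q ×ᵥ (m ×ᵥ w) +ᵥ suc q ×ᵥ Σᵥ ws +ᵥ (b ×ᵥ w +ᵥ combination W r)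
          ≡⟨ cong (_+ᵥ (b ×ᵥ w +ᵥ combination W r)) (+ᵥ.×-distrib-+ (m ×ᵥ w) (Σᵥ ws) (suc q)) ⟨
        suc q ×ᵥ (m ×ᵥ w +ᵥ Σᵥ ws) +ᵥ (b ×ᵥ w +ᵥ combination W r)
          ≡⟨ cong (λ y → suc q ×ᵥ y +ᵥ (b ×ᵥ w +ᵥ combination W r))
               (trans (Σᵥ-++ (replicate m w) ws) (cong (_+ᵥ Σᵥ ws) (Σᵥ-replicate m w))) ⟨
        suc q ×ᵥ Σᵥ (replicate m w ++ ws) +ᵥ (b ×ᵥ w +ᵥ combination W r) ∎) ,
      (begin
        a + Vec.sum as
          ≡⟨ cong₂ _+_ (m≡m%n+[m/n]*n a (suc q)) es ⟩
        b + m * suc q + (suc q * length ws + Vec.sum r)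
          ≡⟨ rearrange b m q (length ws) (Vec.sum r) ⟩
        suc q * (m + length ws) + (b + Vec.sum r)
          ≡⟨ cong (λ l → suc q * l + (b + Vec.sum r))
               (trans (List.length-++ (replicate m w)) (cong (_+ length ws) (List.length-replicate m))) ⟨
        suc q * length (replicate m w ++ ws) + (b + Vec.sum r) ∎) ,
      ≤-trans (+-mono-≤ (≤-pred (m%n<n a (suc q))) r≤) (≤-reflexive (sym (*-suc q (length W))))
      where
      open ≡-Reasoning
      m = a / suc q
      b = a % suc q
      rearrange : ∀ b m q l r → b + m * suc q + (suc q * l + r) ≡ suc q * (m + l) + (b + r)
      rearrange = solve-∀

  record Decomposition (n : ℕ) (x : ℤ^ D) : Set where
    constructor decomposition
    field
      {parts}    : List (ℤ^ D)
      {rest}     : ℤ^ D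
      {size}     : ℕ
      parts∈     : All (_∈ V) parts
      rest∈      : rest ∈[ size ]
      size≤k     : size ≤ k
      total      : length parts + size ≡ n
      value      : x ≡ Σᵥ parts +ᵥ rest

  -- Taking integer parts of the weights leaves weights below 1, which sum to less than k.
  decompose : ∀ {n x} → x ∈[ n ] → Decomposition n x
  decompose {n} {x} (q , a , ea , sa) with ws , r , ws∈ , ec , es , r≤ ← divide V q a = record
    { parts∈ = ws∈
    ; rest∈ = q , r , combination-r , sum-r
    ; size≤k = *-cancelˡ-≤ (suc q) (≤-trans (≤-reflexive (sym sum-r)) (≤-trans r≤ (*-monoˡ-≤ k (n≤1+n q))))
    ; total = m+[n∸m]≡n ws≤n
    ; value = sym (trans (+ᵥ.comm (Σᵥ ws) (x -ᵥ Σᵥ ws)) (-ᵥ-+ᵥ x (Σᵥ ws)))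
    }
    where
    open ≡-Reasoning
    sums : suc q * length ws + Vec.sum r ≡ suc q * n
    sums = trans (sym es) sa
    ws≤n : length ws ≤ n
    ws≤n = *-cancelˡ-≤ (suc q) (≤-trans (m≤m+n _ (Vec.sum r)) (≤-reflexive sums))
    sum-r : Vec.sum r ≡ suc q * (n ∸ length ws)
    sum-r = +-cancelˡ-≡ (suc q * length ws) _ _ (trans sums (trans
      (cong (suc q *_) (sym (m+[n∸m]≡n ws≤n))) (*-distribˡ-+ (suc q) (length ws) (n ∸ length ws))))
    combination-r : combination V r ≡ suc q ×ᵥ (x -ᵥ Σᵥ ws)
    combination-r = +ᵥ.cancelˡ (suc q ×ᵥ Σᵥ ws) _ _ (begin
      suc q ×ᵥ Σᵥ ws +ᵥ combination V r  ≡⟨ trans (sym ec) ea ⟩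
      suc q ×ᵥ x  ≡⟨ cong (suc q ×ᵥ_) (trans (+ᵥ.comm (Σᵥ ws) _) (-ᵥ-+ᵥ x (Σᵥ ws))) ⟨
      suc q ×ᵥ (Σᵥ ws +ᵥ (x -ᵥ Σᵥ ws))  ≡⟨ +ᵥ.×-distrib-+ (Σᵥ ws) (x -ᵥ Σᵥ ws) (suc q) ⟩
      suc q ×ᵥ Σᵥ ws +ᵥ suc q ×ᵥ (x -ᵥ Σᵥ ws)  ∎)

-- Levels above a supporting hyperplane

module Levels {D} (V : List (ℤ^ D)) (φ : ℤ^ D → ℤ) (φ-+ : Additive φ) (u : ℤ^ D)
  (φu≤ : ∀ {w} → w ∈ V → φ u ℤ.≤ φ w) (φ≡⇒≡u : ∀ {w} → w ∈ V → φ w ≡ φ u → w ≡ u) where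

  open Dilates V

  private
    +-cancel : ∀ a b → a ℤ.+ b ℤ.- b ≡ a
    +-cancel = solve-∀ᶻ

  -- The absolute value only serves to land in ℕ: on the dilates the difference is nonnegative by
  -- `lev-spec`.
  lev : ℕ → ℤ^ D → ℕ
  lev n x = ℤ.∣ φ x ℤ.- ℤ.+ n ℤ.* φ u ∣

  lev-unique : ∀ {n x t} → φ x ≡ ℤ.+ t ℤ.+ ℤ.+ n ℤ.* φ u → lev n x ≡ t
  lev-unique {n} {x} {t} e = cong ℤ.∣_∣ (trans (cong (ℤ._- ℤ.+ n ℤ.* φ u) e) (+-cancel (ℤ.+ t) (ℤ.+ n ℤ.* φ u)))

  private
    gap : ∀ {w} → w ∈ V → φ w ≡ ℤ.+ ℤ.∣ φ w ℤ.- φ u ∣ ℤ.+ φ u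
    gap {w} w∈ = trans (sym (cancel (φ w) (φ u))) (cong (ℤ._+ φ u) (sym (ℤ.0≤i⇒+∣i∣≡i (ℤ.i≤j⇒0≤j-i (φu≤ w∈)))))
      where
      cancel : ∀ a b → a ℤ.- b ℤ.+ b ≡ a
      cancel = solve-∀ᶻ

    -- Here t is the sum of aᵢ (φ wᵢ - φ u), whose terms are nonnegative. If it vanishes, each wᵢ
    -- with a positive coefficient has the same value as u and hence equals u.
    φ-combination : ∀ {W} → All (_∈ V) W → ∀ a → ∃[ t ] φ (combination W a) ≡ ℤ.+ t ℤ.+ ℤ.+ Vec.sum a ℤ.* φ u ×
      (t ≡ 0 → combination W a ≡ Vec.sum a ×ᵥ u)
    φ-combination [] [] = 0 , additive-0 φ φ-+ , λ _ → refl
    φ-combination {w ∷ W} (w∈ ∷ W∈) (a ∷ as) with t , e , z ← φ-combination W∈ as = a * g + t , eq , zeros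
      where
      open ≡-Reasoning
      g = ℤ.∣ φ w ℤ.- φ u ∣
      rearrange : ∀ a g p t s → a ℤ.* (g ℤ.+ p) ℤ.+ (t ℤ.+ s ℤ.* p) ≡ a ℤ.* g ℤ.+ t ℤ.+ (a ℤ.+ s) ℤ.* p
      rearrange = solve-∀ᶻ
      eq : φ (a ×ᵥ w +ᵥ combination W as) ≡ ℤ.+ (a * g + t) ℤ.+ ℤ.+ (a + Vec.sum as) ℤ.* φ u
      eq = begin
        φ (a ×ᵥ w +ᵥ combination W as)  ≡⟨ φ-+ _ _ ⟩
        φ (a ×ᵥ w) ℤ.+ φ (combination W as)  ≡⟨ cong₂ ℤ._+_ (additive-× φ φ-+ a w) e ⟩
        ℤ.+ a ℤ.* φ w ℤ.+ (ℤ.+ t ℤ.+ ℤ.+ Vec.sum as ℤ.* φ u)  ≡⟨ cong (λ p → ℤ.+ a ℤ.* p ℤ.+ (ℤ.+ t ℤ.+ ℤ.+ Vec.sum as ℤ.* φ u)) (gap w∈) ⟩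
        ℤ.+ a ℤ.* (ℤ.+ g ℤ.+ φ u) ℤ.+ (ℤ.+ t ℤ.+ ℤ.+ Vec.sum as ℤ.* φ u)  ≡⟨ rearrange (ℤ.+ a) (ℤ.+ g) (φ u) (ℤ.+ t) (ℤ.+ Vec.sum as) ⟩
        ℤ.+ a ℤ.* ℤ.+ g ℤ.+ ℤ.+ t ℤ.+ ℤ.+ (a + Vec.sum as) ℤ.* φ u  ≡⟨ cong (λ p → p ℤ.+ ℤ.+ t ℤ.+ ℤ.+ (a + Vec.sum as) ℤ.* φ u) (sym (ℤ.pos-* a g)) ⟩
        ℤ.+ (a * g + t) ℤ.+ ℤ.+ (a + Vec.sum as) ℤ.* φ u ∎
      zeros : a * g + t ≡ 0 → a ×ᵥ w +ᵥ combination W as ≡ (a + Vec.sum as) ×ᵥ u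
      zeros tz = trans (cong₂ _+ᵥ_ a×w (z (m+n≡0⇒n≡0 (a * g) tz))) (sym (+ᵥ.×-homo-+ u a (Vec.sum as)))
        where
        a×w : a ×ᵥ w ≡ a ×ᵥ u
        a×w with m*n≡0⇒m≡0∨n≡0 a (m+n≡0⇒m≡0 (a * g) tz)
        ... | inj₁ refl = refl
        ... | inj₂ g≡0 = cong (a ×ᵥ_) (φ≡⇒≡u w∈ (trans (gap w∈) (trans (cong (λ g → ℤ.+ g ℤ.+ φ u) g≡0) (ℤ.+-identityˡ (φ u)))))

    level : ∀ {n x} → x ∈[ n ] → (φ x ≡ ℤ.+ lev n x ℤ.+ ℤ.+ n ℤ.* φ u) × (lev n x ≡ 0 → x ≡ n ×ᵥ u)
    level {n} {x} (q , a , ea , sa) with t , e , z ← φ-combination (All.tabulate id) a = spec , zeros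
      where
      open ≡-Reasoning
      δ = φ x ℤ.- ℤ.+ n ℤ.* φ u
      restore : ∀ a b → a ≡ a ℤ.- b ℤ.+ b
      restore = solve-∀ᶻ
      scaled : ℤ.+ suc q ℤ.* δ ≡ ℤ.+ t
      scaled = begin
        ℤ.+ suc q ℤ.* δ  ≡⟨ expand (ℤ.+ suc q) (φ x) (ℤ.+ n) (φ u) ⟩
        ℤ.+ suc q ℤ.* φ x ℤ.- ℤ.+ suc q ℤ.* ℤ.+ n ℤ.* φ u  ≡⟨ cong₂ (λ p r → p ℤ.- r ℤ.* φ u) scaled-φ (sym (ℤ.pos-* (suc q) n)) ⟩
        ℤ.+ t ℤ.+ ℤ.+ (suc q * n) ℤ.* φ u ℤ.- ℤ.+ (suc q * n) ℤ.* φ u ≡⟨ +-cancel (ℤ.+ t) (ℤ.+ (suc q * n) ℤ.* φ u) ⟩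
        ℤ.+ t ∎
        where
        expand : ∀ q x n u → q ℤ.* (x ℤ.- n ℤ.* u) ≡ q ℤ.* x ℤ.- q ℤ.* n ℤ.* u
        expand = solve-∀ᶻ
        scaled-φ : ℤ.+ suc q ℤ.* φ x ≡ ℤ.+ t ℤ.+ ℤ.+ (suc q * n) ℤ.* φ u
        scaled-φ = trans (sym (additive-× φ φ-+ (suc q) x)) (trans (cong φ (sym ea)) (trans e (cong (λ s → ℤ.+ t ℤ.+ ℤ.+ s ℤ.* φ u) sa)))
      0≤δ : 0ℤ ℤ.≤ δ
      0≤δ = ℤ.*-cancelˡ-≤-pos 0ℤ δ (ℤ.+ suc q) (subst₂ ℤ._≤_ (sym (ℤ.*-zeroʳ (ℤ.+ suc q))) (sym scaled) (ℤ.+≤+ z≤n))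
      spec : φ x ≡ ℤ.+ lev n x ℤ.+ ℤ.+ n ℤ.* φ u
      spec = trans (restore (φ x) (ℤ.+ n ℤ.* φ u)) (cong (ℤ._+ ℤ.+ n ℤ.* φ u) (sym (ℤ.0≤i⇒+∣i∣≡i 0≤δ)))
      zeros : lev n x ≡ 0 → x ≡ n ×ᵥ u
      zeros l≡0 = ×ᵥ-cancelˡ q (trans (sym ea) (trans (z t≡0) (trans (cong (_×ᵥ u) sa) (sym (+ᵥ.×-assocˡ u (suc q) n)))))
        where
        t≡0 : t ≡ 0
        t≡0 = ℤ.+-injective (trans (sym scaled) (trans (cong (ℤ._*_ (ℤ.+ suc q)) (ℤ.∣i∣≡0⇒i≡0 l≡0)) (ℤ.*-zeroʳ (ℤ.+ suc q))))

  lev-spec : ∀ {n x} → x ∈[ n ] → φ x ≡ ℤ.+ lev n x ℤ.+ ℤ.+ n ℤ.* φ u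
  lev-spec x∈ = proj₁ (level x∈)

  lev≡0⇒ : ∀ {n x} → x ∈[ n ] → lev n x ≡ 0 → x ≡ n ×ᵥ u
  lev≡0⇒ x∈ = proj₂ (level x∈)

  lev-+ : ∀ {m n x y} → x ∈[ m ] → y ∈[ n ] → lev (m + n) (x +ᵥ y) ≡ lev m x + lev n y
  lev-+ {m} {n} {x} {y} x∈ y∈ = lev-unique {m + n} {x +ᵥ y} (trans (φ-+ x y) (trans (cong₂ ℤ._+_ (lev-spec x∈) (lev-spec y∈))
    (rearrange (ℤ.+ lev m x) (ℤ.+ m) (φ u) (ℤ.+ lev n y) (ℤ.+ n))))
    where
    rearrange : ∀ a m p b n → a ℤ.+ m ℤ.* p ℤ.+ (b ℤ.+ n ℤ.* p) ≡ a ℤ.+ b ℤ.+ (m ℤ.+ n) ℤ.* p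
    rearrange = solve-∀ᶻ

  lev-×u : ∀ n → lev n (n ×ᵥ u) ≡ 0
  lev-×u n = lev-unique {n} (trans (additive-× φ φ-+ n u) (sym (ℤ.+-identityˡ _)))

  lev-× : ∀ {w} → w ∈ V → ∀ n → lev n (n ×ᵥ w) ≡ n * lev 1 w
  lev-× w∈ zero = lev-×u 0
  lev-× w∈ (suc n) = trans (lev-+ (∈[1] w∈) (∈[]-× w∈ n)) (cong (_ +_) (lev-× w∈ n))

  0<lev : ∀ {w} → w ∈ V → w ≢ u → 0 < lev 1 w
  0<lev {w} w∈ w≢u with lev 1 w in e
  ... | zero = contradiction (trans (lev≡0⇒ (∈[1] w∈) e) (+ᵥ.×-homo-1 u)) w≢u
  ... | suc _ = s≤s z≤n

-- An injective functional and the two poles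

module _ {A : Set} where

  ∃-least : ∀ (f : A → ℤ) {a} {xs : List A} → a ∈ xs → ∃[ m ] m ∈ xs × (∀ {x} → x ∈ xs → f m ℤ.≤ f x)
  ∃-least f {a} {xs} a∈ = m , m∈ , All.lookup (E.f[argmin]≤f[xs] a xs)
    where
    module E = Extrema ℤ.≤-totalOrder
    m = E.argmin f a xs
    m∈ : m ∈ xs
    m∈ with E.argmin-sel f a xs
    ... | inj₁ m≡a = subst (_∈ xs) (sym m≡a) a∈
    ... | inj₂ i = i

private
  -- Coordinates read as digits in base B: additive in the vector, and injective as soon as B is
  -- large compared with the digits.
  radix : ∀ {D} → ℕ → ℤ^ D → ℤ
  radix B [] = 0ℤ
  radix B (c ∷ x) = c ℤ.+ ℤ.+ B ℤ.* radix B x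

  radix-+ : ∀ {D} B → Additive (radix {D} B)
  radix-+ B [] [] = refl
  radix-+ B (c ∷ x) (d ∷ y) = trans (cong (λ r → c ℤ.+ d ℤ.+ ℤ.+ B ℤ.* r) (radix-+ B x y))
    (rearrange c d (ℤ.+ B) (radix B x) (radix B y))
    where
    rearrange : ∀ c d b r s → c ℤ.+ d ℤ.+ b ℤ.* (r ℤ.+ s) ≡ c ℤ.+ b ℤ.* r ℤ.+ (d ℤ.+ b ℤ.* s)
    rearrange = solve-∀ᶻ

  norm : ∀ {D} → ℤ^ D → ℕ
  norm [] = 0
  norm (c ∷ x) = ℤ.∣ c ∣ + norm x

  -- The lowest digits differ by a multiple of B that is smaller than B in absolute value, so they
  -- agree, and B can be cancelled in what remains.
  radix-injective : ∀ {D} B (x y : ℤ^ D) → norm x + norm y < B → radix B x ≡ radix B y → x ≡ y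
  radix-injective B [] [] _ _ = refl
  radix-injective B (c ∷ x) (d ∷ y) small e = cong₂ _∷_ c≡d (radix-injective B x y small′ r≡s)
    where
    r = radix B x
    s = radix B y
    difference : c ℤ.- d ≡ ℤ.+ B ℤ.* (s ℤ.- r)
    difference = begin
      c ℤ.- d  ≡⟨ lemma₁ c d (ℤ.+ B) r ⟩
      (c ℤ.+ ℤ.+ B ℤ.* r) ℤ.- (d ℤ.+ ℤ.+ B ℤ.* r)  ≡⟨ cong (ℤ._- (d ℤ.+ ℤ.+ B ℤ.* r)) e ⟩
      (d ℤ.+ ℤ.+ B ℤ.* s) ℤ.- (d ℤ.+ ℤ.+ B ℤ.* r)  ≡⟨ lemma₂ d (ℤ.+ B) r s ⟩
      ℤ.+ B ℤ.* (s ℤ.- r) ∎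
      where
      open ≡-Reasoning
      lemma₁ : ∀ c d b r → c ℤ.- d ≡ (c ℤ.+ b ℤ.* r) ℤ.- (d ℤ.+ b ℤ.* r)
      lemma₁ = solve-∀ᶻ
      lemma₂ : ∀ d b r s → (d ℤ.+ b ℤ.* s) ℤ.- (d ℤ.+ b ℤ.* r) ≡ b ℤ.* (s ℤ.- r)
      lemma₂ = solve-∀ᶻ
    ∣s-r∣<1 : ℤ.∣ s ℤ.- r ∣ < 1
    ∣s-r∣<1 = *-cancelˡ-< B ℤ.∣ s ℤ.- r ∣ 1 (begin-strict
      B * ℤ.∣ s ℤ.- r ∣  ≡⟨ ℤ.abs-* (ℤ.+ B) (s ℤ.- r) ⟨
      ℤ.∣ ℤ.+ B ℤ.* (s ℤ.- r) ∣  ≡⟨ cong ℤ.∣_∣ difference ⟨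
      ℤ.∣ c ℤ.- d ∣  ≤⟨ ℤ.∣i-j∣≤∣i∣+∣j∣ c d ⟩
      ℤ.∣ c ∣ + ℤ.∣ d ∣  ≤⟨ +-mono-≤ (m≤m+n ℤ.∣ c ∣ (norm x)) (m≤m+n ℤ.∣ d ∣ (norm y)) ⟩
      norm (c ∷ x) + norm (d ∷ y) <⟨ small ⟩
      B  ≡⟨ *-identityʳ B ⟨
      B * 1  ∎)
      where open ≤-Reasoning
    s-r≡0 : s ℤ.- r ≡ 0ℤ
    s-r≡0 = ℤ.∣i∣≡0⇒i≡0 (n<1⇒n≡0 ∣s-r∣<1)
    r≡s : r ≡ s
    r≡s = sym (ℤ.i-j≡0⇒i≡j s r s-r≡0)
    c≡d : c ≡ d
    c≡d = ℤ.i-j≡0⇒i≡j c d (trans difference (trans (cong (ℤ._*_ (ℤ.+ B)) s-r≡0) (ℤ.*-zeroʳ (ℤ.+ B))))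
    small′ : norm x + norm y < B
    small′ = ≤-<-trans (+-mono-≤ (m≤n+m (norm x) ℤ.∣ c ∣) (m≤n+m (norm y) ℤ.∣ d ∣)) small

∃-injective-functional : ∀ {D} (V : List (ℤ^ D)) →
  ∃[ φ ] Additive φ × (∀ {x y} → x ∈ V → y ∈ V → φ x ≡ φ y → x ≡ y)
∃-injective-functional V = radix B , radix-+ B , λ {x} {y} x∈ y∈ →
  radix-injective B x y (s≤s (+-mono-≤ (norm≤ x∈) (norm≤ y∈)))
  where
  C = Σℕ (map norm V)
  B = suc (C + C)
  norm≤ : ∀ {x} → x ∈ V → norm x ≤ C
  norm≤ = lemma V
    where
    lemma : ∀ W {x} → x ∈ W → norm x ≤ Σℕ (map norm W)
    lemma (w ∷ W) (here refl) = m≤m+n _ _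
    lemma (w ∷ W) (there i) = ≤-trans (lemma W i) (m≤n+m _ (norm w))

-- An interface that forgets the functional, so that arguments at either end are given once; the
-- north pole comes from the negated functional.
record Pole {D} (V : List (ℤ^ D)) : Set where
  open Dilates V
  field
    apex     : ℤ^ D
    apex∈    : apex ∈ V
    lev      : ℕ → ℤ^ D → ℕ
    lev-+    : ∀ {m n x y} → x ∈[ m ] → y ∈[ n ] → lev (m + n) (x +ᵥ y) ≡ lev m x + lev n y
    lev≡0⇒   : ∀ {n x} → x ∈[ n ] → lev n x ≡ 0 → x ≡ n ×ᵥ apex
    lev-apex : ∀ n → lev n (n ×ᵥ apex) ≡ 0

  lev-× : ∀ {w} → w ∈ V → ∀ n → lev n (n ×ᵥ w) ≡ n * lev 1 w
  lev-× w∈ zero = lev-apex 0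
  lev-× w∈ (suc n) = trans (lev-+ (∈[1] w∈) (∈[]-× w∈ n)) (cong (lev 1 _ +_) (lev-× w∈ n))

  0<lev : ∀ {w} → w ∈ V → w ≢ apex → 0 < lev 1 w
  0<lev {w} w∈ w≢u with lev 1 w in eq
  ... | zero = contradiction (trans (lev≡0⇒ (∈[1] w∈) eq) (+ᵥ.×-homo-1 apex)) w≢u
  ... | suc _ = s≤s z≤n

-- Two opposite vertices, the extrema of an injective functional, with the distances of a point of n · conv V
-- from the two supporting hyperplanes.
record Poles {D} (V : List (ℤ^ D)) : Set where
  open Dilates V
  field
    south north : Pole V
  module South = Pole south
  module North = Pole north
  field
    width         : ℕ
    0<width       : 0 < width
    lev-sum       : ∀ {n x} → x ∈[ n ] → South.lev n x + North.lev n x ≡ n * width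
    lev-injective : ∀ {x y} → x ∈ V → y ∈ V → South.lev 1 x ≡ South.lev 1 y → x ≡ y

∃-poles : ∀ {D} (V : List (ℤ^ D)) → (∃[ a ] ∃[ b ] a ∈ V × b ∈ V × a ≢ b) → Poles V
∃-poles V (a , b , a∈ , b∈ , a≢b)
  with φ , φ-+ , φ-inj ← ∃-injective-functional V
  with u , u∈ , u≤ ← ∃-least φ a∈
  with v , v∈ , v≤ ← ∃-least (λ x → ℤ.- φ x) a∈ = record
    { south = record { apex = u ; apex∈ = u∈ ; lev = S.lev ; lev-+ = S.lev-+ ; lev≡0⇒ = S.lev≡0⇒ ; lev-apex = S.lev-×u }
    ; north = record { apex = v ; apex∈ = v∈ ; lev = N.lev ; lev-+ = N.lev-+ ; lev≡0⇒ = N.lev≡0⇒ ; lev-apex = N.lev-×u }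
    ; width = width
    ; 0<width = S.0<lev v∈ v≢u
    ; lev-sum = λ {n} {x} x∈ → ℤ.+-injective (sum n (ℤ.+ S.lev n x) (ℤ.+ N.lev n x) (S.lev-spec x∈) (N.lev-spec x∈))
    ; lev-injective = λ {x} {y} x∈ y∈ l≡l → φ-inj x∈ y∈
        (trans (S.lev-spec (∈[1] x∈)) (trans (cong (λ l → ℤ.+ l ℤ.+ ℤ.+ 1 ℤ.* φ u) l≡l) (sym (S.lev-spec (∈[1] y∈)))))
    }
  where
  open Dilates V
  open ≡-Reasoning
  -φ-+ : Additive (λ x → ℤ.- φ x)
  -φ-+ x y = trans (cong ℤ.-_ (φ-+ x y)) (ℤ.neg-distrib-+ (φ x) (φ y))
  module S = Levels V φ φ-+ u u≤ (λ w∈ → φ-inj w∈ u∈)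
  module N = Levels V (λ x → ℤ.- φ x) -φ-+ v v≤ (λ w∈ → φ-inj w∈ v∈ ∘ ℤ.neg-injective)
  width = S.lev 1 v
  φ≤v : ∀ {x} → x ∈ V → φ x ℤ.≤ φ v
  φ≤v x∈ = ℤ.neg-cancel-≤ (v≤ x∈)
  v≢u : v ≢ u
  v≢u refl = a≢b (trans (≡u a∈) (sym (≡u b∈)))
    where
    ≡u : ∀ {x} → x ∈ V → x ≡ u
    ≡u x∈ = φ-inj x∈ u∈ (ℤ.≤-antisym (φ≤v x∈) (u≤ x∈))
  sum : ∀ n s t {x} → φ x ≡ s ℤ.+ ℤ.+ n ℤ.* φ u → ℤ.- φ x ≡ t ℤ.+ ℤ.+ n ℤ.* (ℤ.- φ v) → s ℤ.+ t ≡ ℤ.+ (n * width)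
  sum n s t {x} es et = begin
    s ℤ.+ t  ≡⟨ lemma₁ s t (ℤ.+ n) (φ u) (φ v) ⟩
    (s ℤ.+ ℤ.+ n ℤ.* φ u) ℤ.+ (t ℤ.+ ℤ.+ n ℤ.* (ℤ.- φ v)) ℤ.+ ℤ.+ n ℤ.* (φ v ℤ.- φ u)
      ≡⟨ cong₂ (λ p q → p ℤ.+ q ℤ.+ ℤ.+ n ℤ.* (φ v ℤ.- φ u)) es et ⟨
    φ x ℤ.+ (ℤ.- φ x) ℤ.+ ℤ.+ n ℤ.* (φ v ℤ.- φ u)  ≡⟨ cong (λ p → φ x ℤ.+ (ℤ.- φ x) ℤ.+ ℤ.+ n ℤ.* (p ℤ.- φ u)) (S.lev-spec (∈[1] v∈)) ⟩
    φ x ℤ.+ (ℤ.- φ x) ℤ.+ ℤ.+ n ℤ.* (ℤ.+ width ℤ.+ ℤ.+ 1 ℤ.* φ u ℤ.- φ u)  ≡⟨ lemma₂ (φ x) (ℤ.+ n) (ℤ.+ width) (φ u) ⟩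
    ℤ.+ n ℤ.* ℤ.+ width  ≡⟨ ℤ.pos-* n width ⟨
    ℤ.+ (n * width) ∎
    where
    lemma₁ : ∀ s t n u v → s ℤ.+ t ≡ (s ℤ.+ n ℤ.* u) ℤ.+ (t ℤ.+ n ℤ.* (ℤ.- v)) ℤ.+ n ℤ.* (v ℤ.- u)
    lemma₁ = solve-∀ᶻ
    lemma₂ : ∀ x n w u → x ℤ.+ (ℤ.- x) ℤ.+ n ℤ.* (w ℤ.+ ℤ.+ 1 ℤ.* u ℤ.- u) ≡ n ℤ.* w
    lemma₂ = solve-∀ᶻ

-- Points near a vertex, and splitting of sums at a pole

module Geometry {D} {V : List (ℤ^ D)} (P : Poles V) where

  open Dilates V
  open Poles P

  ∈[]-cast : ∀ {m n x} → m ≡ n → x ∈[ m ] → x ∈[ n ]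
  ∈[]-cast refl x∈ = x∈

  -- The radius τ will not depend on n: the points near nw form a translate of the lattice points of
  -- τ · conv V, whose number is therefore constant.
  Near : ℤ^ D → ℕ → ℕ → ℤ^ D → Set
  Near w n τ x = ∃[ y ] y ∈[ τ ] × x ≡ (n ∸ τ) ×ᵥ w +ᵥ y

  near-pad : ∀ {w} → w ∈ V → ∀ j {m n τ y} → y ∈[ m ] → j + m ≡ n → m ≤ τ → τ ≤ n → Near w n τ (j ×ᵥ w +ᵥ y)
  near-pad {w} w∈ j {m} {n} {τ} {y} y∈ refl m≤τ τ≤n =
    (j ∸ i) ×ᵥ w +ᵥ y , ∈[]-cast size (∈[]-+ (∈[]-× w∈ (j ∸ i)) y∈) ,
    trans (cong (_+ᵥ y) (trans (cong (_×ᵥ w) (sym (m+[n∸m]≡n i≤j))) (+ᵥ.×-homo-+ w i (j ∸ i)))) (+ᵥ.assoc _ _ y)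
    where
    i = n ∸ τ
    i≤j : i ≤ j
    i≤j = m≤n+o⇒m∸n≤o (j + m) τ (≤-trans (+-monoʳ-≤ j m≤τ) (≤-reflexive (+-comm j τ)))
    size : j ∸ i + m ≡ τ
    size = +-cancelˡ-≡ i _ _ (trans (sym (+-assoc i (j ∸ i) m)) (trans (cong (_+ m) (m+[n∸m]≡n i≤j)) (sym (m∸n+n≡m τ≤n))))

  near-∈ : ∀ {w} → w ∈ V → ∀ {n τ x} → τ ≤ n → Near w n τ x → x ∈[ n ]
  near-∈ w∈ {n} {τ} τ≤n (y , y∈ , refl) = ∈[]-cast (m∸n+n≡m τ≤n) (∈[]-+ (∈[]-× w∈ (n ∸ τ)) y∈)

  near-apex : ∀ {w} → w ∈ V → ∀ {n τ} → τ ≤ n → Near w n τ (n ×ᵥ w)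
  near-apex {w} w∈ {n} {τ} τ≤n = τ ×ᵥ w , ∈[]-× w∈ τ , trans (cong (_×ᵥ w) (sym (m∸n+n≡m τ≤n))) (+ᵥ.×-homo-+ w (n ∸ τ) τ)

  -- Seen from a pole other than w, the neighbourhood of nw moves away at least linearly in n. This
  -- keeps it clear of the gaps at that pole.
  near-lev : ∀ (Q : Pole V) {w} → w ∈ V → ∀ {n τ x} → τ ≤ n → Near w n τ x → (n ∸ τ) * Pole.lev Q 1 w ≤ Pole.lev Q n x
  near-lev Q {w} w∈ {n} {τ} τ≤n (y , y∈ , refl) = begin
    (n ∸ τ) * lev 1 w  ≡⟨ lev-× w∈ (n ∸ τ) ⟨
    lev (n ∸ τ) ((n ∸ τ) ×ᵥ w)  ≤⟨ m≤m+n _ (lev τ y) ⟩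
    lev (n ∸ τ) ((n ∸ τ) ×ᵥ w) + lev τ y  ≡⟨ lev-+ (∈[]-× w∈ (n ∸ τ)) y∈ ⟨
    lev (n ∸ τ + τ) ((n ∸ τ) ×ᵥ w +ᵥ y)  ≡⟨ cong (λ m → lev m ((n ∸ τ) ×ᵥ w +ᵥ y)) (m∸n+n≡m τ≤n) ⟩
    lev n ((n ∸ τ) ×ᵥ w +ᵥ y)  ∎
    where
    open Pole Q
    open ≤-Reasoning

  lev-southern≤ : ∀ {n x} → x ∈[ n ] → South.lev n x ≤ n * width
  lev-southern≤ x∈ = ≤-trans (m≤m+n _ _) (≤-reflexive (lev-sum x∈))

  lev-northern≤ : ∀ {n x} → x ∈[ n ] → North.lev n x ≤ n * width
  lev-northern≤ x∈ = ≤-trans (m≤n+m _ _) (≤-reflexive (lev-sum x∈))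

  module AtPole (Q : Pole V) (lev≤ : ∀ {n x} → x ∈[ n ] → Pole.lev Q n x ≤ n * width) where

    open Pole Q

    lev-0 : lev 0 0ᵥ ≡ 0
    lev-0 = lev-apex 0

    private
      -- Here m counts the parts other than the apex. Each of them has level at least 1, so the
      -- total level bounds their number.
      separate : ∀ {ws} → All (_∈ V) ws → ∃[ j ] ∃[ m ] ∃[ y ] y ∈[ m ] × j + m ≡ length ws ×
        m ≤ lev (length ws) (Σᵥ ws) × Σᵥ ws ≡ j ×ᵥ apex +ᵥ y
      separate [] = 0 , 0 , 0ᵥ , ∈[0] , refl , z≤n , sym (+ᵥ.identityˡ 0ᵥ)
      separate {w ∷ ws} (w∈ ∷ ws∈) with j , m , y , y∈ , j+m , m≤ , eq ← separate ws∈ | w ≟ apex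
      ... | yes refl = suc j , m , y , y∈ , cong suc j+m , ≤-trans m≤ (≤-trans (m≤n+m _ (lev 1 w)) (≤-reflexive (sym (lev-+ (∈[1] w∈) (∈[]-Σ ws∈))))) ,
        trans (cong (w +ᵥ_) eq) (sym (+ᵥ.assoc w (j ×ᵥ w) y))
      ... | no w≢ = j , suc m , w +ᵥ y , ∈[]-+ (∈[1] w∈) y∈ , trans (+-suc j m) (cong suc j+m) ,
        ≤-trans (+-mono-≤ (0<lev w∈ w≢) m≤) (≤-reflexive (sym (lev-+ (∈[1] w∈) (∈[]-Σ ws∈)))) ,
        trans (cong (w +ᵥ_) eq) (+ᵥ.solve 3 (λ w a y → w ⊞ (a ⊞ y) ⊜ a ⊞ (w ⊞ y)) refl w (j ×ᵥ apex) y)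

    low⇒near : ∀ {n x l τ} → x ∈[ n ] → lev n x ≤ l → l + k ≤ τ → τ ≤ n → Near apex n τ x
    low⇒near {n} {x} {l} {τ} x∈ l≤ l+k≤τ τ≤n
      with decomposition {ws} {r} {f} ws∈ r∈ f≤k refl refl ← decompose x∈
      with j , m , y , y∈ , j+m , m≤ , eq ← separate ws∈ =
      subst (Near apex n τ) (sym (trans (cong (_+ᵥ r) eq) (+ᵥ.assoc (j ×ᵥ apex) y r)))
        (near-pad apex∈ j (∈[]-+ y∈ r∈) (trans (sym (+-assoc j m f)) (cong (_+ f) j+m))
          (≤-trans (+-mono-≤ m≤l f≤k) l+k≤τ) τ≤n)
      where
      m≤l : m ≤ l
      m≤l = ≤-trans m≤ (≤-trans (m≤m+n _ (lev f r)) (≤-trans (≤-reflexive (sym (lev-+ (∈[]-Σ ws∈) r∈))) l≤))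

    -- Exchanging the summand n · apex for x one part at a time changes the level in steps below K.
    module _ (K θ : ℕ) (k*width<K : k * width < K) (width<K : width < K) where

      Split : ℕ → ℤ^ D → Set
      Split n z = ∃[ a ] ∃[ b ] a ∈[ n ] × b ∈[ n ] × a +ᵥ b ≡ z × θ ≤ lev n a × lev n a < θ + K

      private
        lev-padded : ∀ {m a} j → a ∈[ m ] → lev (m + j) (a +ᵥ j ×ᵥ apex) ≡ lev m a
        lev-padded j a∈ = trans (lev-+ a∈ (∈[]-× apex∈ j)) (trans (cong (lev _ _ +_) (lev-apex j)) (+-identityʳ _))

        -- A discrete intermediate value argument. The current summands are `a +ᵥ length ws ×ᵥ apex`
        -- and `b +ᵥ Σᵥ ws`; a step trades the next vertex for an apex and raises the level of the
        -- first by at most `width`. The first time that θ is reached, the overshoot is less than K.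
        climb : ∀ {ws} → All (_∈ V) ws → ∀ {m m′ a b n} → a ∈[ m ] → b ∈[ m′ ] → m + length ws ≡ n → m′ + length ws ≡ n →
          lev m a < θ → θ ≤ lev m a + lev (length ws) (Σᵥ ws) → Split n (a +ᵥ length ws ×ᵥ apex +ᵥ (b +ᵥ Σᵥ ws))
        climb [] {m} {a = a} a∈ b∈ _ _ a<θ θ≤ =
          contradiction (≤-trans θ≤ (≤-reflexive (trans (cong (lev m a +_) lev-0) (+-identityʳ _)))) (<⇒≱ a<θ)
        climb {w ∷ ws} (w∈ ∷ ws∈) {m} {m′} {a} {b} {n} a∈ b∈ em em′ a<θ θ≤ with θ ≤? lev (m + 1) (a +ᵥ w)
        ... | yes θ≤aw = a +ᵥ w +ᵥ j ×ᵥ apex , b +ᵥ apex +ᵥ Σᵥ ws ,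
          ∈[]-cast em1 (∈[]-+ aw∈ (∈[]-× apex∈ j)) , ∈[]-cast (trans (+-assoc m′ 1 j) em′) (∈[]-+ (∈[]-+ b∈ (∈[1] apex∈)) (∈[]-Σ ws∈)) ,
          +ᵥ.solve 6 (λ a w j b u s → ((a ⊞ w) ⊞ j) ⊞ ((b ⊞ u) ⊞ s) ⊜ (a ⊞ (u ⊞ j)) ⊞ (b ⊞ (w ⊞ s))) refl
            a w (j ×ᵥ apex) b apex (Σᵥ ws) ,
          ≤-trans θ≤aw (≤-reflexive (sym eq)) , ≤-<-trans (≤-reflexive eq) aw<
          where
          j = length ws
          aw∈ = ∈[]-+ a∈ (∈[1] w∈)
          em1 : m + 1 + j ≡ n
          em1 = trans (+-assoc m 1 j) em
          eq : lev n (a +ᵥ w +ᵥ j ×ᵥ apex) ≡ lev (m + 1) (a +ᵥ w)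
          eq = trans (cong (λ i → lev i (a +ᵥ w +ᵥ j ×ᵥ apex)) (sym em1)) (lev-padded j aw∈)
          aw< : lev (m + 1) (a +ᵥ w) < θ + K
          aw< = ≤-<-trans (≤-reflexive (lev-+ a∈ (∈[1] w∈)))
            (+-mono-< a<θ (≤-<-trans (≤-trans (lev≤ (∈[1] w∈)) (≤-reflexive (*-identityˡ width))) width<K))
        ... | no θ≰aw = subst (Split n)
          (+ᵥ.solve 6 (λ a w j b u s → ((a ⊞ w) ⊞ j) ⊞ ((b ⊞ u) ⊞ s) ⊜ (a ⊞ (u ⊞ j)) ⊞ (b ⊞ (w ⊞ s))) refl
            a w (j ×ᵥ apex) b apex (Σᵥ ws))
          (climb ws∈ aw∈ (∈[]-+ b∈ (∈[1] apex∈)) (trans (+-assoc m 1 j) em) (trans (+-assoc m′ 1 j) em′) (≰⇒> θ≰aw)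
            (≤-trans θ≤ (≤-reflexive (trans (cong (lev m a +_) (lev-+ (∈[1] w∈) (∈[]-Σ ws∈)))
              (trans (sym (+-assoc (lev m a) (lev 1 w) (lev j (Σᵥ ws)))) (cong (_+ lev j (Σᵥ ws)) (sym (lev-+ a∈ (∈[1] w∈)))))))))
          where
          j = length ws
          aw∈ = ∈[]-+ a∈ (∈[1] w∈)

      split : ∀ {n x} → x ∈[ n ] → θ ≤ lev n x → Split n (n ×ᵥ apex +ᵥ x)
      split {n} {x} x∈ θ≤x
        with decomposition {ws} {r} {f} ws∈ r∈ f≤k refl refl ← decompose x∈ = subst (Split n) value split′
        where
        j = length ws
        value : r +ᵥ j ×ᵥ apex +ᵥ (f ×ᵥ apex +ᵥ Σᵥ ws) ≡ n ×ᵥ apex +ᵥ (Σᵥ ws +ᵥ r)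
        value = trans (+ᵥ.solve 4 (λ r j f s → (r ⊞ j) ⊞ (f ⊞ s) ⊜ (j ⊞ f) ⊞ (s ⊞ r)) refl r (j ×ᵥ apex) (f ×ᵥ apex) (Σᵥ ws))
          (cong (_+ᵥ (Σᵥ ws +ᵥ r)) (sym (+ᵥ.×-homo-+ apex j f)))
        split′ : Split n (r +ᵥ j ×ᵥ apex +ᵥ (f ×ᵥ apex +ᵥ Σᵥ ws))
        split′ with θ ≤? lev f r
        ... | no θ≰r = climb ws∈ r∈ (∈[]-× apex∈ f) (+-comm f j) (+-comm f j) (≰⇒> θ≰r)
          (≤-trans θ≤x (≤-reflexive (trans (lev-+ (∈[]-Σ ws∈) r∈) (+-comm _ (lev f r)))))
        -- The remainder may reach θ before any exchange, but its level is at most `k * width`,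
        -- which is less than K.
        ... | yes θ≤r = r +ᵥ j ×ᵥ apex , f ×ᵥ apex +ᵥ Σᵥ ws ,
          ∈[]-cast (+-comm f j) (∈[]-+ r∈ (∈[]-× apex∈ j)) , ∈[]-cast (+-comm f j) (∈[]-+ (∈[]-× apex∈ f) (∈[]-Σ ws∈)) , refl ,
          ≤-trans θ≤r (≤-reflexive (sym eq)) ,
          ≤-<-trans (≤-trans (≤-reflexive eq) (lev≤ r∈)) (≤-<-trans (*-monoˡ-≤ width f≤k) (<-≤-trans k*width<K (m≤n+m K θ)))
          where
          eq : lev n (r +ᵥ j ×ᵥ apex) ≡ lev f r
          eq = trans (cong (λ i → lev i (r +ᵥ j ×ᵥ apex)) (+-comm j f)) (lev-padded j r∈)

-- Many representations of a sum by exchanging pairs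

module Representations {D} {V : List (ℤ^ D)} (P : Poles V) where

  open Dilates V
  open Poles P
  open Geometry P
  open South using (lev; lev-+)

  private
    Pair : Set
    Pair = ℤ^ D × ℤ^ D

    Ascending : Pair → Set
    Ascending (p , q) = p ∈ V × q ∈ V × lev 1 p < lev 1 q

    lows highs both : List Pair → ℤ^ D
    lows ps = Σᵥ (map proj₁ ps)
    highs ps = Σᵥ (map proj₂ ps)
    both ps = lows ps +ᵥ highs ps

    -- Only one vertex may be paired with itself. Otherwise many copies of two vertices could occur
    -- without an ascending pair, and a sum far from every 2nw would show no spread.
    record Pairing (N : ℕ) (z : ℤ^ D) : Set where
      field
        {pairs}   : List Pair
        {middle}  : ℤ^ D
        {copies}  : ℕ
        ascending : All Ascending pairs
        middle∈   : middle ∈ V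
        number    : length pairs + copies ≡ N
        sum       : z ≡ both pairs +ᵥ (copies + copies) ×ᵥ middle

    +-pair : ∀ {N z p q} → p ∈ V → q ∈ V → lev 1 p < lev 1 q → Pairing N z → Pairing (suc N) (p +ᵥ q +ᵥ z)
    +-pair {p = p} {q} p∈ q∈ p<q π = record
      { pairs = (p , q) ∷ pairs ; ascending = (p∈ , q∈ , p<q) ∷ ascending ; middle∈ = middle∈ ; number = cong suc number
      ; sum = trans (cong (p +ᵥ q +ᵥ_) sum) (+ᵥ.solve 5 (λ p q l h m → (p ⊞ q) ⊞ ((l ⊞ h) ⊞ m) ⊜ ((p ⊞ l) ⊞ (q ⊞ h)) ⊞ m) refl
          p q (lows pairs) (highs pairs) ((copies + copies) ×ᵥ middle)) }
      where open Pairing π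

    double : ∀ c (w : ℤ^ D) → (suc c + suc c) ×ᵥ w ≡ w +ᵥ w +ᵥ (c + c) ×ᵥ w
    double c w = trans (cong (_×ᵥ w) (cong suc (+-suc c c))) (sym (+ᵥ.assoc w w ((c + c) ×ᵥ w)))

    -- A pair (p , p) either joins the copies of the middle point w, or is exchanged with one of them for (p , w) twice.
    +-equal : ∀ {N z p} → p ∈ V → Pairing N z → Pairing (suc N) (p +ᵥ p +ᵥ z)
    +-equal {N} {z} {p} p∈ record { pairs = ps ; copies = zero ; ascending = asc ; middle∈ = w∈ ; number = number ; sum = sum } = record
      { pairs = ps ; middle = p ; copies = 1 ; ascending = asc ; middle∈ = p∈ ; number = trans (+-suc (length ps) 0) (cong suc number)
      ; sum = trans (cong (p +ᵥ p +ᵥ_) (trans sum (+ᵥ.identityʳ _)))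
          (trans (+ᵥ.comm (p +ᵥ p) (both ps)) (cong (both ps +ᵥ_) (sym (trans (double 0 p) (+ᵥ.identityʳ _))))) }
    +-equal {N} {z} {p} p∈ record { pairs = ps ; middle = w ; copies = suc c ; ascending = asc ; middle∈ = w∈ ; number = number ; sum = sum }
      with <-cmp (lev 1 p) (lev 1 w)
    ... | tri≈ _ p≡w _ = record
      { pairs = ps ; middle = w ; copies = suc (suc c) ; ascending = asc ; middle∈ = w∈
      ; number = trans (+-suc (length ps) (suc c)) (cong suc number)
      ; sum = trans (cong₂ _+ᵥ_ (cong (λ x → x +ᵥ x) (lev-injective p∈ w∈ p≡w)) sum)
          (trans (+ᵥ.solve 3 (λ w b c → w ⊞ (b ⊞ c) ⊜ b ⊞ (w ⊞ c)) refl (w +ᵥ w) (both ps) ((suc c + suc c) ×ᵥ w))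
            (cong (both ps +ᵥ_) (sym (double (suc c) w)))) }
    ... | tri< p<w _ _ = record
      { pairs = (p , w) ∷ (p , w) ∷ ps ; middle = w ; copies = c ; ascending = (p∈ , w∈ , p<w) ∷ (p∈ , w∈ , p<w) ∷ asc ; middle∈ = w∈
      ; number = cong suc (trans (sym (+-suc (length ps) c)) number)
      ; sum = trans (cong (p +ᵥ p +ᵥ_) (trans sum (cong (both ps +ᵥ_) (double c w))))
          (+ᵥ.solve 5 (λ p w l h c → (p ⊞ p) ⊞ ((l ⊞ h) ⊞ ((w ⊞ w) ⊞ c)) ⊜ ((p ⊞ (p ⊞ l)) ⊞ (w ⊞ (w ⊞ h))) ⊞ c) refl
            p w (lows ps) (highs ps) ((c + c) ×ᵥ w)) }
    ... | tri> _ _ w<p = record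
      { pairs = (w , p) ∷ (w , p) ∷ ps ; middle = w ; copies = c ; ascending = (w∈ , p∈ , w<p) ∷ (w∈ , p∈ , w<p) ∷ asc ; middle∈ = w∈
      ; number = cong suc (trans (sym (+-suc (length ps) c)) number)
      ; sum = trans (cong (p +ᵥ p +ᵥ_) (trans sum (cong (both ps +ᵥ_) (double c w))))
          (+ᵥ.solve 5 (λ p w l h c → (p ⊞ p) ⊞ ((l ⊞ h) ⊞ ((w ⊞ w) ⊞ c)) ⊜ ((w ⊞ (w ⊞ l)) ⊞ (p ⊞ (p ⊞ h))) ⊞ c) refl
            p w (lows ps) (highs ps) ((c + c) ×ᵥ w)) }

    pairing : ∀ {ws ws′} → All (_∈ V) ws → All (_∈ V) ws′ → length ws ≡ length ws′ → Pairing (length ws) (Σᵥ ws +ᵥ Σᵥ ws′)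
    -- Without copies any element of V can serve as the middle; the south apex is at hand.
    pairing [] [] _ = record { pairs = [] ; copies = 0 ; ascending = [] ; middle∈ = South.apex∈ ; number = refl ; sum = sym (+ᵥ.identityʳ _) }
    pairing {p ∷ ws} {q ∷ ws′} (p∈ ∷ ws∈) (q∈ ∷ ws′∈) l≡l = subst (Pairing _)
      (+ᵥ-interchange p q (Σᵥ ws) (Σᵥ ws′)) π′
      where
      π = pairing ws∈ ws′∈ (suc-injective l≡l)
      π′ : Pairing (suc (length ws)) (p +ᵥ q +ᵥ (Σᵥ ws +ᵥ Σᵥ ws′))
      π′ with <-cmp (lev 1 p) (lev 1 q)
      ... | tri< p<q _ _ = +-pair p∈ q∈ p<q π
      ... | tri> _ _ q<p = subst (λ x → Pairing _ (x +ᵥ _)) (+ᵥ.comm q p) (+-pair q∈ p∈ q<p π)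
      ... | tri≈ _ p≡q _ with refl ← lev-injective p∈ q∈ p≡q = +-equal p∈ π

    lows∈ : ∀ {ps} → All Ascending ps → lows ps ∈[ length ps ]
    lows∈ [] = ∈[0]
    lows∈ ((p∈ , _) ∷ asc) = ∈[]-+ (∈[1] p∈) (lows∈ asc)

    highs∈ : ∀ {ps} → All Ascending ps → highs ps ∈[ length ps ]
    highs∈ [] = ∈[0]
    highs∈ ((_ , q∈ , _) ∷ asc) = ∈[]-+ (∈[1] q∈) (highs∈ asc)

    -- The i-th entry takes the higher points of the first i pairs and the lower points of the
    -- others, so consecutive entries differ in one pair and the level strictly increases.
    chain : ℤ^ D → List Pair → List (ℤ^ D)
    chain a [] = a ∷ []
    chain a ((p , q) ∷ ps) = a +ᵥ p +ᵥ lows ps ∷ chain (a +ᵥ q) ps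

    length-chain : ∀ a ps → length (chain a ps) ≡ suc (length ps)
    length-chain a [] = refl
    length-chain a ((p , q) ∷ ps) = cong suc (length-chain (a +ᵥ q) ps)

  Summand : ℕ → ℤ^ D → ℤ^ D → Set
  Summand n z x = x ∈[ n ] × ∃[ y ] y ∈[ n ] × x +ᵥ y ≡ z

  private
    chain-summands : ∀ {ps} → All Ascending ps → ∀ {m n a b z} → a ∈[ m ] → b ∈[ m ] → m + length ps ≡ n →
      a +ᵥ b +ᵥ both ps ≡ z → All (Summand n z) (chain a ps)
    chain-summands [] {m} {a = a} {b} a∈ b∈ eq ez =
      (∈[]-cast m≡n a∈ , b , ∈[]-cast m≡n b∈ , trans (sym (trans (cong (a +ᵥ b +ᵥ_) (+ᵥ.identityʳ 0ᵥ)) (+ᵥ.identityʳ _))) ez) ∷ []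
      where m≡n = trans (sym (+-identityʳ m)) eq
    chain-summands {(p , q) ∷ ps} ((p∈ , q∈ , _) ∷ asc) {m} {n} {a} {b} a∈ b∈ eq ez =
      (∈[]-cast eq′ (∈[]-+ (∈[]-+ a∈ (∈[1] p∈)) (lows∈ asc)) , b +ᵥ q +ᵥ highs ps ,
        ∈[]-cast eq′ (∈[]-+ (∈[]-+ b∈ (∈[1] q∈)) (highs∈ asc)) ,
        trans (+ᵥ.solve 6 (λ a p l b q h → ((a ⊞ p) ⊞ l) ⊞ ((b ⊞ q) ⊞ h) ⊜ (a ⊞ b) ⊞ ((p ⊞ l) ⊞ (q ⊞ h))) refl
          a p (lows ps) b q (highs ps)) ez) ∷
      chain-summands asc (∈[]-+ a∈ (∈[1] q∈)) (∈[]-+ b∈ (∈[1] p∈)) eq′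
        (trans (+ᵥ.solve 6 (λ a p l b q h → ((a ⊞ q) ⊞ (b ⊞ p)) ⊞ (l ⊞ h) ⊜ (a ⊞ b) ⊞ ((p ⊞ l) ⊞ (q ⊞ h))) refl
          a p (lows ps) b q (highs ps)) ez)
      where eq′ = trans (+-assoc m 1 (length ps)) eq

    chain-lev≥ : ∀ {ps} → All Ascending ps → ∀ {m n a} → a ∈[ m ] → m + length ps ≡ n →
      All (λ x → lev m a + lev (length ps) (lows ps) ≤ lev n x) (chain a ps)
    chain-lev< : ∀ {ps} → All Ascending ps → ∀ {m n a} → a ∈[ m ] → m + length ps ≡ n →
      AllPairs (λ x y → lev n x < lev n y) (chain a ps)

    lev-head : ∀ {p ps m n a} → p ∈ V → All Ascending ps → a ∈[ m ] → m + suc (length ps) ≡ n →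
      lev n (a +ᵥ p +ᵥ lows ps) ≡ lev m a + lev 1 p + lev (length ps) (lows ps)
    lev-head {p} {ps} {m} {n} {a} p∈ asc a∈ eq = begin
      lev n (a +ᵥ p +ᵥ lows ps)  ≡⟨ cong (λ i → lev i (a +ᵥ p +ᵥ lows ps)) (trans (+-assoc m 1 (length ps)) eq) ⟨
      lev (m + 1 + length ps) (a +ᵥ p +ᵥ lows ps)  ≡⟨ lev-+ (∈[]-+ a∈ (∈[1] p∈)) (lows∈ asc) ⟩
      lev (m + 1) (a +ᵥ p) + lev (length ps) (lows ps)  ≡⟨ cong (_+ lev (length ps) (lows ps)) (lev-+ a∈ (∈[1] p∈)) ⟩
      lev m a + lev 1 p + lev (length ps) (lows ps)  ∎
      where open ≡-Reasoning

    chain-lev-tail : ∀ {p q ps m n a} → p ∈ V → q ∈ V → lev 1 p < lev 1 q → All Ascending ps → a ∈[ m ] → m + suc (length ps) ≡ n →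
      All (λ x → lev n (a +ᵥ p +ᵥ lows ps) < lev n x) (chain (a +ᵥ q) ps)
    chain-lev-tail {p} {q} {ps} {m} {n} {a} p∈ q∈ p<q asc a∈ eq =
      All.map (<-≤-trans (≤-<-trans (≤-reflexive (lev-head p∈ asc a∈ eq)) (+-monoˡ-< (lev (length ps) (lows ps))
        (<-≤-trans (+-monoʳ-< (lev m a) p<q) (≤-reflexive (sym (lev-+ a∈ (∈[1] q∈))))))))
        (chain-lev≥ asc (∈[]-+ a∈ (∈[1] q∈)) (trans (+-assoc m 1 (length ps)) eq))

    chain-lev≥ [] {m} {n} {a} a∈ eq = ≤-reflexive (trans (cong (lev m a +_) (South.lev-apex 0)) (trans (+-identityʳ _)
      (cong (λ i → lev i a) (trans (sym (+-identityʳ m)) eq)))) ∷ []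
    chain-lev≥ {(p , q) ∷ ps} ((p∈ , q∈ , p<q) ∷ asc) {m} {n} {a} a∈ eq =
      ≤-reflexive head ∷ All.map (λ lt → ≤-trans (≤-reflexive head) (<⇒≤ lt)) (chain-lev-tail p∈ q∈ p<q asc a∈ eq)
      where
      head : lev m a + lev (suc (length ps)) (p +ᵥ lows ps) ≡ lev n (a +ᵥ p +ᵥ lows ps)
      head = trans (cong (lev m a +_) (lev-+ (∈[1] p∈) (lows∈ asc))) (trans (sym (+-assoc (lev m a) _ _)) (sym (lev-head p∈ asc a∈ eq)))

    chain-lev< [] a∈ eq = [] ∷ []
    chain-lev< ((p∈ , q∈ , p<q) ∷ asc) {m} a∈ eq =
      chain-lev-tail p∈ q∈ p<q asc a∈ eq ∷ chain-lev< asc (∈[]-+ a∈ (∈[1] q∈)) (trans (+-assoc m 1 _) eq)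

  -- With r and r′ in kP, there are 2 (n - k) vertices in all; those not accounted for by m are equal to w.
  assemble : ℕ → ℤ^ D → ℤ^ D → ℤ^ D → Vec ℕ k → ℤ^ D
  assemble n w r r′ m = combination V m +ᵥ (2 * (n ∸ k) ∸ Vec.sum m) ×ᵥ w +ᵥ (r +ᵥ r′)

  -- Three uses of one pairing: `z≡` gives the parameters of the union bound, `summands` and
  -- `distinct` give many disjoint chances when the spread is large, and `z≡near` replaces them when
  -- it is small.
  record Representation (n : ℕ) (z : ℤ^ D) : Set where
    field
      {w r r′}  : ℤ^ D
      {m}       : Vec ℕ k
      w∈        : w ∈ V
      r∈        : r ∈[ k ]
      r′∈       : r′ ∈[ k ]
      {spread}  : ℕ
      sum-m     : Vec.sum m ≡ 2 * spread
      spread≤   : spread ≤ n ∸ k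
      z≡        : z ≡ assemble n w r r′ m
      {xs}      : List (ℤ^ D)
      length-xs : length xs ≡ suc spread
      summands  : All (Summand n z) xs
      distinct  : AllPairs (λ x y → lev n x < lev n y) xs
      z≡near    : ∀ {τ} → 2 * spread + (k + k) ≤ τ → τ ≤ n → ∃[ y ] Near w n τ y × z ≡ n ×ᵥ w +ᵥ y

  private
    -- Surplus parts are put back into the remainder: pairing off the vertices of two summands
    -- requires equally many of them.
    exact : ∀ {n x} → k ≤ n → x ∈[ n ] → ∃[ ws ] ∃[ r ] All (_∈ V) ws × r ∈[ k ] × length ws ≡ n ∸ k × x ≡ Σᵥ ws +ᵥ r
    exact {n} {x} k≤n x∈ with decomposition {ws} {r} {f} ws∈ r∈ f≤k refl refl ← decompose x∈ =
      List.take N ws , Σᵥ (List.drop N ws) +ᵥ r , All.take⁺ N ws∈ ,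
      ∈[]-cast size (∈[]-+ (∈[]-Σ (All.drop⁺ N ws∈)) r∈) ,
      trans (List.length-take N ws) (m≤n⇒m⊓n≡m N≤ws) ,
      trans (cong (_+ᵥ r) (trans (cong Σᵥ (sym (List.take++drop≡id N ws))) (Σᵥ-++ (List.take N ws) (List.drop N ws)))) (+ᵥ.assoc _ _ r)
      where
      N = n ∸ k
      N≤ws : N ≤ length ws
      N≤ws = m≤n+o⇒m∸n≤o n k (≤-trans (+-monoʳ-≤ (length ws) f≤k) (≤-reflexive (+-comm (length ws) k)))
      size : length (List.drop N ws) + f ≡ k
      size = +-cancelˡ-≡ N _ _ (begin
        N + (length (List.drop N ws) + f)  ≡⟨ cong (λ l → N + (l + f)) (List.length-drop N ws) ⟩
        N + (length ws ∸ N + f)  ≡⟨ +-assoc N (length ws ∸ N) f ⟨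
        N + (length ws ∸ N) + f  ≡⟨ cong (_+ f) (m+[n∸m]≡n N≤ws) ⟩
        n  ≡⟨ m∸n+n≡m k≤n ⟨
        N + k  ∎)
        where open ≡-Reasoning

  represent : ∀ {n x y} → k ≤ n → x ∈[ n ] → y ∈[ n ] → Representation n (x +ᵥ y)
  represent {n} {x} {y} k≤n x∈ y∈
    with ws , r , ws∈ , r∈ , |ws| , refl ← exact k≤n x∈
    with ws′ , r′ , ws′∈ , r′∈ , |ws′| , refl ← exact k≤n y∈
    with record { pairs = ps ; middle = w ; copies = c ; ascending = asc ; middle∈ = w∈ ; number = number ; sum = sum } ← pairing ws∈ ws′∈ (trans |ws| (sym |ws′|))
    with m , em , sm ← coefficients (All.++⁺ {xs = map proj₁ ps} {ys = map proj₂ ps} (All.map⁺ (All.map proj₁ asc)) (All.map⁺ (All.map (λ (_ , q∈ , _) → q∈) asc))) = record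
      { w∈ = w∈ ; r∈ = r∈ ; r′∈ = r′∈
      ; sum-m = sum-m
      ; spread≤ = ≤-trans (m≤m+n T c) (≤-reflexive T+c≡N)
      ; z≡ = trans z≡ (cong₂ (λ p q → p +ᵥ q ×ᵥ w +ᵥ (r +ᵥ r′)) (sym em′) (sym 2N∸))
      ; length-xs = length-chain a ps
      ; summands = chain-summands asc (∈[]-+ (∈[]-× w∈ c) r∈) (∈[]-+ (∈[]-× w∈ c) r′∈) c+k+T≡n a+b
      ; distinct = chain-lev< asc (∈[]-+ (∈[]-× w∈ c) r∈) c+k+T≡n
      ; z≡near = near
      }
    where
    open ≡-Reasoning
    T = length ps
    N = n ∸ k
    a = c ×ᵥ w +ᵥ r
    b = c ×ᵥ w +ᵥ r′
    z = Σᵥ ws +ᵥ r +ᵥ (Σᵥ ws′ +ᵥ r′)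
    T+c≡N : T + c ≡ N
    T+c≡N = trans number |ws|
    em′ : combination V m ≡ both ps
    em′ = trans em (Σᵥ-++ (map proj₁ ps) (map proj₂ ps))
    sum-m : Vec.sum m ≡ 2 * T
    sum-m = trans sm (trans (List.length-++ (map proj₁ ps)) (cong₂ _+_ (List.length-map proj₁ ps)
      (trans (List.length-map proj₂ ps) (sym (+-identityʳ T)))))
    2N∸ : 2 * N ∸ Vec.sum m ≡ c + c
    2N∸ = begin
      2 * N ∸ Vec.sum m  ≡⟨ cong₂ (λ p q → 2 * p ∸ q) (sym T+c≡N) sum-m ⟩
      2 * (T + c) ∸ 2 * T  ≡⟨ cong (_∸ 2 * T) (*-distribˡ-+ 2 T c) ⟩
      2 * T + 2 * c ∸ 2 * T  ≡⟨ m+n∸m≡n (2 * T) (2 * c) ⟩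
      2 * c  ≡⟨ cong (c +_) (+-identityʳ c) ⟩
      c + c  ∎
    z≡ : z ≡ both ps +ᵥ (c + c) ×ᵥ w +ᵥ (r +ᵥ r′)
    z≡ = trans (+ᵥ-interchange (Σᵥ ws) r (Σᵥ ws′) r′)
      (cong (_+ᵥ (r +ᵥ r′)) sum)
    c+k+T≡n : c + k + T ≡ n
    c+k+T≡n = trans (trans (rearrange c k T) (cong (_+ k) T+c≡N)) (m∸n+n≡m k≤n)
      where
      rearrange : ∀ c k t → c + k + t ≡ t + c + k
      rearrange = solve-∀
    a+b : a +ᵥ b +ᵥ both ps ≡ z
    a+b = sym (trans z≡ (trans (cong (λ q → both ps +ᵥ q +ᵥ (r +ᵥ r′)) (+ᵥ.×-homo-+ w c c))
      (+ᵥ.solve 4 (λ p c r q → (p ⊞ (c ⊞ c)) ⊞ (r ⊞ q) ⊜ ((c ⊞ r) ⊞ (c ⊞ q)) ⊞ p) refl (both ps) (c ×ᵥ w) r r′)))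
    near : ∀ {τ} → 2 * T + (k + k) ≤ τ → τ ≤ n → ∃[ y ] Near w n τ y × z ≡ n ×ᵥ w +ᵥ y
    near {τ} small τ≤n = j ×ᵥ w +ᵥ y₀ , near-pad w∈ j y₀∈ j+≡n small τ≤n , trans z≡ (trans
      (cong (λ q → both ps +ᵥ q +ᵥ (r +ᵥ r′)) (trans (cong (_×ᵥ w) (sym n+j)) (+ᵥ.×-homo-+ w n j)))
      (+ᵥ.solve 4 (λ p n j r → (p ⊞ (n ⊞ j)) ⊞ r ⊜ n ⊞ (j ⊞ (p ⊞ r))) refl (both ps) (n ×ᵥ w) (j ×ᵥ w) (r +ᵥ r′)))
      where
      size = 2 * T + (k + k)
      j = n ∸ size
      y₀ = both ps +ᵥ (r +ᵥ r′)
      y₀∈ : y₀ ∈[ size ]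
      y₀∈ = ∈[]-cast (cong (λ t → T + t + (k + k)) (sym (+-identityʳ T))) (∈[]-+ (∈[]-+ (lows∈ asc) (highs∈ asc)) (∈[]-+ r∈ r′∈))
      j+≡n : j + size ≡ n
      j+≡n = m∸n+n≡m (≤-trans small τ≤n)
      n+j : n + j ≡ c + c
      n+j = +-cancelʳ-≡ (2 * T + (k + k)) _ _ (begin
        n + j + size  ≡⟨ +-assoc n j size ⟩
        n + (j + size)  ≡⟨ cong (n +_) j+≡n ⟩
        n + n  ≡⟨ cong₂ _+_ c+k+T≡n c+k+T≡n ⟨
        c + k + T + (c + k + T)  ≡⟨ rearrange c k T ⟩
        c + c + size  ∎)
        where
        rearrange : ∀ c k t → c + k + t + (c + k + t) ≡ c + c + (2 * t + (k + k))
        rearrange = solve-∀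

-- Sums over all subsets of Fin n and over boxes of coefficient vectors

∑ₛ : ∀ n → (Subset n → ℕ) → ℕ
∑ₛ zero f = f []
∑ₛ (suc n) f = ∑ₛ n (λ B → f (false ∷ B)) + ∑ₛ n (λ B → f (true ∷ B))

∑ₛ-cong : ∀ n {f g : Subset n → ℕ} → (∀ B → f B ≡ g B) → ∑ₛ n f ≡ ∑ₛ n g
∑ₛ-cong zero h = h []
∑ₛ-cong (suc n) h = cong₂ _+_ (∑ₛ-cong n λ B → h (false ∷ B)) (∑ₛ-cong n λ B → h (true ∷ B))

∑ₛ-+ : ∀ n (f g : Subset n → ℕ) → ∑ₛ n (λ B → f B + g B) ≡ ∑ₛ n f + ∑ₛ n g
∑ₛ-+ zero f g = refl
∑ₛ-+ (suc n) f g = trans (cong₂ _+_ (∑ₛ-+ n _ _) (∑ₛ-+ n _ _)) (+-interchange (∑ₛ n _) (∑ₛ n _) (∑ₛ n _) (∑ₛ n _))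

∑ₛ-0 : ∀ n → ∑ₛ n (λ _ → 0) ≡ 0
∑ₛ-0 zero = refl
∑ₛ-0 (suc n) = cong₂ _+_ (∑ₛ-0 n) (∑ₛ-0 n)

∑ₛ-1 : ∀ n → ∑ₛ n (λ _ → 1) ≡ 2 ^ n
∑ₛ-1 zero = refl
∑ₛ-1 (suc n) = cong₂ _+_ (∑ₛ-1 n) (trans (∑ₛ-1 n) (sym (+-identityʳ (2 ^ n))))

set : ∀ {n} → Fin n → Bool → Subset n → Subset n
set i b B = B Vec.[ i ]≔ b

-- Conditioning on one bit. Overwriting the bit instead of deleting it keeps the index set, so the
-- conditioned sums are again sums over `Subset n`.
∑ₛ-set : ∀ {n} (i : Fin n) f → 2 * ∑ₛ n f ≡ ∑ₛ n (f ∘ set i true) + ∑ₛ n (f ∘ set i false)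
∑ₛ-set {suc n} zero f = lemma (∑ₛ n _) (∑ₛ n _)
  where
  lemma : ∀ a b → 2 * (a + b) ≡ b + b + (a + a)
  lemma = solve-∀
∑ₛ-set {suc n} (suc i) f = trans (*-distribˡ-+ 2 (∑ₛ n _) (∑ₛ n _))
  (trans (cong₂ _+_ (∑ₛ-set i (λ B → f (false ∷ B))) (∑ₛ-set i (λ B → f (true ∷ B)))) (+-interchange (∑ₛ n _) (∑ₛ n _) (∑ₛ n _) (∑ₛ n _)))

-- A point is either always present (nothing) or present according to one bit of the random subset.
Literal : ℕ → Set
Literal n = Maybe (Fin n)

holds : ∀ {n} → Subset n → Literal n → Bool
holds B nothing = true
holds B (just i) = lookup B i

-- Dependence on different bits. A point that is always present is apart from everything, itself
-- included.
Apart : ∀ {n} → Literal n → Literal n → Set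
Apart p q = ∀ i → p ≡ just i → q ≢ just i

miss : ∀ {n} → Literal n × Literal n → Subset n → ℕ
miss (p , q) B = if holds B p ∧ holds B q then 0 else 1

-- The indicator of the event that no pair is completely present. Divided by 2 ^ n, its sum over all
-- subsets is the probability of a miss.
misses : ∀ {n} → List (Literal n × Literal n) → Subset n → ℕ
misses [] B = 1
misses (pq ∷ ps) B = miss pq B * misses ps B

ApartPairs : ∀ {n} → Literal n × Literal n → Literal n × Literal n → Set
ApartPairs (p , q) (p′ , q′) = (Apart p p′ × Apart p q′) × (Apart q p′ × Apart q q′)

record Independent {n} (ps : List (Literal n × Literal n)) : Set where
  constructor independent
  field
    within  : All (λ (p , q) → Apart p q) ps
    between : AllPairs ApartPairs ps

private
  holds-set : ∀ {n} i b (B : Subset n) p → Apart (just i) p → holds (set i b B) p ≡ holds B p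
  holds-set i b B nothing apart = refl
  holds-set i b B (just j) apart = Vec.lookup∘update′ (λ { refl → apart i refl refl }) B b

  misses-set : ∀ {n} i b (B : Subset n) {ps} → All (λ (p , q) → Apart (just i) p × Apart (just i) q) ps →
    misses ps (set i b B) ≡ misses ps B
  misses-set i b B [] = refl
  misses-set i b B {(p , q) ∷ ps} ((ap , aq) ∷ as) = cong₂ _*_
    (cong₂ (λ s t → if s ∧ t then 0 else 1) (holds-set i b B p ap) (holds-set i b B q aq)) (misses-set i b B as)

  ∧-true : ∀ b → b ∧ true ≡ b
  ∧-true true = refl
  ∧-true false = refl

  module Toggle {n : ℕ} {ps : List (Literal n × Literal n)} where

    g = misses ps
    G = ∑ₛ n g

    half : ∀ i → All (λ (p , q) → Apart (just i) p × Apart (just i) q) ps →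
      2 * ∑ₛ n (λ B → (if lookup B i then 0 else 1) * g B) ≡ G
    half i ai = trans (∑ₛ-set i _) (cong₂ _+_
      (trans (∑ₛ-cong n λ B → cong (λ b → (if b then 0 else 1) * g (set i true B)) (Vec.lookup∘update i B true)) (∑ₛ-0 n))
      (∑ₛ-cong n λ B → trans (cong (λ b → (if b then 0 else 1) * g (set i false B)) (Vec.lookup∘update i B false))
        (trans (+-identityʳ _) (misses-set i false B ai))))

    four : ∀ {x} → 2 * x ≡ G → 4 * x ≤ 3 * G
    four {x} e = ≤-trans (≤-reflexive (trans (lemma x) (cong (2 *_) e))) (*-monoˡ-≤ G {2} {3} (s≤s (s≤s z≤n)))
      where
      lemma : ∀ x → 4 * x ≡ 2 * (2 * x)
      lemma = solve-∀

    -- A pair is incomplete with probability 3/4, 1/2 or 0 if two, one or none of its points are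
    -- random, and the remaining pairs do not read these bits.
    three-quarters : ∀ p q → Apart p q → All (ApartPairs (p , q)) ps → 4 * ∑ₛ n (misses ((p , q) ∷ ps)) ≤ 3 * G
    three-quarters nothing nothing _ _ = ≤-trans (≤-reflexive (cong (4 *_) (∑ₛ-0 n))) z≤n
    three-quarters (just i) nothing _ as = four {∑ₛ n (misses ((just i , nothing) ∷ ps))} (trans
      (cong (2 *_) (∑ₛ-cong n λ B → cong (λ b → (if b then 0 else 1) * g B) (∧-true (lookup B i)))) (half i (All.map proj₁ as)))
    three-quarters nothing (just j) _ as = four {∑ₛ n (misses ((nothing , just j) ∷ ps))} (half j (All.map proj₂ as))
    three-quarters (just i) (just j) ij as = ≤-reflexive (begin
      4 * F  ≡⟨ lemma₁ F ⟩
      2 * (2 * F)  ≡⟨ cong (2 *_) (∑ₛ-set i f) ⟩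
      2 * (∑ₛ n (f ∘ set i true) + ∑ₛ n (f ∘ set i false))  ≡⟨ cong₂ (λ s t → 2 * (s + t)) on off ⟩
      2 * (∑ₛ n (λ B → (if lookup B j then 0 else 1) * g B) + G)  ≡⟨ *-distribˡ-+ 2 (∑ₛ n (λ B → (if lookup B j then 0 else 1) * g B)) G ⟩
      2 * ∑ₛ n (λ B → (if lookup B j then 0 else 1) * g B) + 2 * G  ≡⟨ cong (_+ 2 * G) (half j (All.map proj₂ as)) ⟩
      G + 2 * G  ∎)
      where
      open ≡-Reasoning
      f = misses ((just i , just j) ∷ ps)
      F = ∑ₛ n f
      lemma₁ : ∀ x → 4 * x ≡ 2 * (2 * x)
      lemma₁ = solve-∀
      on : ∑ₛ n (f ∘ set i true) ≡ ∑ₛ n (λ B → (if lookup B j then 0 else 1) * g B)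
      on = ∑ₛ-cong n λ B → cong₂ _*_
        (cong₂ (λ s t → if s ∧ t then 0 else 1) (Vec.lookup∘update i B true) (holds-set i true B (just j) λ { m refl refl → ij m refl refl }))
        (misses-set i true B (All.map proj₁ as))
      off : ∑ₛ n (f ∘ set i false) ≡ G
      off = ∑ₛ-cong n λ B → trans (cong₂ _*_
        (cong (λ s → if s ∧ lookup (set i false B) j then 0 else 1) (Vec.lookup∘update i B false)) (misses-set i false B (All.map proj₁ as)))
        (+-identityʳ _)

misses-bound : ∀ {n} {ps : List (Literal n × Literal n)} → Independent ps → 4 ^ length ps * ∑ₛ n (misses ps) ≤ 3 ^ length ps * 2 ^ n
misses-bound {n} {[]} _ = +-monoˡ-≤ 0 (≤-reflexive (∑ₛ-1 n))
misses-bound {n} {(p , q) ∷ ps} (independent (within ∷ withins) (between ∷ betweens)) = begin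
  4 * 4 ^ r * ∑ₛ n (misses ((p , q) ∷ ps))  ≡⟨ lemma (4 ^ r) _ ⟩
  4 ^ r * (4 * ∑ₛ n (misses ((p , q) ∷ ps)))  ≤⟨ *-monoʳ-≤ (4 ^ r) (Toggle.three-quarters p q within between) ⟩
  4 ^ r * (3 * ∑ₛ n (misses ps))  ≡⟨ lemma₂ (4 ^ r) _ ⟩
  3 * (4 ^ r * ∑ₛ n (misses ps))  ≤⟨ *-monoʳ-≤ 3 (misses-bound (independent withins betweens)) ⟩
  3 * (3 ^ r * 2 ^ n)  ≡⟨ *-assoc 3 (3 ^ r) (2 ^ n) ⟨
  3 * 3 ^ r * 2 ^ n  ∎
  where
  open ≤-Reasoning
  r = length ps
  lemma : ∀ a b → 4 * a * b ≡ a * (4 * b)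
  lemma = solve-∀
  lemma₂ : ∀ a b → a * (3 * b) ≡ 3 * (a * b)
  lemma₂ = solve-∀

-- (3/4)³ ≤ 1/2
misses-bound-2^ : ∀ {n} {ps : List (Literal n × Literal n)} → Independent ps → ∀ c → 3 * c ≤ length ps → ∑ₛ n (misses ps) * 2 ^ c ≤ 2 ^ n
misses-bound-2^ {n} {ps} ind c 3c≤ = *-cancelˡ-≤ (3 ^ r) {{m^n≢0 3 r}} (begin
  3 ^ r * (S * 2 ^ c)  ≡⟨ lemma (3 ^ r) S (2 ^ c) ⟩
  3 ^ r * 2 ^ c * S  ≤⟨ *-monoˡ-≤ S powers ⟩
  4 ^ r * S  ≤⟨ misses-bound ind ⟩
  3 ^ r * 2 ^ n  ∎)
  where
  open ≤-Reasoning
  r = length ps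
  S = ∑ₛ n (misses ps)
  lemma : ∀ a b c → a * (b * c) ≡ a * c * b
  lemma = solve-∀
  ^-distrib-* : ∀ c → 54 ^ c ≡ 27 ^ c * 2 ^ c
  ^-distrib-* zero = refl
  ^-distrib-* (suc c) = trans (cong (54 *_) (^-distrib-* c)) (swap (27 ^ c) (2 ^ c))
    where
    swap : ∀ a b → 54 * (a * b) ≡ 27 * a * (2 * b)
    swap = solve-∀
  powers : 3 ^ r * 2 ^ c ≤ 4 ^ r
  powers = begin
    3 ^ r * 2 ^ c  ≡⟨ cong (λ x → 3 ^ x * 2 ^ c) (m∸n+n≡m 3c≤) ⟨
    3 ^ (r ∸ 3 * c + 3 * c) * 2 ^ c  ≡⟨ cong (_* 2 ^ c) (^-distribˡ-+-* 3 (r ∸ 3 * c) (3 * c)) ⟩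
    3 ^ (r ∸ 3 * c) * 3 ^ (3 * c) * 2 ^ c  ≡⟨ *-assoc (3 ^ (r ∸ 3 * c)) (3 ^ (3 * c)) (2 ^ c) ⟩
    3 ^ (r ∸ 3 * c) * (3 ^ (3 * c) * 2 ^ c)  ≡⟨ cong (λ x → 3 ^ (r ∸ 3 * c) * (x * 2 ^ c)) (^-*-assoc 3 3 c) ⟨
    3 ^ (r ∸ 3 * c) * (27 ^ c * 2 ^ c)  ≡⟨ cong (3 ^ (r ∸ 3 * c) *_) (^-distrib-* c) ⟨
    3 ^ (r ∸ 3 * c) * 54 ^ c  ≤⟨ *-mono-≤ (^-monoˡ-≤ (r ∸ 3 * c) (n≤1+n 3)) (^-monoˡ-≤ c (m≤m+n 54 10)) ⟩
    4 ^ (r ∸ 3 * c) * 64 ^ c  ≡⟨ cong (4 ^ (r ∸ 3 * c) *_) (^-*-assoc 4 3 c) ⟩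
    4 ^ (r ∸ 3 * c) * 4 ^ (3 * c)  ≡⟨ ^-distribˡ-+-* 4 (r ∸ 3 * c) (3 * c) ⟨
    4 ^ (r ∸ 3 * c + 3 * c)  ≡⟨ cong (4 ^_) (m∸n+n≡m 3c≤) ⟩
    4 ^ r  ∎

-- Sums over lists, Markov's inequality and geometric series

Σ[_]_ : ∀ {A : Set} → List A → (A → ℕ) → ℕ
Σ[ xs ] f = Σℕ (map f xs)

module _ {A : Set} where

  Σ-≤ : ∀ {xs : List A} {f c} → (∀ {x} → x ∈ xs → f x ≤ c) → Σ[ xs ] f ≤ length xs * c
  Σ-≤ {[]} h = z≤n
  Σ-≤ {x ∷ xs} h = +-mono-≤ (h (here refl)) (Σ-≤ {xs} (h ∘ there))

  Σ-member : ∀ {xs : List A} {x} f → x ∈ xs → f x ≤ Σ[ xs ] f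
  Σ-member f (here refl) = m≤m+n _ _
  Σ-member {y ∷ xs} f (there i) = ≤-trans (Σ-member f i) (m≤n+m _ (f y))

  Σ-*ʳ : ∀ (xs : List A) f c → Σ[ xs ] (λ x → f x * c) ≡ Σ[ xs ] f * c
  Σ-*ʳ [] f c = refl
  Σ-*ʳ (x ∷ xs) f c = trans (cong (f x * c +_) (Σ-*ʳ xs f c)) (sym (*-distribʳ-+ c (f x) _))

  ∑ₛ-Σ : ∀ n (xs : List A) (f : A → Subset n → ℕ) → ∑ₛ n (λ B → Σ[ xs ] (λ x → f x B)) ≡ Σ[ xs ] (λ x → ∑ₛ n (f x))
  ∑ₛ-Σ n [] f = ∑ₛ-0 n
  ∑ₛ-Σ n (x ∷ xs) f = trans (∑ₛ-+ n (f x) _) (cong (∑ₛ n (f x) +_) (∑ₛ-Σ n xs f))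

  length≤zeros+Σ : ∀ (xs : List A) f → length xs ≤ length (filter (λ x → f x ≟ⁿ 0) xs) + Σ[ xs ] f
  length≤zeros+Σ [] f = z≤n
  length≤zeros+Σ (x ∷ xs) f with f x in eq
  ... | zero = s≤s (length≤zeros+Σ xs f)
  ... | suc m = ≤-trans (s≤s (≤-trans (length≤zeros+Σ xs f) (+-monoʳ-≤ (length (filter (λ x → f x ≟ⁿ 0) xs)) (m≤n+m (Σ[ xs ] f) m)))) (≤-reflexive (sym (+-suc (length (filter (λ x → f x ≟ⁿ 0) xs)) (m + Σ[ xs ] f))))

subsets : ∀ n → List (Subset n)
subsets zero = [] ∷ []
subsets (suc n) = map (false ∷_) (subsets n) ++ map (true ∷_) (subsets n)

subsets-unique : ∀ n → Unique (subsets n)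
subsets-unique zero = [] ∷ []
subsets-unique (suc n) = Unique.++⁺ (Unique.map⁺ Vec.∷-injectiveʳ (subsets-unique n)) (Unique.map⁺ Vec.∷-injectiveʳ (subsets-unique n))
  disjoint
  where
  disjoint : ∀ {B} → ¬ (B ∈ map (false ∷_) (subsets n) × B ∈ map (true ∷_) (subsets n))
  disjoint (B∈ , B∈′) with _ , _ , refl ← ∈-map⁻ _ B∈ | _ , _ , () ← ∈-map⁻ _ B∈′

length-subsets : ∀ n → length (subsets n) ≡ 2 ^ n
length-subsets zero = refl
length-subsets (suc n) = trans (List.length-++ (map (false ∷_) (subsets n)))
  (cong₂ _+_ (trans (List.length-map _ (subsets n)) (length-subsets n)) (trans (trans (List.length-map _ (subsets n)) (length-subsets n)) (sym (+-identityʳ _))))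

Σ-subsets : ∀ n f → Σ[ subsets n ] f ≡ ∑ₛ n f
Σ-subsets zero f = +-identityʳ (f [])
Σ-subsets (suc n) f = begin
  Σℕ (map f (map (false ∷_) (subsets n) ++ map (true ∷_) (subsets n)))
    ≡⟨ cong Σℕ (List.map-++ f (map (false ∷_) (subsets n)) _) ⟩
  Σℕ (map f (map (false ∷_) (subsets n)) ++ map f (map (true ∷_) (subsets n)))
    ≡⟨ sum-++ (map f (map (false ∷_) (subsets n))) _ ⟩
  Σℕ (map f (map (false ∷_) (subsets n))) + Σℕ (map f (map (true ∷_) (subsets n)))
    ≡⟨ cong₂ (λ p q → Σℕ p + Σℕ q) (sym (List.map-∘ (subsets n))) (sym (List.map-∘ (subsets n))) ⟩
  Σ[ subsets n ] (λ B → f (false ∷ B)) + Σ[ subsets n ] (λ B → f (true ∷ B))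
    ≡⟨ cong₂ _+_ (Σ-subsets n _) (Σ-subsets n _) ⟩
  ∑ₛ n (λ B → f (false ∷ B)) + ∑ₛ n (λ B → f (true ∷ B)) ∎
  where open ≡-Reasoning

-- Markov's inequality: a natural number other than 0 is at least 1, so a mean of at most 1/2 leaves
-- at most half of the subsets with a nonzero value.
half-zeros : ∀ n (f : Subset n → ℕ) → 2 * ∑ₛ n f ≤ 2 ^ n → 2 ^ n ≤ 2 * length (filter (λ B → f B ≟ⁿ 0) (subsets n))
half-zeros n f small = +-cancelʳ-≤ (2 ^ n) _ _ (begin
  2 ^ n + 2 ^ n  ≡⟨ cong (2 ^ n +_) (+-identityʳ _) ⟨
  2 * 2 ^ n  ≡⟨ cong (2 *_) (length-subsets n) ⟨
  2 * length (subsets n)  ≤⟨ *-monoʳ-≤ 2 (length≤zeros+Σ (subsets n) f) ⟩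
  2 * (z + Σ[ subsets n ] f)  ≡⟨ cong (λ s → 2 * (z + s)) (Σ-subsets n f) ⟩
  2 * (z + ∑ₛ n f)  ≡⟨ *-distribˡ-+ 2 z (∑ₛ n f) ⟩
  2 * z + 2 * ∑ₛ n f  ≤⟨ +-monoʳ-≤ (2 * z) small ⟩
  2 * z + 2 ^ n  ∎)
  where
  open ≤-Reasoning
  z = length (filter (λ B → f B ≟ⁿ 0) (subsets n))

-- A box and not a simplex of vectors with bounded sum, because only over a box does the sum factor
-- into one-dimensional sums.
box : ℕ → ∀ k → List (Vec ℕ k)
box K zero = [] ∷ []
box K (suc k) = concatMap (λ j → map (j ∷_) (box K k)) (upTo K)

∈-box : ∀ {K k} (m : Vec ℕ k) → Vec.sum m < K → m ∈ box K k
∈-box [] _ = here refl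
∈-box {K} {suc k} (j ∷ m) small = List-concatMap⁺ (∈-upTo⁺ (≤-<-trans (m≤m+n j _) small)) (∈-map⁺ (j ∷_) (∈-box m (≤-<-trans (m≤n+m _ j) small)))
  where
  List-concatMap⁺ : ∀ {x} → x ∈ upTo K → (x ∷ m) ∈ map (x ∷_) (box K k) → (x ∷ m) ∈ box K (suc k)
  List-concatMap⁺ x∈ y∈ = Any.concat⁺ (Any.map⁺ (Any.map (λ { refl → y∈ }) x∈))

private
  Σ-applyUpTo-+ : ∀ f a b → Σℕ (List.applyUpTo f (a + b)) ≡ Σℕ (List.applyUpTo f a) + Σℕ (List.applyUpTo (λ j → f (a + j)) b)
  Σ-applyUpTo-+ f zero b = refl
  Σ-applyUpTo-+ f (suc a) b = trans (cong (f 0 +_) (Σ-applyUpTo-+ (f ∘ suc) a b)) (sym (+-assoc (f 0) _ _))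

  Σ-applyUpTo-≤ : ∀ f a {c} → (∀ j → f j ≤ c) → Σℕ (List.applyUpTo f a) ≤ a * c
  Σ-applyUpTo-≤ f zero h = z≤n
  Σ-applyUpTo-≤ f (suc a) h = +-mono-≤ (h 0) (Σ-applyUpTo-≤ (f ∘ suc) a (h ∘ suc))

  -- The first 24 terms sum to at most 24 G. Twice the shifted function satisfies the same
  -- hypothesis, so the remaining terms sum to at most half of 48 G.
  geometric-blocks : ∀ b f G → (∀ j → f j * 2 ^ (j / 24) ≤ G) → Σℕ (List.applyUpTo f (b * 24)) ≤ 48 * G
  geometric-blocks zero f G h = z≤n
  geometric-blocks (suc b) f G h = begin
    Σℕ (List.applyUpTo f (24 + b * 24))  ≡⟨ Σ-applyUpTo-+ f 24 (b * 24) ⟩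
    Σℕ (List.applyUpTo f 24) + Σℕ (List.applyUpTo f′ (b * 24))  ≤⟨ +-mono-≤ (Σ-applyUpTo-≤ f 24 first) rest ⟩
    24 * G + 24 * G  ≡⟨ *-distribʳ-+ G 24 24 ⟨
    48 * G  ∎
    where
    open ≤-Reasoning
    f′ : ℕ → ℕ
    f′ j = f (24 + j)
    first : ∀ j → f j ≤ G
    first j = ≤-trans (m≤m*n (f j) (2 ^ (j / 24)) {{m^n≢0 2 (j / 24)}}) (h j)
    doubled : ∀ j → 2 * f′ j * 2 ^ (j / 24) ≤ G
    doubled j = ≤-trans (≤-reflexive (trans (lemma (f′ j) (2 ^ (j / 24)))
      (cong (λ e → f′ j * 2 ^ e) (sym (DivMod.+-distrib-/-∣ˡ j {24} ∣-refl))))) (h (24 + j))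
      where
      lemma : ∀ a b → 2 * a * b ≡ a * (2 * b)
      lemma = solve-∀
    Σ-double : ∀ g n → Σℕ (List.applyUpTo (λ j → 2 * g j) n) ≡ 2 * Σℕ (List.applyUpTo g n)
    Σ-double g zero = refl
    Σ-double g (suc n) = trans (cong (2 * g 0 +_) (Σ-double (g ∘ suc) n)) (sym (*-distribˡ-+ 2 (g 0) _))
    rest : Σℕ (List.applyUpTo f′ (b * 24)) ≤ 24 * G
    rest = *-cancelˡ-≤ 2 (≤-trans (≤-reflexive (sym (Σ-double f′ (b * 24))))
      (≤-trans (geometric-blocks b (λ j → 2 * f′ j) G doubled) (≤-reflexive (lemma G))))
      where
      lemma : ∀ g → 48 * g ≡ 2 * (24 * g)
      lemma = solve-∀

  geometric : ∀ K f G → (∀ j → f j * 2 ^ (j / 24) ≤ G) → Σ[ upTo K ] f ≤ 48 * G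
  geometric K f G h = begin
    Σℕ (map f (upTo K))  ≡⟨ cong Σℕ (List.map-upTo f K) ⟩
    Σℕ (List.applyUpTo f K)  ≤⟨ m≤m+n _ _ ⟩
    Σℕ (List.applyUpTo f K) + _  ≡⟨ Σ-applyUpTo-+ f K (K * 23) ⟨
    Σℕ (List.applyUpTo f (K + K * 23))  ≡⟨ cong (λ n → Σℕ (List.applyUpTo f n)) (*-suc K 23) ⟨
    Σℕ (List.applyUpTo f (K * 24))  ≤⟨ geometric-blocks K f G h ⟩
    48 * G  ∎
    where open ≤-Reasoning

-- Each entry is rounded separately, so that 2 ^ weight is a product over the entries. The divisor
-- 24 is dictated by the estimate in `far`.
weight : ∀ {k} → Vec ℕ k → ℕ
weight m = Vec.sum (Vec.map (_/ 24) m)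

weight≤ : ∀ {k} (m : Vec ℕ k) → weight m * 24 ≤ Vec.sum m
weight≤ [] = z≤n
weight≤ (j ∷ m) = ≤-trans (≤-reflexive (*-distribʳ-+ 24 (j / 24) (weight m))) (+-mono-≤ (m/n*n≤m j 24) (weight≤ m))

Σ-box-≤ : ∀ K k (f : Vec ℕ k → ℕ) G → (∀ m → f m * 2 ^ weight m ≤ G) → Σ[ box K k ] f ≤ 48 ^ k * G
Σ-box-≤ K zero f G h = +-monoˡ-≤ 0 (≤-trans (≤-reflexive (sym (*-identityʳ (f [])))) (h []))
Σ-box-≤ K (suc k) f G h = begin
  Σ[ box K (suc k) ] f  ≡⟨ Σ-concatMap (upTo K) ⟩
  Σ[ upTo K ] (λ j → Σ[ box K k ] (λ m → f (j ∷ m)))  ≤⟨ geometric K _ (48 ^ k * G) slice ⟩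
  48 * (48 ^ k * G)  ≡⟨ *-assoc 48 (48 ^ k) G ⟨
  48 ^ suc k * G  ∎
  where
  open ≤-Reasoning
  Σ-concatMap : ∀ js → Σ[ concatMap (λ j → map (j ∷_) (box K k)) js ] f ≡ Σ[ js ] (λ j → Σ[ box K k ] (λ m → f (j ∷ m)))
  Σ-concatMap [] = refl
  Σ-concatMap (j ∷ js) = trans (cong Σℕ (List.map-++ f (map (j ∷_) (box K k)) _))
    (trans (sum-++ (map f (map (j ∷_) (box K k))) _) (cong₂ _+_ (cong Σℕ (sym (List.map-∘ (box K k)))) (Σ-concatMap js)))
  slice : ∀ j → Σ[ box K k ] (λ m → f (j ∷ m)) * 2 ^ (j / 24) ≤ 48 ^ k * G
  slice j = ≤-trans (≤-reflexive (sym (Σ-*ʳ (box K k) _ (2 ^ (j / 24)))))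
    (Σ-box-≤ K k (λ m → f (j ∷ m) * 2 ^ (j / 24)) G λ m → ≤-trans (≤-reflexive (trans (*-assoc (f (j ∷ m)) _ _)
      (cong (f (j ∷ m) *_) (sym (^-distribˡ-+-* 2 (j / 24) (weight m)))))) (h (j ∷ m)))

-- Fourier–Motzkin elimination for weak linear inequalities over ℚ. Feasibility is decided in the strong sense needed
-- for constructive reals: an infeasible system is not even satisfied up to ε by sequences of rational points.

∑ℚ : ∀ {k} → (Fin k → ℚ) → ℚ
∑ℚ = foldr ℚ._+_ 0ℚ

∑ℚ-cong : ∀ {k} {f g : Fin k → ℚ} → (∀ i → f i ≡ g i) → ∑ℚ f ≡ ∑ℚ g
∑ℚ-cong {zero} h = refl
∑ℚ-cong {suc k} h = cong₂ ℚ._+_ (h zero) (∑ℚ-cong (h ∘ suc))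

∑ℚ-+ : ∀ {k} (f g : Fin k → ℚ) → ∑ℚ (λ i → f i ℚ.+ g i) ≡ ∑ℚ f ℚ.+ ∑ℚ g
∑ℚ-+ {zero} f g = sym (ℚ.+-identityʳ 0ℚ)
∑ℚ-+ {suc k} f g = trans (cong (ℚ._+_ (f zero ℚ.+ g zero)) (∑ℚ-+ (f ∘ suc) (g ∘ suc)))
  (solve 4 (λ a b c d → (a :+ b) :+ (c :+ d) := (a :+ c) :+ (b :+ d)) refl (f zero) (g zero) (∑ℚ (f ∘ suc)) (∑ℚ (g ∘ suc)))
  where open +-*-Solver

∑ℚ-*ˡ : ∀ {k} p (f : Fin k → ℚ) → ∑ℚ (λ i → p ℚ.* f i) ≡ p ℚ.* ∑ℚ f
∑ℚ-*ˡ {zero} p f = sym (ℚ.*-zeroʳ p)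
∑ℚ-*ˡ {suc k} p f = trans (cong (ℚ._+_ (p ℚ.* f zero)) (∑ℚ-*ˡ p (f ∘ suc))) (sym (ℚ.*-distribˡ-+ p (f zero) _))

-- The limit inferior is at least 0. This is stable under sums and positive multiples, the
-- operations by which inequalities are eliminated.
Nonneg∞ : (ℕ → ℚ) → Set
Nonneg∞ g = ∀ ε → 0ℚ ℚ.< ε → ∃[ N ] ∀ n → N ≤ n → 0ℚ ℚ.< g n ℚ.+ ε

Nonneg∞-cong : ∀ {f g} → (∀ n → f n ≡ g n) → Nonneg∞ f → Nonneg∞ g
Nonneg∞-cong h nn ε 0<ε with N , p ← nn ε 0<ε = N , λ n N≤n → subst (λ x → 0ℚ ℚ.< x ℚ.+ ε) (h n) (p n N≤n)

Nonneg∞-+ : ∀ {f g} → Nonneg∞ f → Nonneg∞ g → Nonneg∞ (λ n → f n ℚ.+ g n)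
Nonneg∞-+ {f} {g} nf ng ε 0<ε = M ⊔ N , λ n M⊔N≤n → subst₂ ℚ._<_ (ℚ.+-identityʳ 0ℚ) (regroup (f n) (g n))
    (ℚ.+-mono-< (p n (≤-trans (m≤m⊔n M N) M⊔N≤n)) (q n (≤-trans (m≤n⊔m M N) M⊔N≤n)))
  where
  open +-*-Solver
  0<½ε : 0ℚ ℚ.< ℚ.½ ℚ.* ε
  0<½ε = subst (ℚ._< ℚ.½ ℚ.* ε) (ℚ.*-zeroʳ ℚ.½) (ℚ.*-monoʳ-<-pos ℚ.½ 0<ε)
  M = proj₁ (nf (ℚ.½ ℚ.* ε) 0<½ε)
  N = proj₁ (ng (ℚ.½ ℚ.* ε) 0<½ε)
  p = proj₂ (nf (ℚ.½ ℚ.* ε) 0<½ε)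
  q = proj₂ (ng (ℚ.½ ℚ.* ε) 0<½ε)
  regroup : ∀ a b → a ℚ.+ ℚ.½ ℚ.* ε ℚ.+ (b ℚ.+ ℚ.½ ℚ.* ε) ≡ a ℚ.+ b ℚ.+ ε
  regroup a b = trans (solve 4 (λ a b h e → (a :+ h :* e) :+ (b :+ h :* e) := (a :+ b) :+ (h :+ h) :* e) refl a b ℚ.½ ε)
    (cong (ℚ._+_ (a ℚ.+ b)) (ℚ.*-identityˡ ε))

record PositivePair (c r : ℚ) : Set where
  field
    0<c : 0ℚ ℚ.< c
    0<r : 0ℚ ℚ.< r
    c*r≡1 : c ℚ.* r ≡ 1ℚ

  r*[c*x] : ∀ x → r ℚ.* (c ℚ.* x) ≡ x
  r*[c*x] x = trans (sym (ℚ.*-assoc r c x)) (trans (cong (ℚ._* x) (trans (ℚ.*-comm r c) c*r≡1)) (ℚ.*-identityˡ x))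

  c*[r*x] : ∀ x → c ℚ.* (r ℚ.* x) ≡ x
  c*[r*x] x = trans (sym (ℚ.*-assoc c r x)) (trans (cong (ℚ._* x) c*r≡1) (ℚ.*-identityˡ x))

0<* : ∀ {p q} → 0ℚ ℚ.< p → 0ℚ ℚ.< q → 0ℚ ℚ.< p ℚ.* q
0<* {p} {q} 0<p 0<q = subst (ℚ._< p ℚ.* q) (ℚ.*-zeroʳ p) (ℚ.*-monoʳ-<-pos p {{ℚ.positive 0<p}} 0<q)

0≤* : ∀ {p q} → 0ℚ ℚ.≤ p → 0ℚ ℚ.≤ q → 0ℚ ℚ.≤ p ℚ.* q
0≤* {p} {q} 0≤p 0≤q = subst (ℚ._≤ p ℚ.* q) (ℚ.*-zeroʳ p) (ℚ.*-monoˡ-≤-nonNeg p {{ℚ.nonNegative 0≤p}} 0≤q)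

positivePair : ∀ {c} → 0ℚ ℚ.< c → ∃[ r ] PositivePair c r
positivePair {c} 0<c = ℚ.1/ c , record
  { 0<c = 0<c
  ; 0<r = ℚ.positive⁻¹ (ℚ.1/ c) {{ℚ.1/pos⇒pos c}}
  ; c*r≡1 = ℚ.*-inverseʳ c }
  where
  instance
    c>0 : ℚ.Positive c
    c>0 = ℚ.positive 0<c
    c≢0 : ℚ.NonZero c
    c≢0 = ℚ.pos⇒nonZero c

Nonneg∞-*ˡ : ∀ {c f} → 0ℚ ℚ.< c → Nonneg∞ f → Nonneg∞ (λ n → c ℚ.* f n)
Nonneg∞-*ˡ {c} {f} 0<c nf ε 0<ε with r , pp ← positivePair 0<c with N , p ← nf (r ℚ.* ε) (0<* (PositivePair.0<r pp) 0<ε) =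
  N , λ n N≤n → subst (0ℚ ℚ.<_) (trans (ℚ.*-distribˡ-+ c (f n) (r ℚ.* ε)) (cong (ℚ._+_ (c ℚ.* f n)) (PositivePair.c*[r*x] pp ε))) (0<* 0<c (p n N≤n))

Nonneg∞-const : ∀ {q} → Nonneg∞ (λ _ → q) → 0ℚ ℚ.≤ q
Nonneg∞-const {q} nn = ℚ.≮⇒≥ λ q<0 →
  let N , p = nn (ℚ.- q) (ℚ.neg-antimono-< q<0)
  in ℚ.<-irrefl (sym (ℚ.+-inverseʳ q)) (p N ≤-refl)

-- The affine function b + Σ aᵢ xᵢ
Form : ℕ → Set
Form k = ℚ × (Fin k → ℚ)

eval : ∀ {k} → Form k → (Fin k → ℚ) → ℚ
eval (b , a) x = b ℚ.+ ∑ℚ (λ i → a i ℚ.* x i)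

infixl 6 _+ᶠ_
infixl 7 _*ᶠ_

_+ᶠ_ : ∀ {k} → Form k → Form k → Form k
(b , a) +ᶠ (b′ , a′) = b ℚ.+ b′ , λ i → a i ℚ.+ a′ i

_*ᶠ_ : ∀ {k} → ℚ → Form k → Form k
p *ᶠ (b , a) = p ℚ.* b , λ i → p ℚ.* a i

eval-+ : ∀ {k} (f g : Form k) x → eval (f +ᶠ g) x ≡ eval f x ℚ.+ eval g x
eval-+ (b , a) (b′ , a′) x = trans
  (cong (ℚ._+_ (b ℚ.+ b′)) (trans (∑ℚ-cong λ i → ℚ.*-distribʳ-+ (x i) (a i) (a′ i)) (∑ℚ-+ (λ i → a i ℚ.* x i) (λ i → a′ i ℚ.* x i))))
  (solve 4 (λ b b′ s s′ → (b :+ b′) :+ (s :+ s′) := (b :+ s) :+ (b′ :+ s′)) refl b b′ (∑ℚ λ i → a i ℚ.* x i) (∑ℚ λ i → a′ i ℚ.* x i))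
  where open +-*-Solver

eval-* : ∀ {k} p (f : Form k) x → eval (p *ᶠ f) x ≡ p ℚ.* eval f x
eval-* p (b , a) x = trans
  (cong (ℚ._+_ (p ℚ.* b)) (trans (∑ℚ-cong λ i → ℚ.*-assoc p (a i) (x i)) (∑ℚ-*ˡ p (λ i → a i ℚ.* x i))))
  (sym (ℚ.*-distribˡ-+ p b _))

_≤0≤_ : ∀ {k} → (Fin k → ℚ) → Form k → Set
x ≤0≤ f = 0ℚ ℚ.≤ eval f x

private
  module _ {k : ℕ} where

    tail : Form (suc k) → Form k
    tail (b , a) = b , a ∘ suc

    cons : ℚ → (Fin k → ℚ) → Fin (suc k) → ℚ
    cons x₀ x zero = x₀
    cons x₀ x (suc i) = x i

    eval-suc : ∀ f x → eval f x ≡ proj₂ f zero ℚ.* x zero ℚ.+ eval (tail f) (x ∘ suc)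
    eval-suc (b , a) x = solve 3 (λ b c s → b :+ (c :+ s) := c :+ (b :+ s)) refl b (a zero ℚ.* x zero) (∑ℚ λ i → a (suc i) ℚ.* x (suc i))
      where open +-*-Solver

    -- The system normalised as 0 ≤ z, 0 ≤ x₀ + g and 0 ≤ h - x₀ with z, g, h not involving x₀.
    record Normalised (S : List (Form (suc k))) : Set where
      field
        zs gs hs : List (Form k)
        sound    : ∀ x₀ x → All (x ≤0≤_) zs → All (λ g → ℚ.- eval g x ℚ.≤ x₀) gs → All (λ h → x₀ ℚ.≤ eval h x) hs → All (cons x₀ x ≤0≤_) S
        approx   : ∀ (y : ℕ → Fin (suc k) → ℚ) → All (λ f → Nonneg∞ (λ n → eval f (y n))) S →
          All (λ f → Nonneg∞ (λ n → eval f (y n ∘ suc))) zs × All (λ g → Nonneg∞ (λ n → y n zero ℚ.+ eval g (y n ∘ suc))) gs ×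
          All (λ h → Nonneg∞ (λ n → eval h (y n ∘ suc) ℚ.- y n zero)) hs

    normalise : ∀ S → Normalised S
    normalise [] = record { zs = [] ; gs = [] ; hs = [] ; sound = λ _ _ _ _ _ → [] ; approx = λ _ _ → [] , [] , [] }
    normalise (f ∷ S) with record { zs = zs ; gs = gs ; hs = hs ; sound = sound ; approx = approx } ← normalise S | ℚ.<-cmp 0ℚ (proj₂ f zero)
    ... | tri≈ _ 0≡c _ = record
      { zs = tail f ∷ zs ; gs = gs ; hs = hs
      ; sound = λ { x₀ x (z ∷ zx) gx hx → subst (0ℚ ℚ.≤_) (sym (eq (cons x₀ x))) z ∷ sound x₀ x zx gx hx }
      ; approx = λ { y (ny ∷ nys) → let zy , gy , hy = approx y nys in Nonneg∞-cong (λ n → eq (y n)) ny ∷ zy , gy , hy } }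
      where
      eq : ∀ x → eval f x ≡ eval (tail f) (x ∘ suc)
      eq x = trans (eval-suc f x) (trans (cong (λ c → c ℚ.* x zero ℚ.+ eval (tail f) (x ∘ suc)) (sym 0≡c))
        (trans (cong (ℚ._+ eval (tail f) (x ∘ suc)) (ℚ.*-zeroˡ (x zero))) (ℚ.+-identityˡ _)))
    ... | tri< 0<c _ _ with r , pp ← positivePair 0<c = record
      { zs = zs ; gs = g ∷ gs ; hs = hs
      ; sound = λ { x₀ x zx (gx ∷ gxs) hx → subst (0ℚ ℚ.≤_) (sym (eq (cons x₀ x))) (0≤* (ℚ.<⇒≤ 0<c) (move gx)) ∷ sound x₀ x zx gxs hx }
      ; approx = λ { y (ny ∷ nys) → let zy , gy , hy = approx y nys in
          zy , Nonneg∞-cong (λ n → r*[c*x] (y n zero ℚ.+ eval g (y n ∘ suc))) (Nonneg∞-*ˡ 0<r (Nonneg∞-cong (λ n → eq (y n)) ny)) ∷ gy , hy } }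
      where
      open PositivePair pp using (0<r; r*[c*x]; c*[r*x])
      c = proj₂ f zero
      g = r *ᶠ tail f
      move : ∀ {x₀ p} → ℚ.- p ℚ.≤ x₀ → 0ℚ ℚ.≤ x₀ ℚ.+ p
      move {x₀} {p} le = subst (ℚ._≤ x₀ ℚ.+ p) (ℚ.+-inverseˡ p) (ℚ.+-monoˡ-≤ p le)
      eq : ∀ x → eval f x ≡ c ℚ.* (x zero ℚ.+ eval g (x ∘ suc))
      eq x = trans (eval-suc f x) (sym (trans (ℚ.*-distribˡ-+ c (x zero) (eval g (x ∘ suc))) (cong (ℚ._+_ (c ℚ.* x zero))
        (trans (cong (ℚ._*_ c) (eval-* r (tail f) (x ∘ suc))) (c*[r*x] _)))))
    ... | tri> _ _ c<0 with r , pp ← positivePair (ℚ.neg-antimono-< c<0) = record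
      { zs = zs ; gs = gs ; hs = h ∷ hs
      ; sound = λ { x₀ x zx gx (hx ∷ hxs) → subst (0ℚ ℚ.≤_) (sym (eq (cons x₀ x))) (0≤* (ℚ.<⇒≤ 0<c) (move hx)) ∷ sound x₀ x zx gx hxs }
      ; approx = λ { y (ny ∷ nys) → let zy , gy , hy = approx y nys in
          zy , gy , Nonneg∞-cong (λ n → r*[c*x] (eval h (y n ∘ suc) ℚ.- y n zero)) (Nonneg∞-*ˡ 0<r (Nonneg∞-cong (λ n → eq (y n)) ny)) ∷ hy } }
      where
      open PositivePair pp using (0<c; 0<r; r*[c*x]; c*[r*x])
      open +-*-Solver
      c = proj₂ f zero
      h = r *ᶠ tail f
      move : ∀ {x₀ p} → x₀ ℚ.≤ p → 0ℚ ℚ.≤ p ℚ.- x₀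
      move {x₀} {p} le = subst (ℚ._≤ p ℚ.- x₀) (ℚ.+-inverseʳ x₀) (ℚ.+-monoˡ-≤ (ℚ.- x₀) le)
      eq : ∀ x → eval f x ≡ (ℚ.- c) ℚ.* (eval h (x ∘ suc) ℚ.- x zero)
      eq x = trans (eval-suc f x) (sym (trans
        (solve 3 (λ c e x₀ → (:- c) :* (e :- x₀) := c :* x₀ :+ (:- c) :* e) refl c (eval h (x ∘ suc)) (x zero)) (cong (ℚ._+_ (c ℚ.* x zero))
        (trans (cong (ℚ._*_ (ℚ.- c)) (eval-* r (tail f) (x ∘ suc))) (c*[r*x] _)))))

  0≤p+q⇒-p≤q : ∀ {p q} → 0ℚ ℚ.≤ p ℚ.+ q → ℚ.- p ℚ.≤ q
  0≤p+q⇒-p≤q {p} {q} le = subst₂ ℚ._≤_ (ℚ.+-identityʳ (ℚ.- p)) (solve 2 (λ p q → (:- p) :+ (p :+ q) := q) refl p q) (ℚ.+-monoʳ-≤ (ℚ.- p) le)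
    where open +-*-Solver

  below : ∀ us → ∃[ x ] All (λ u → x ℚ.≤ u) us
  below [] = 0ℚ , []
  below (u ∷ us) with x , x≤ ← below us = u ℚ.⊓ x , ℚ.p⊓q≤p u x ∷ All.map (ℚ.≤-trans (ℚ.p⊓q≤q u x)) x≤

  between : ∀ ls us → All (λ l → All (λ u → l ℚ.≤ u) us) ls → ∃[ x ] All (λ l → l ℚ.≤ x) ls × All (λ u → x ℚ.≤ u) us
  between [] us [] with x , x≤ ← below us = x , [] , x≤
  between (l ∷ ls) us (l≤ ∷ ls≤) with x , ls≤x , x≤us ← between ls us ls≤ =
    l ℚ.⊔ x , ℚ.p≤p⊔q l x ∷ All.map (λ le → ℚ.≤-trans le (ℚ.p≤q⊔p l x)) ls≤x ,
    All.zipWith (λ (a , b) → ℚ.⊔-lub a b) (l≤ , x≤us)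

private
  All-product⁺ : ∀ {A : Set} {P : A → Set} (f : A → A → A) {xs ys} → (∀ {x y} → x ∈ xs → y ∈ ys → P (f x y)) → All P (cartesianProductWith f xs ys)
  All-product⁺ f {xs} {ys} h = All.tabulate λ i →
    case ∈-cartesianProductWith⁻ f xs ys i of λ { (x , y , x∈ , y∈ , refl) → h x∈ y∈ }

  module _ {k : ℕ} {S : List (Form (suc k))} (N : Normalised S) where
    open Normalised N

    eliminate : List (Form k)
    eliminate = zs ++ cartesianProductWith _+ᶠ_ gs hs

    eliminate-approx : ∀ (y : ℕ → Fin (suc k) → ℚ) → All (λ f → Nonneg∞ (λ n → eval f (y n))) S →
      All (λ f → Nonneg∞ (λ n → eval f (y n ∘ suc))) eliminate
    eliminate-approx y nn = All.++⁺ zy (All-product⁺ _+ᶠ_ λ {g} {h} g∈ h∈ → Nonneg∞-cong (eq g h) (Nonneg∞-+ {λ n → y n zero ℚ.+ eval g (y n ∘ suc)} {λ n → eval h (y n ∘ suc) ℚ.- y n zero} (All.lookup gy g∈) (All.lookup hy h∈)))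
      where
      zy = proj₁ (approx y nn)
      gy = proj₁ (proj₂ (approx y nn))
      hy = proj₂ (proj₂ (approx y nn))
      open +-*-Solver
      cancel : ∀ x g h → x ℚ.+ g ℚ.+ (h ℚ.- x) ≡ g ℚ.+ h
      cancel = solve 3 (λ x g h → (x :+ g) :+ (h :- x) := g :+ h) refl
      eq : ∀ g h n → y n zero ℚ.+ eval g (y n ∘ suc) ℚ.+ (eval h (y n ∘ suc) ℚ.- y n zero) ≡ eval (g +ᶠ h) (y n ∘ suc)
      eq g h n = trans (cancel (y n zero) (eval g (y n ∘ suc)) (eval h (y n ∘ suc))) (sym (eval-+ g h (y n ∘ suc)))

    eliminate-sound : ∀ x → All (x ≤0≤_) eliminate → ∃[ x₀ ] All (cons x₀ x ≤0≤_) S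
    eliminate-sound x sat = x₀ , sound x₀ x (All.++⁻ˡ zs sat) (All.map⁻ (proj₁ (proj₂ b))) (All.map⁻ (proj₂ (proj₂ b)))
      where
      lower : Form k → ℚ
      lower g = ℚ.- eval g x
      upper : Form k → ℚ
      upper h = eval h x
      sums : ∀ {f} → f ∈ cartesianProductWith _+ᶠ_ gs hs → x ≤0≤ f
      sums = All.lookup (All.++⁻ʳ zs sat)
      lower≤upper : ∀ {g h} → g ∈ gs → h ∈ hs → lower g ℚ.≤ upper h
      lower≤upper {g} {h} g∈ h∈ = 0≤p+q⇒-p≤q {eval g x} {eval h x}
        (subst (0ℚ ℚ.≤_) (eval-+ g h x) (sums (∈-cartesianProductWith⁺ _+ᶠ_ g∈ h∈)))
      b = between (map lower gs) (map upper hs) (All.map⁺ (All.tabulate λ g∈ → All.map⁺ (All.tabulate λ h∈ → lower≤upper g∈ h∈)))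
      x₀ = proj₁ b

fourier-motzkin : ∀ {k} (S : List (Form k)) →
  (∃[ x ] All (x ≤0≤_) S) ⊎ (∀ (y : ℕ → Fin k → ℚ) → ¬ All (λ f → Nonneg∞ (λ n → eval f (y n))) S)
fourier-motzkin {zero} S with All.all? (λ f → 0ℚ ℚ.≤? eval f (λ ())) S
... | yes sat = inj₁ ((λ ()) , sat)
-- Without variables every form is constant, and a constant that is nonnegative up to every ε is
-- nonnegative.
... | no ¬sat = inj₂ λ y nn → ¬sat (All.map (λ {f} n → Nonneg∞-const {eval f (λ ())} n) nn)
fourier-motzkin {suc k} S with fourier-motzkin (eliminate (normalise S))
... | inj₁ (x , sat) = inj₁ (cons (proj₁ e) x , proj₂ e)
  where e = eliminate-sound (normalise S) x sat
... | inj₂ no-solution = inj₂ λ y nn → no-solution (λ n → y n ∘ suc) (eliminate-approx (normalise S) y nn)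

-- The embeddings of ℕ and ℤ in ℚ

ℤ→ℚ-injective : ∀ {a b} → ℤ→ℚ a ≡ ℤ→ℚ b → a ≡ b
ℤ→ℚ-injective {a} {b} e with ℚᵘ.*≡* eq ← ℚ.fromℚᵘ-injective {ℚᵘ.mkℚᵘ a 0} {ℚᵘ.mkℚᵘ b 0} e =
  trans (sym (ℤ.*-identityʳ a)) (trans eq (ℤ.*-identityʳ b))

ℤ→ℚ-+ : ∀ a b → ℤ→ℚ (a ℤ.+ b) ≡ ℤ→ℚ a ℚ.+ ℤ→ℚ b
ℤ→ℚ-+ a b = ℚ.toℚᵘ-injective (begin
  ℚ.toℚᵘ (ℤ→ℚ (a ℤ.+ b))  ≈⟨ ℚ.toℚᵘ-fromℚᵘ (ℚᵘ.mkℚᵘ (a ℤ.+ b) 0) ⟩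
  ℚᵘ.mkℚᵘ (a ℤ.+ b) 0  ≈⟨ ℚᵘ.*≡* (lemma a b) ⟩
  ℚᵘ.mkℚᵘ a 0 ℚᵘ.+ ℚᵘ.mkℚᵘ b 0  ≈⟨ ℚᵘ.+-cong (ℚ.toℚᵘ-fromℚᵘ (ℚᵘ.mkℚᵘ a 0)) (ℚ.toℚᵘ-fromℚᵘ (ℚᵘ.mkℚᵘ b 0)) ⟨
  ℚ.toℚᵘ (ℤ→ℚ a) ℚᵘ.+ ℚ.toℚᵘ (ℤ→ℚ b)  ≈⟨ ℚ.toℚᵘ-homo-+ (ℤ→ℚ a) (ℤ→ℚ b) ⟨
  ℚ.toℚᵘ (ℤ→ℚ a ℚ.+ ℤ→ℚ b)  ∎)
  where
  open import Relation.Binary.Reasoning.Setoid ℚᵘ.≃-setoid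
  lemma : ∀ a b → (a ℤ.+ b) ℤ.* ℤ.+ 1 ≡ (a ℤ.* ℤ.+ 1 ℤ.+ b ℤ.* ℤ.+ 1) ℤ.* ℤ.+ 1
  lemma = solve-∀ᶻ

ℤ→ℚ-* : ∀ a b → ℤ→ℚ (a ℤ.* b) ≡ ℤ→ℚ a ℚ.* ℤ→ℚ b
ℤ→ℚ-* a b = ℚ.toℚᵘ-injective (begin
  ℚ.toℚᵘ (ℤ→ℚ (a ℤ.* b))  ≈⟨ ℚ.toℚᵘ-fromℚᵘ (ℚᵘ.mkℚᵘ (a ℤ.* b) 0) ⟩
  ℚᵘ.mkℚᵘ a 0 ℚᵘ.* ℚᵘ.mkℚᵘ b 0  ≈⟨ ℚᵘ.*-cong (ℚ.toℚᵘ-fromℚᵘ (ℚᵘ.mkℚᵘ a 0)) (ℚ.toℚᵘ-fromℚᵘ (ℚᵘ.mkℚᵘ b 0)) ⟨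
  ℚ.toℚᵘ (ℤ→ℚ a) ℚᵘ.* ℚ.toℚᵘ (ℤ→ℚ b)  ≈⟨ ℚ.toℚᵘ-homo-* (ℤ→ℚ a) (ℤ→ℚ b) ⟨
  ℚ.toℚᵘ (ℤ→ℚ a ℚ.* ℤ→ℚ b)  ∎)
  where
  open import Relation.Binary.Reasoning.Setoid ℚᵘ.≃-setoid

ℤ→ℚ-mono-≤ : ∀ {a b} → a ℤ.≤ b → ℤ→ℚ a ℚ.≤ ℤ→ℚ b
ℤ→ℚ-mono-≤ {a} {b} a≤b = ℚ.toℚᵘ-cancel-≤ (ℚᵘ.≤-respˡ-≃ (ℚᵘ.≃-sym (ℚ.toℚᵘ-fromℚᵘ (ℚᵘ.mkℚᵘ a 0)))
  (ℚᵘ.≤-respʳ-≃ (ℚᵘ.≃-sym (ℚ.toℚᵘ-fromℚᵘ (ℚᵘ.mkℚᵘ b 0))) (ℚᵘ.*≤* (ℤ.*-monoʳ-≤-nonNeg (ℤ.+ 1) a≤b))))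

ℕ→ℚ-injective : ∀ {a b} → ℕ→ℚ a ≡ ℕ→ℚ b → a ≡ b
ℕ→ℚ-injective e = ℤ.+-injective (ℤ→ℚ-injective e)

ℕ→ℚ-* : ∀ a b → ℕ→ℚ (a * b) ≡ ℕ→ℚ a ℚ.* ℕ→ℚ b
ℕ→ℚ-* a b = trans (cong ℤ→ℚ (ℤ.pos-* a b)) (ℤ→ℚ-* (ℤ.+ a) (ℤ.+ b))

0≤ℕ→ℚ : ∀ n → 0ℚ ℚ.≤ ℕ→ℚ n
0≤ℕ→ℚ n = ℤ→ℚ-mono-≤ {ℤ.+ 0} {ℤ.+ n} (ℤ.+≤+ z≤n)

0<ℕ→ℚ-suc : ∀ n → 0ℚ ℚ.< ℕ→ℚ (suc n)
0<ℕ→ℚ-suc n = ℚ.<-≤-trans (ℚ.positive⁻¹ 1ℚ) (ℤ→ℚ-mono-≤ {ℤ.+ 1} {ℤ.+ suc n} (ℤ.+≤+ (s≤s z≤n)))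

private
  clear-denominator : ∀ {p} → 0ℚ ℚ.≤ p → ∃[ d ] ∃[ a ] p ℚ.* ℕ→ℚ (suc d) ≡ ℕ→ℚ a
  clear-denominator {p@(ℚ.mkℚ (ℤ.+ a) d _)} _ = d , a , ℚ.toℚᵘ-injective (begin
    ℚ.toℚᵘ (p ℚ.* ℕ→ℚ (suc d))  ≈⟨ ℚ.toℚᵘ-homo-* p (ℕ→ℚ (suc d)) ⟩
    ℚᵘ.mkℚᵘ (ℤ.+ a) d ℚᵘ.* ℚ.toℚᵘ (ℕ→ℚ (suc d))  ≈⟨ ℚᵘ.*-congˡ {ℚᵘ.mkℚᵘ (ℤ.+ a) d} (ℚ.toℚᵘ-fromℚᵘ (ℚᵘ.mkℚᵘ (ℤ.+ suc d) 0)) ⟩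
    ℚᵘ.mkℚᵘ (ℤ.+ a) d ℚᵘ.* ℚᵘ.mkℚᵘ (ℤ.+ suc d) 0  ≈⟨ ℚᵘ.*≡* (trans (ℤ.*-identityʳ _) (cong (ℤ._*_ (ℤ.+ a)) (cong ℤ.+_ (sym (*-identityʳ (suc d)))))) ⟩
    ℚᵘ.mkℚᵘ (ℤ.+ a) 0  ≈⟨ ℚ.toℚᵘ-fromℚᵘ (ℚᵘ.mkℚᵘ (ℤ.+ a) 0) ⟨
    ℚ.toℚᵘ (ℕ→ℚ a)  ∎)
    where
    open import Relation.Binary.Reasoning.Setoid ℚᵘ.≃-setoid
  clear-denominator {ℚ.mkℚ ℤ.-[1+ a ] d _} (ℚ.*≤* ())

  clear-denominators : ∀ {k} (w : Fin k → ℚ) → (∀ i → 0ℚ ℚ.≤ w i) →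
    ∃[ q ] ∃[ a ] (∀ i → w i ℚ.* ℕ→ℚ (suc q) ≡ ℕ→ℚ (lookup a i))
  clear-denominators {zero} w _ = 0 , [] , λ ()
  clear-denominators {suc k} w 0≤w with d , a , e ← clear-denominator (0≤w zero) | q , as , es ← clear-denominators (w ∘ suc) (0≤w ∘ suc) =
    q + d * suc q , a * suc q ∷ Vec.map (suc d *_) as , λ
    { zero → begin
        w zero ℚ.* ℕ→ℚ (suc d * suc q)  ≡⟨ cong (ℚ._*_ (w zero)) (ℕ→ℚ-* (suc d) (suc q)) ⟩
        w zero ℚ.* (ℕ→ℚ (suc d) ℚ.* ℕ→ℚ (suc q))  ≡⟨ ℚ.*-assoc (w zero) _ _ ⟨
        w zero ℚ.* ℕ→ℚ (suc d) ℚ.* ℕ→ℚ (suc q)  ≡⟨ cong (ℚ._* ℕ→ℚ (suc q)) e ⟩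
        ℕ→ℚ a ℚ.* ℕ→ℚ (suc q)  ≡⟨ ℕ→ℚ-* a (suc q) ⟨
        ℕ→ℚ (a * suc q)  ∎
    ; (suc i) → begin
        w (suc i) ℚ.* ℕ→ℚ (suc d * suc q)  ≡⟨ cong (λ m → w (suc i) ℚ.* ℕ→ℚ m) (*-comm (suc d) (suc q)) ⟩
        w (suc i) ℚ.* ℕ→ℚ (suc q * suc d)  ≡⟨ cong (ℚ._*_ (w (suc i))) (ℕ→ℚ-* (suc q) (suc d)) ⟩
        w (suc i) ℚ.* (ℕ→ℚ (suc q) ℚ.* ℕ→ℚ (suc d))  ≡⟨ ℚ.*-assoc (w (suc i)) _ _ ⟨
        w (suc i) ℚ.* ℕ→ℚ (suc q) ℚ.* ℕ→ℚ (suc d)  ≡⟨ cong (ℚ._* ℕ→ℚ (suc d)) (es i) ⟩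
        ℕ→ℚ (lookup as i) ℚ.* ℕ→ℚ (suc d)  ≡⟨ ℕ→ℚ-* (lookup as i) (suc d) ⟨
        ℕ→ℚ (lookup as i * suc d)  ≡⟨ cong ℕ→ℚ (*-comm (lookup as i) (suc d)) ⟩
        ℕ→ℚ (suc d * lookup as i)  ≡⟨ cong ℕ→ℚ (Vec.lookup-map i (suc d *_) as) ⟨
        ℕ→ℚ (lookup (Vec.map (suc d *_) as) i)  ∎
    }
    where open ≡-Reasoning

ℕ→ℚ-sum : ∀ {k} (a : Vec ℕ k) → ℕ→ℚ (Vec.sum a) ≡ ∑ℚ (λ i → ℕ→ℚ (lookup a i))
ℕ→ℚ-sum [] = refl
ℕ→ℚ-sum (a ∷ as) = trans (ℤ→ℚ-+ (ℤ.+ a) (ℤ.+ Vec.sum as)) (cong (ℚ._+_ (ℕ→ℚ a)) (ℕ→ℚ-sum as))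

-- Integer, rational and real weights

module Hull {D : ℕ} where

  coefficient : (V : List (ℤ^ D)) → Fin D → Fin (length V) → ℚ
  coefficient V j i = ℤ→ℚ (lookup (List.lookup V i) j)

  coord-combination : ∀ V a j → ℤ→ℚ (coord j (combination V a)) ≡ ∑ℚ (λ i → coefficient V j i ℚ.* ℕ→ℚ (lookup a i))
  coord-combination [] [] j = cong ℤ→ℚ (additive-0 (coord j) (coord-additive j))
  coord-combination (v ∷ V) (a ∷ as) j = begin
    ℤ→ℚ (coord j (a ×ᵥ v +ᵥ combination V as))  ≡⟨ cong ℤ→ℚ (coord-additive j (a ×ᵥ v) (combination V as)) ⟩
    ℤ→ℚ (coord j (a ×ᵥ v) ℤ.+ coord j (combination V as))  ≡⟨ ℤ→ℚ-+ (coord j (a ×ᵥ v)) (coord j (combination V as)) ⟩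
    ℤ→ℚ (coord j (a ×ᵥ v)) ℚ.+ ℤ→ℚ (coord j (combination V as))  ≡⟨ cong₂ ℚ._+_ scaled (coord-combination V as j) ⟩
    ℤ→ℚ (coord j v) ℚ.* ℕ→ℚ a ℚ.+ _  ∎
    where
    open ≡-Reasoning
    scaled : ℤ→ℚ (coord j (a ×ᵥ v)) ≡ ℤ→ℚ (coord j v) ℚ.* ℕ→ℚ a
    scaled = trans (cong ℤ→ℚ (additive-× (coord j) (coord-additive j) a v)) (trans (ℤ→ℚ-* (ℤ.+ a) (coord j v)) (ℚ.*-comm (ℕ→ℚ a) _))

  record Weights (V : List (ℤ^ D)) (n : ℕ) (z : ℤ^ D) (w : Fin (length V) → ℚ) : Set where
    field
      nonneg : ∀ i → 0ℚ ℚ.≤ w i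
      total  : ∑ℚ w ≡ 1ℚ
      point  : ∀ j → ℤ→ℚ (coord j z) ≡ ℕ→ℚ n ℚ.* ∑ℚ (λ i → coefficient V j i ℚ.* w i)

  weights⇒InDilate : ∀ {V n z w} → Weights V n z w → InDilate V n z
  weights⇒InDilate {V} {n} {z} {w} W = q , Vec.map (n *_) a ,
    trans (combination-scale V n a) (lookup-ext λ j → trans (additive-× (coord j) (coord-additive j) n (combination V a))
      (trans (ℤ→ℚ-injective (coordinates j)) (sym (additive-× (coord j) (coord-additive j) (suc q) z)))) ,
    trans (sum-scale n a) (trans (cong (n *_) (ℕ→ℚ-injective sums)) (*-comm n (suc q)))
    where
    open Weights W
    open ≡-Reasoning
    c = clear-denominators w nonneg
    q = proj₁ c
    a = proj₁ (proj₂ c)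
    cleared = proj₂ (proj₂ c)
    Q = ℕ→ℚ (suc q)
    sums : ℕ→ℚ (Vec.sum a) ≡ Q
    sums = begin
      ℕ→ℚ (Vec.sum a)  ≡⟨ ℕ→ℚ-sum a ⟩
      ∑ℚ (λ i → ℕ→ℚ (lookup a i))  ≡⟨ ∑ℚ-cong (λ i → trans (sym (cleared i)) (ℚ.*-comm (w i) Q)) ⟩
      ∑ℚ (λ i → Q ℚ.* w i)  ≡⟨ ∑ℚ-*ˡ Q w ⟩
      Q ℚ.* ∑ℚ w  ≡⟨ cong (ℚ._*_ Q) total ⟩
      Q ℚ.* 1ℚ  ≡⟨ ℚ.*-identityʳ Q ⟩
      Q  ∎
    coordinates : ∀ j → ℤ→ℚ (ℤ.+ n ℤ.* coord j (combination V a)) ≡ ℤ→ℚ (ℤ.+ suc q ℤ.* coord j z)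
    coordinates j = begin
      ℤ→ℚ (ℤ.+ n ℤ.* coord j (combination V a))  ≡⟨ ℤ→ℚ-* (ℤ.+ n) (coord j (combination V a)) ⟩
      ℕ→ℚ n ℚ.* ℤ→ℚ (coord j (combination V a))  ≡⟨ cong (ℚ._*_ (ℕ→ℚ n)) (coord-combination V a j) ⟩
      ℕ→ℚ n ℚ.* ∑ℚ (λ i → coefficient V j i ℚ.* ℕ→ℚ (lookup a i))  ≡⟨ cong (ℚ._*_ (ℕ→ℚ n)) (∑ℚ-cong rescale) ⟩
      ℕ→ℚ n ℚ.* ∑ℚ (λ i → Q ℚ.* (coefficient V j i ℚ.* w i))  ≡⟨ cong (ℚ._*_ (ℕ→ℚ n)) (∑ℚ-*ˡ Q (λ i → coefficient V j i ℚ.* w i)) ⟩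
      ℕ→ℚ n ℚ.* (Q ℚ.* ∑ℚ (λ i → coefficient V j i ℚ.* w i))  ≡⟨ swap (ℕ→ℚ n) Q (∑ℚ (λ i → coefficient V j i ℚ.* w i)) ⟩
      Q ℚ.* (ℕ→ℚ n ℚ.* ∑ℚ (λ i → coefficient V j i ℚ.* w i))  ≡⟨ cong (ℚ._*_ Q) (point j) ⟨
      Q ℚ.* ℤ→ℚ (coord j z)  ≡⟨ ℤ→ℚ-* (ℤ.+ suc q) (coord j z) ⟨
      ℤ→ℚ (ℤ.+ suc q ℤ.* coord j z)  ∎
      where
      open +-*-Solver
      swap : ∀ a b c → a ℚ.* (b ℚ.* c) ≡ b ℚ.* (a ℚ.* c)
      swap = solve 3 (λ a b c → a :* (b :* c) := b :* (a :* c)) refl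
      rescale : ∀ i → coefficient V j i ℚ.* ℕ→ℚ (lookup a i) ≡ Q ℚ.* (coefficient V j i ℚ.* w i)
      rescale i = trans (cong (ℚ._*_ (coefficient V j i)) (trans (sym (cleared i)) (ℚ.*-comm (w i) Q))) (swap (coefficient V j i) Q (w i))

  -- The coefficients are divided by their sum `suc q * suc n`. It is positive because the factor of
  -- dilation is a successor, which is why enumeration starts at factor 1.
  InDilate⇒weights : ∀ {V n z} → InDilate V (suc n) z → ∃[ w ] Weights V (suc n) z w
  InDilate⇒weights {V} {n} {z} (q , a , ea , sa) = w , record
    { nonneg = λ i → 0≤* (0≤ℕ→ℚ (lookup a i)) (ℚ.<⇒≤ 0<r)
    ; total = begin
        ∑ℚ w  ≡⟨ ∑ℚ-cong (λ i → ℚ.*-comm (ℕ→ℚ (lookup a i)) r) ⟩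
        ∑ℚ (λ i → r ℚ.* ℕ→ℚ (lookup a i))  ≡⟨ ∑ℚ-*ˡ r (λ i → ℕ→ℚ (lookup a i)) ⟩
        r ℚ.* ∑ℚ (λ i → ℕ→ℚ (lookup a i))  ≡⟨ cong (ℚ._*_ r) (ℕ→ℚ-sum a) ⟨
        r ℚ.* ℕ→ℚ (Vec.sum a)  ≡⟨ cong (λ s → r ℚ.* ℕ→ℚ s) sa ⟩
        r ℚ.* ℕ→ℚ (suc q * suc n)  ≡⟨ ℚ.*-comm r _ ⟩
        ℕ→ℚ (suc q * suc n) ℚ.* r  ≡⟨ c*r≡1 ⟩
        1ℚ  ∎
    ; point = λ j → sym (begin
        N ℚ.* ∑ℚ (λ i → coefficient V j i ℚ.* w i)  ≡⟨ cong (ℚ._*_ N) (∑ℚ-cong λ i → regroup (coefficient V j i) (ℕ→ℚ (lookup a i)) r) ⟩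
        N ℚ.* ∑ℚ (λ i → r ℚ.* (coefficient V j i ℚ.* ℕ→ℚ (lookup a i)))  ≡⟨ cong (ℚ._*_ N) (∑ℚ-*ˡ r (λ i → coefficient V j i ℚ.* ℕ→ℚ (lookup a i))) ⟩
        N ℚ.* (r ℚ.* ∑ℚ (λ i → coefficient V j i ℚ.* ℕ→ℚ (lookup a i)))  ≡⟨ cong (λ s → N ℚ.* (r ℚ.* s)) (coord-combination V a j) ⟨
        N ℚ.* (r ℚ.* ℤ→ℚ (coord j (combination V a)))  ≡⟨ cong (λ s → N ℚ.* (r ℚ.* s)) (scaled j) ⟩
        N ℚ.* (r ℚ.* (Q ℚ.* ℤ→ℚ (coord j z)))  ≡⟨ regroup₂ N r Q (ℤ→ℚ (coord j z)) ⟩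
        (Q ℚ.* N) ℚ.* r ℚ.* ℤ→ℚ (coord j z)  ≡⟨ cong (λ p → p ℚ.* r ℚ.* ℤ→ℚ (coord j z)) (ℕ→ℚ-* (suc q) (suc n)) ⟨
        ℕ→ℚ (suc q * suc n) ℚ.* r ℚ.* ℤ→ℚ (coord j z)  ≡⟨ cong (ℚ._* ℤ→ℚ (coord j z)) c*r≡1 ⟩
        1ℚ ℚ.* ℤ→ℚ (coord j z)  ≡⟨ ℚ.*-identityˡ _ ⟩
        ℤ→ℚ (coord j z)  ∎)
    }
    where
    open ≡-Reasoning
    open +-*-Solver
    Q = ℕ→ℚ (suc q)
    N = ℕ→ℚ (suc n)
    pair = positivePair (0<ℕ→ℚ-suc (n + q * suc n))
    r = proj₁ pair
    open PositivePair (proj₂ pair) using (0<r; c*r≡1)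
    w : Fin (length V) → ℚ
    w i = ℕ→ℚ (lookup a i) ℚ.* r
    scaled : ∀ j → ℤ→ℚ (coord j (combination V a)) ≡ Q ℚ.* ℤ→ℚ (coord j z)
    scaled j = trans (cong (ℤ→ℚ ∘ coord j) ea) (trans (cong ℤ→ℚ (additive-× (coord j) (coord-additive j) (suc q) z)) (ℤ→ℚ-* (ℤ.+ suc q) (coord j z)))
    regroup : ∀ c a r → c ℚ.* (a ℚ.* r) ≡ r ℚ.* (c ℚ.* a)
    regroup = solve 3 (λ c a r → c :* (a :* r) := r :* (c :* a)) refl
    regroup₂ : ∀ n r q x → n ℚ.* (r ℚ.* (q ℚ.* x)) ≡ q ℚ.* n ℚ.* r ℚ.* x
    regroup₂ = solve 4 (λ n r q x → n :* (r :* (q :* x)) := q :* n :* r :* x) refl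

  seq-∑ : ∀ {k} (w : Fin k → ℝ) N → seq (∑ w) N ≡ ∑ℚ (λ i → seq (w i) N)
  seq-∑ {zero} w N = refl
  seq-∑ {suc k} w N = cong (ℚ._+_ (seq (w zero) N)) (seq-∑ (w ∘ suc) N)

  open import Defs using () renaming (_≤_ to _≤ʳ_; _≈_ to _≈ʳ_; _·_ to _·ʳ_)

  ≡⇒≈ : ∀ {x y : ℝ} → (∀ n → seq x n ≡ seq y n) → x ≈ʳ y
  ≡⇒≈ {x} {y} h ε 0<ε = 0 , λ n _ → subst (ℚ._< ε) (sym (trans (cong (λ a → ℚ.∣ a ℚ.- seq y n ∣) (h n)) (cong ℚ.∣_∣ (ℚ.+-inverseʳ (seq y n))))) 0<ε

  weights⇒L : ∀ {V n z w} → Weights V n z w → L (dilate n (conv V)) z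
  weights⇒L {V} {n} {z} {w} W = (λ j → fromℚ (∑ℚ λ i → coefficient V j i ℚ.* w i)) ,
    ((λ i → fromℚ (w i)) ,
      (λ i ε 0<ε → 0 , λ _ _ → subst (ℚ._< w i ℚ.+ ε) (ℚ.+-identityʳ 0ℚ) (ℚ.+-mono-≤-< (nonneg i) 0<ε)) ,
      ≡⇒≈ {∑ λ i → fromℚ (w i)} {fromℚ 1ℚ} (λ N → trans (seq-∑ (λ i → fromℚ (w i)) N) total) ,
      λ j → ≡⇒≈ {fromℚ (∑ℚ λ i → coefficient V j i ℚ.* w i)} {∑ λ i → coefficient V j i ·ʳ fromℚ (w i)} λ N → sym (seq-∑ (λ i → coefficient V j i ·ʳ fromℚ (w i)) N)) ,
    λ j → ≡⇒≈ {fromℤ (lookup z j)} {ℕ→ℚ n ·ʳ fromℚ (∑ℚ λ i → coefficient V j i ℚ.* w i)} λ N → point j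
    where open Weights W

  ∣p∣<ε⇒0<p+ε : ∀ {p ε} → ℚ.∣ p ∣ ℚ.< ε → 0ℚ ℚ.< p ℚ.+ ε
  ∣p∣<ε⇒0<p+ε {p} {ε} lt with ℚ.∣p∣≡p∨∣p∣≡-p p
  ... | inj₁ e = subst (ℚ._< p ℚ.+ ε) (ℚ.+-identityʳ 0ℚ) (ℚ.+-mono-≤-< (subst (0ℚ ℚ.≤_) e (ℚ.0≤∣p∣ p)) (ℚ.≤-<-trans (ℚ.0≤∣p∣ p) lt))
  ... | inj₂ e = subst (ℚ._< p ℚ.+ ε) (ℚ.+-inverseʳ p) (ℚ.+-monoʳ-< p (subst (ℚ._< ε) e lt))

  ≈⇒Nonneg∞ : ∀ {x y : ℝ} → x ≈ʳ y → Nonneg∞ (λ n → seq x n ℚ.- seq y n)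
  ≈⇒Nonneg∞ {x} {y} x≈y ε 0<ε = proj₁ (x≈y ε 0<ε) , λ n N≤n → ∣p∣<ε⇒0<p+ε {seq x n ℚ.- seq y n} (proj₂ (x≈y ε 0<ε) n N≤n)

  ≈-sym : ∀ {x y : ℝ} → x ≈ʳ y → y ≈ʳ x
  ≈-sym {x} {y} x≈y ε 0<ε = proj₁ (x≈y ε 0<ε) , λ n N≤n → subst (ℚ._< ε)
    (trans (sym (ℚ.∣-p∣≡∣p∣ (seq x n ℚ.- seq y n))) (cong ℚ.∣_∣ (flip (seq x n) (seq y n)))) (proj₂ (x≈y ε 0<ε) n N≤n)
    where
    open +-*-Solver
    flip : ∀ p q → ℚ.- (p ℚ.- q) ≡ q ℚ.- p
    flip = solve 2 (λ p q → :- (p :- q) := q :- p) refl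

-- Deciding membership and listing the lattice points

module Decide {D : ℕ} where

  open Hull {D}
  open import Defs using () renaming (_≤_ to _≤ʳ_; _≈_ to _≈ʳ_; _·_ to _·ʳ_)

  private
    unit-form : ∀ {k} → Fin k → Fin k → ℚ
    unit-form zero zero = 1ℚ
    unit-form zero (suc _) = 0ℚ
    unit-form (suc _) zero = 0ℚ
    unit-form (suc i) (suc j) = unit-form i j

    ∑-0 : ∀ {k} (x : Fin k → ℚ) → ∑ℚ (λ j → 0ℚ ℚ.* x j) ≡ 0ℚ
    ∑-0 x = trans (∑ℚ-*ˡ 0ℚ x) (ℚ.*-zeroˡ (∑ℚ x))

    ∑-unit : ∀ {k} i (x : Fin k → ℚ) → ∑ℚ (λ j → unit-form i j ℚ.* x j) ≡ x i
    ∑-unit zero x = trans (cong₂ ℚ._+_ (ℚ.*-identityˡ (x zero)) (∑-0 (x ∘ suc))) (ℚ.+-identityʳ (x zero))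
    ∑-unit (suc i) x = trans (cong₂ ℚ._+_ (ℚ.*-zeroˡ (x zero)) (∑-unit i (x ∘ suc))) (ℚ.+-identityˡ (x (suc i)))

    coordinate : ∀ {k} → Fin k → Form k
    coordinate i = 0ℚ , unit-form i

    eval-coordinate : ∀ {k} (i : Fin k) x → eval (coordinate i) x ≡ x i
    eval-coordinate i x = trans (ℚ.+-identityˡ _) (∑-unit i x)

    -1ℚ : ℚ
    -1ℚ = ℚ.- 1ℚ

    -1* : ∀ p → -1ℚ ℚ.* p ≡ ℚ.- p
    -1* p = trans (sym (ℚ.neg-distribˡ-* 1ℚ p)) (cong (λ q → ℚ.- q) (ℚ.*-identityˡ p))

    opposite : ∀ {k} → List (Form k) → List (Form k)
    opposite = map (-1ℚ *ᶠ_)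

    total-form : ∀ {k} → Form k
    total-form = -1ℚ , λ _ → 1ℚ

    eval-total : ∀ {k} (x : Fin k → ℚ) → eval total-form x ≡ ∑ℚ x ℚ.- 1ℚ
    eval-total x = trans (cong (ℚ._+_ -1ℚ) (trans (∑ℚ-*ˡ 1ℚ x) (ℚ.*-identityˡ (∑ℚ x)))) (ℚ.+-comm -1ℚ (∑ℚ x))

    module _ (V : List (ℤ^ D)) (n : ℕ) (z : ℤ^ D) where

      k : ℕ
      k = length V

      N : ℚ
      N = ℕ→ℚ (suc n)

      point-form : Fin D → Form k
      point-form j = ℤ→ℚ (coord j z) , λ i → ℚ.- N ℚ.* coefficient V j i

      eval-point : ∀ j x → eval (point-form j) x ≡ ℤ→ℚ (coord j z) ℚ.- N ℚ.* ∑ℚ (λ i → coefficient V j i ℚ.* x i)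
      eval-point j x = cong (ℚ._+_ (ℤ→ℚ (coord j z))) (trans (∑ℚ-cong λ i → ℚ.*-assoc (ℚ.- N) (coefficient V j i) (x i))
        (trans (∑ℚ-*ˡ (ℚ.- N) (λ i → coefficient V j i ℚ.* x i)) (sym (ℚ.neg-distribˡ-* N _))))

      equations : List (Form k)
      equations = total-form ∷ map point-form (List.allFin D)

      system : List (Form k)
      system = map coordinate (List.allFin k) ++ (equations ++ opposite equations)

      solution⇒weights : ∀ {x} → All (x ≤0≤_) system → Weights V (suc n) z x
      solution⇒weights {x} sat = record
        { nonneg = λ i → subst (0ℚ ℚ.≤_) (eval-coordinate i x) (All.lookup (All.map⁻ (All.++⁻ˡ (map coordinate (List.allFin k)) sat)) (∈-allFin i))
        ; total = ℚ-minus (trans (sym (eval-total x)) (zeroes (here refl)))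
        ; point = λ j → ℚ-minus (trans (sym (eval-point j x)) (zeroes (there (∈-map⁺ point-form (∈-allFin j)))))
        }
        where
        sat′ = All.++⁻ʳ (map coordinate (List.allFin k)) sat
        zeroes : ∀ {f} → f ∈ equations → eval f x ≡ 0ℚ
        zeroes {f} f∈ = ℚ.≤-antisym (subst (ℚ._≤ 0ℚ) (neg-neg (eval f x)) (ℚ.neg-antimono-≤ (subst (0ℚ ℚ.≤_) (trans (eval-* -1ℚ f x) (-1* (eval f x)))
            (All.lookup (All.map⁻ (All.++⁻ʳ equations sat′)) f∈))))
          (All.lookup (All.++⁻ˡ equations sat′) f∈)
          where
          open +-*-Solver
          neg-neg : ∀ p → ℚ.- (ℚ.- p) ≡ p
          neg-neg = solve 1 (λ p → :- (:- p) := p) refl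
        ℚ-minus : ∀ {p q} → p ℚ.- q ≡ 0ℚ → p ≡ q
        ℚ-minus {p} {q} e = trans (solve 2 (λ p q → p := (p :- q) :+ q) refl p q) (trans (cong (ℚ._+ q) e) (ℚ.+-identityˡ q))
          where open +-*-Solver

      -- The rational sequences behind the real weights solve the system in the limit. The real
      -- point x of the hull drops out by adding N times its own equation to that of z.
      L⇒approximate : L (dilate (suc n) (conv V)) z → ∃[ y ] All (λ f → Nonneg∞ (λ m → eval f (y m))) system
      L⇒approximate (x , (w , 0≤w , Σw≈1 , x≈) , z≈) = y , All.++⁺
        (All.map⁺ (All.tabulate λ {i} _ → Nonneg∞-cong {λ m → seq (w i) m} (λ m → sym (eval-coordinate i (y m))) (0≤w′ i)))
        (All.++⁺ (proj₁ both ∷ All.map⁺ (All.tabulate λ {j} _ → proj₁ (both′ j))) (proj₂ both ∷ All.map⁺ (All.map⁺ (All.tabulate λ {j} _ → proj₂ (both′ j)))))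
        where
        y : ℕ → Fin k → ℚ
        y m i = seq (w i) m
        open +-*-Solver
        0≤w′ : ∀ i → Nonneg∞ (λ m → seq (w i) m)
        0≤w′ i = 0≤w i
        flip : ∀ p q → q ℚ.- p ≡ ℚ.- (p ℚ.- q)
        flip = solve 2 (λ p q → q :- p := :- (p :- q)) refl
        TwoSided : Form k → Set
        TwoSided f = Nonneg∞ (λ m → eval f (y m)) × Nonneg∞ (λ m → eval (-1ℚ *ᶠ f) (y m))
        two-sided : ∀ f {p q : ℕ → ℚ} → (∀ m → eval f (y m) ≡ p m ℚ.- q m) → Nonneg∞ (λ m → p m ℚ.- q m) → Nonneg∞ (λ m → q m ℚ.- p m) → TwoSided f
        two-sided f {p} {q} e n₁ n₂ = Nonneg∞-cong (λ m → sym (e m)) n₁ ,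
          Nonneg∞-cong (λ m → trans (flip (p m) (q m)) (trans (cong (λ r → ℚ.- r) (sym (e m))) (sym (trans (eval-* -1ℚ f (y m)) (-1* (eval f (y m))))))) n₂
        both : TwoSided total-form
        both = two-sided total-form {seq (∑ w)} {λ _ → 1ℚ} (λ m → trans (eval-total (y m)) (cong (ℚ._- 1ℚ) (sym (seq-∑ w m))))
          (≈⇒Nonneg∞ {∑ w} {fromℚ 1ℚ} Σw≈1) (≈⇒Nonneg∞ {fromℚ 1ℚ} {∑ w} (≈-sym {∑ w} {fromℚ 1ℚ} Σw≈1))
        combo : Fin D → ℝ
        combo j = ∑ λ i → coefficient V j i ·ʳ w i
        Z : Fin D → ℚ
        Z j = ℤ→ℚ (coord j z)
        telescope : ∀ z x s c → z ℚ.- c ℚ.* x ℚ.+ c ℚ.* (x ℚ.- s) ≡ z ℚ.- c ℚ.* s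
        telescope = solve 4 (λ z x s c → (z :- c :* x) :+ c :* (x :- s) := z :- c :* s) refl
        telescope′ : ∀ z x s c → c ℚ.* x ℚ.- z ℚ.+ c ℚ.* (s ℚ.- x) ≡ c ℚ.* s ℚ.- z
        telescope′ = solve 4 (λ z x s c → (c :* x :- z) :+ c :* (s :- x) := c :* s :- z) refl
        both′ : ∀ j → TwoSided (point-form j)
        both′ j = two-sided (point-form j) {λ _ → Z j} {λ m → N ℚ.* seq (combo j) m}
          (λ m → trans (eval-point j (y m)) (cong (λ s → Z j ℚ.- N ℚ.* s) (sym (seq-∑ (λ i → coefficient V j i ·ʳ w i) m))))
          (Nonneg∞-cong (λ m → telescope (Z j) (seq (x j) m) (seq (combo j) m) N)
            (Nonneg∞-+ {λ m → Z j ℚ.- N ℚ.* seq (x j) m} {λ m → N ℚ.* (seq (x j) m ℚ.- seq (combo j) m)} (≈⇒Nonneg∞ {fromℤ (coord j z)} {N ·ʳ x j} (z≈ j))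
              (Nonneg∞-*ˡ {N} {λ m → seq (x j) m ℚ.- seq (combo j) m} (0<ℕ→ℚ-suc n) (≈⇒Nonneg∞ {x j} {combo j} (x≈ j)))))
          (Nonneg∞-cong (λ m → telescope′ (Z j) (seq (x j) m) (seq (combo j) m) N)
            (Nonneg∞-+ {λ m → N ℚ.* seq (x j) m ℚ.- Z j} {λ m → N ℚ.* (seq (combo j) m ℚ.- seq (x j) m)}
              (≈⇒Nonneg∞ {N ·ʳ x j} {fromℤ (coord j z)} (≈-sym {fromℤ (coord j z)} {N ·ʳ x j} (z≈ j)))
              (Nonneg∞-*ˡ {N} {λ m → seq (combo j) m ℚ.- seq (x j) m} (0<ℕ→ℚ-suc n) (≈⇒Nonneg∞ {combo j} {x j} (≈-sym {x j} {combo j} (x≈ j))))))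

  InDilate⇒L : ∀ {V n z} → InDilate V (suc n) z → L (dilate (suc n) (conv V)) z
  InDilate⇒L {V} {n} {z} z∈ = weights⇒L {V} {suc n} {z} (proj₂ (InDilate⇒weights z∈))

  private
    -- Rational weights put z into L, so the alternatives exclude each other. The disjunction
    -- therefore decides `InDilate`, and for z in L it yields rational weights although none can be
    -- read off the reals.
    decide : ∀ V n z → InDilate V (suc n) z ⊎ ¬ L (dilate (suc n) (conv V)) z
    decide V n z = [ (λ (x , sat) → inj₁ (weights⇒InDilate (solution⇒weights V n z sat))) ,
      (λ no-solution → inj₂ λ z∈ → no-solution (proj₁ (L⇒approximate V n z z∈)) (proj₂ (L⇒approximate V n z z∈))) ]′
      (fourier-motzkin (system V n z))

  InDilate? : ∀ V n z → Dec (InDilate V (suc n) z)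
  InDilate? V n z = conclude (decide V n z)
    where
    conclude : InDilate V (suc n) z ⊎ ¬ L (dilate (suc n) (conv V)) z → Dec (InDilate V (suc n) z)
    conclude (inj₁ z∈) = yes z∈
    conclude (inj₂ z∉) = no λ z∈ → z∉ (InDilate⇒L {V} {n} {z} z∈)

  L⇒InDilate : ∀ {V n z} → L (dilate (suc n) (conv V)) z → InDilate V (suc n) z
  L⇒InDilate {V} {n} {z} z∈ = conclude (decide V n z)
    where
    conclude : InDilate V (suc n) z ⊎ ¬ L (dilate (suc n) (conv V)) z → InDilate V (suc n) z
    conclude (inj₁ z∈′) = z∈′
    conclude (inj₂ z∉) = ⊥-elim (z∉ z∈)

  private
    symmetric : ℕ → List ℤ
    symmetric K = map ℤ.+_ (upTo (suc K)) ++ map (λ m → ℤ.- (ℤ.+ m)) (upTo (suc K))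

    ∈-symmetric : ∀ {K} c → ℤ.∣ c ∣ ≤ K → c ∈ symmetric K
    ∈-symmetric (ℤ.+ m) m≤K = ∈-++⁺ˡ (∈-map⁺ ℤ.+_ (∈-upTo⁺ (s≤s m≤K)))
    ∈-symmetric {K} ℤ.-[1+ m ] m≤K = ∈-++⁺ʳ (map ℤ.+_ (upTo (suc K))) (∈-map⁺ (λ m → ℤ.- (ℤ.+ m)) (∈-upTo⁺ (s≤s m≤K)))

    cube : ∀ D → ℕ → List (ℤ^ D)
    cube zero K = [] ∷ []
    cube (suc D) K = cartesianProductWith _∷_ (symmetric K) (cube D K)

    ∈-cube : ∀ {D K} (x : ℤ^ D) → (∀ j → ℤ.∣ coord j x ∣ ≤ K) → x ∈ cube D K
    ∈-cube [] _ = here refl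
    ∈-cube (c ∷ x) h = ∈-cartesianProductWith⁺ _∷_ (∈-symmetric c (h zero)) (∈-cube x (h ∘ suc))

    bound : Fin D → List (ℤ^ D) → ℕ
    bound j V = Σℕ (map (ℤ.∣_∣ ∘ coord j) V)

    coord-bound : ∀ V a j → ℤ.∣ coord j (combination V a) ∣ ≤ Vec.sum a * bound j V
    coord-bound [] [] j = ≤-reflexive (cong ℤ.∣_∣ (additive-0 (coord j) (coord-additive j)))
    coord-bound (v ∷ V) (a ∷ as) j = begin
      ℤ.∣ coord j (a ×ᵥ v +ᵥ combination V as) ∣  ≡⟨ cong ℤ.∣_∣ (coord-additive j (a ×ᵥ v) (combination V as)) ⟩
      ℤ.∣ coord j (a ×ᵥ v) ℤ.+ coord j (combination V as) ∣  ≤⟨ ℤ.∣i+j∣≤∣i∣+∣j∣ (coord j (a ×ᵥ v)) _ ⟩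
      ℤ.∣ coord j (a ×ᵥ v) ∣ + ℤ.∣ coord j (combination V as) ∣  ≤⟨ +-mono-≤ (≤-reflexive scaled) (coord-bound V as j) ⟩
      a * c + Vec.sum as * bound j V  ≤⟨ +-mono-≤ (*-monoʳ-≤ a (m≤m+n c _)) (*-monoʳ-≤ (Vec.sum as) (m≤n+m _ c)) ⟩
      a * (c + bound j V) + Vec.sum as * (c + bound j V)  ≡⟨ *-distribʳ-+ (c + bound j V) a (Vec.sum as) ⟨
      (a + Vec.sum as) * (c + bound j V)  ∎
      where
      open ≤-Reasoning
      c = ℤ.∣ coord j v ∣
      scaled : ℤ.∣ coord j (a ×ᵥ v) ∣ ≡ a * c
      scaled = trans (cong ℤ.∣_∣ (additive-× (coord j) (coord-additive j) a v)) (ℤ.abs-* (ℤ.+ a) (coord j v))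

    InDilate-bound : ∀ {V n x} → InDilate V n x → ∀ j → ℤ.∣ coord j x ∣ ≤ n * bound j V
    InDilate-bound {V} {n} {x} (q , a , ea , sa) j = *-cancelˡ-≤ (suc q) (begin
      suc q * ℤ.∣ coord j x ∣  ≡⟨ ℤ.abs-* (ℤ.+ suc q) (coord j x) ⟨
      ℤ.∣ ℤ.+ suc q ℤ.* coord j x ∣  ≡⟨ cong ℤ.∣_∣ (additive-× (coord j) (coord-additive j) (suc q) x) ⟨
      ℤ.∣ coord j (suc q ×ᵥ x) ∣  ≡⟨ cong (ℤ.∣_∣ ∘ coord j) ea ⟨
      ℤ.∣ coord j (combination V a) ∣  ≤⟨ coord-bound V a j ⟩
      Vec.sum a * bound j V  ≡⟨ cong (_* bound j V) sa ⟩
      suc q * n * bound j V  ≡⟨ *-assoc (suc q) n (bound j V) ⟩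
      suc q * (n * bound j V)  ∎)
      where open ≤-Reasoning

    radius : List (ℤ^ D) → ℕ → ℕ
    radius V n = n * Σℕ (map (λ j → bound j V) (List.allFin D))

    InDilate-radius : ∀ {V n x} → InDilate V n x → ∀ j → ℤ.∣ coord j x ∣ ≤ radius V n
    InDilate-radius {V} {n} x∈ j = ≤-trans (InDilate-bound {V} {n} x∈ j) (*-monoʳ-≤ n (Σ-member (λ j → bound j V) (∈-allFin j)))

  abstract
    -- The index is shifted: this list belongs to the factor n + 1. Accordingly `n₁`, `τ₀` and `τ₁`
    -- below are predecessors of a factor or radius.
    points : List (ℤ^ D) → ℕ → List (ℤ^ D)
    points V n = deduplicate _≟_ (filter (InDilate? V n) (cube D (radius V (suc n))))

    points-unique : ∀ V n → Unique (points V n)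
    points-unique V n = UniqueDec.deduplicate-! _≟_ _

    ∈-points⁺ : ∀ {V n x} → InDilate V (suc n) x → x ∈ points V n
    ∈-points⁺ {V} {n} {x} x∈ = ∈-deduplicate⁺ _≟_ (∈-filter⁺ (InDilate? V n) (∈-cube x (InDilate-radius {V} {suc n} x∈)) x∈)

    ∈-points⁻ : ∀ {V n x} → x ∈ points V n → InDilate V (suc n) x
    ∈-points⁻ {V} {n} x∈ = proj₂ (∈-filter⁻ (InDilate? V n) {xs = cube D (radius V (suc n))} (∈-deduplicate⁻ _≟_ (filter (InDilate? V n) (cube D (radius V (suc n)))) x∈))

  points-enumerate : ∀ V n → Enumerates (points V n) (L (dilate (suc n) (conv V)))
  points-enumerate V n = points-unique V n , λ z → mk⇔ (InDilate⇒L {V} {n} {z} ∘ ∈-points⁻) (∈-points⁺ ∘ L⇒InDilate {V} {n} {z})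

-- Lowest elements, blocks of levels and gap systems

module _ {A : Set} (_≟ᴬ_ : DecidableEquality A) (f : A → ℕ) where

  private
    _without_ : List A → A → List A
    xs without m = filter (λ x → ¬? (x ≟ᴬ m)) xs

    ∈-without⁺ : ∀ {xs m x} → x ∈ xs → x ≢ m → x ∈ xs without m
    ∈-without⁺ {m = m} = ∈-filter⁺ (λ x → ¬? (x ≟ᴬ m))

    ∈-without⁻ : ∀ {xs m x} → x ∈ xs without m → x ∈ xs × x ≢ m
    ∈-without⁻ {xs} {m} = ∈-filter⁻ (λ x → ¬? (x ≟ᴬ m)) {xs = xs}

    without-unique : ∀ {xs m} → Unique xs → Unique (xs without m)
    without-unique {m = m} = Unique.filter⁺ (λ x → ¬? (x ≟ᴬ m))

    ⊆∷without : ∀ xs m → xs ⊆ m ∷ (xs without m)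
    ⊆∷without xs m {x} i with x ≟ᴬ m
    ... | yes x≡m = here x≡m
    ... | no x≢m = there (∈-without⁺ i x≢m)

  least-elements : ∀ s {b} {xs ys : List A} → Unique xs → Unique ys → ys ⊆ xs → (∀ {y} → y ∈ ys → f y ≤ b) → s ≤ length ys →
    ∃[ F ] Unique F × F ⊆ xs × length F ≡ s × (∀ {x} → x ∈ F → f x ≤ b) × (∀ {x y} → x ∈ F → y ∈ xs → f y < f x → y ∈ F)
  least-elements zero _ _ _ _ _ = [] , [] , (λ ()) , refl , (λ ()) , λ ()
  least-elements (suc s) {b} {xs} {ys@(y ∷ _)} uxs uys ys⊆xs f≤b s≤
    with m , m∈ , m≤ ← ∃-least (λ x → ℤ.+ f x) (ys⊆xs (here refl))
    with F , uF , F⊆ , |F| , F≤b , closed ← least-elements s {b} {xs without m} {ys without m} (without-unique uxs) (without-unique uys)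
      (λ i → ∈-without⁺ (ys⊆xs (proj₁ (∈-without⁻ {ys} i))) (proj₂ (∈-without⁻ {ys} i))) (λ i → f≤b (proj₁ (∈-without⁻ {ys} i)))
      (≤-pred (≤-trans s≤ (Unique⇒⊆⇒length≤ uys (⊆∷without ys m)))) =
    m ∷ F , All.tabulate (λ i m≡x → proj₂ (∈-without⁻ {xs} (F⊆ i)) (sym m≡x)) ∷ uF ,
    (λ { (here refl) → m∈ ; (there i) → proj₁ (∈-without⁻ {xs} (F⊆ i)) }) , cong suc |F| , bounded , closed′
    where
    bounded : ∀ {x} → x ∈ m ∷ F → f x ≤ b
    bounded (here refl) = ≤-trans (ℤ.drop‿+≤+ (m≤ (ys⊆xs (here refl)))) (f≤b (here refl))
    bounded (there i) = F≤b i
    closed′ : ∀ {x y} → x ∈ m ∷ F → y ∈ xs → f y < f x → y ∈ m ∷ F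
    closed′ (here refl) y∈ y<x = contradiction (ℤ.drop‿+≤+ (m≤ y∈)) (<⇒≱ y<x)
    closed′ {y = y} (there i) y∈ y<x with y ≟ᴬ m
    ... | yes y≡m = here y≡m
    ... | no y≢m = there (closed i (∈-without⁺ y∈ y≢m) y<x)

Unique⇒AllPairs : ∀ {A : Set} {Q : A → A → Set} {xs : List A} → Unique xs → (∀ {x y} → x ∈ xs → y ∈ xs → x ≢ y → Q x y) → AllPairs Q xs
Unique⇒AllPairs [] h = []
Unique⇒AllPairs (x∉ ∷ u) h = All.tabulate (λ i → h (here refl) (there i) (All.lookup x∉ i)) ∷ Unique⇒AllPairs u (λ i j → h (there i) (there j))

Unique⇒index-lookup : ∀ {A : Set} {xs : List A} → Unique xs → ∀ i (x∈ : List.lookup xs i ∈ xs) → Any.index x∈ ≡ i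
Unique⇒index-lookup (x∉ ∷ u) zero (here _) = refl
Unique⇒index-lookup (x∉ ∷ u) zero (there i) = contradiction refl (All.lookup x∉ i)
Unique⇒index-lookup (x∉ ∷ u) (suc i) (here e) = contradiction (sym e) (All.lookup x∉ (∈-lookup i))
Unique⇒index-lookup (x∉ ∷ u) (suc i) (there j) = cong suc (Unique⇒index-lookup u i j)

n≤2^n : ∀ n → n ≤ 2 ^ n
n≤2^n zero = z≤n
n≤2^n (suc n) = ≤-trans (+-mono-≤ (m^n>0 2 n) (n≤2^n n)) (≤-reflexive (cong (2 ^ n +_) (sym (+-identityʳ (2 ^ n)))))

module Quotients (h : ℕ) .{{_ : NonZero h}} where

  <suc-quotient : ∀ m → m < suc (m / h) * h
  <suc-quotient m = ≤-<-trans (≤-reflexive (m≡m%n+[m/n]*n m h)) (+-monoˡ-< (m / h * h) (m%n<n m h))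

  *≤⇒≤/ : ∀ q {m} → q * h ≤ m → q ≤ m / h
  *≤⇒≤/ q {m} le = ≤-trans (≤-reflexive (sym (m*n/n≡m q h))) (DivMod./-monoˡ-≤ h le)

  quotient-≡ : ∀ {q m} → q * h ≤ m → m < q * h + h → m / h ≡ q
  quotient-≡ {q} {m} le lt = ≤-antisym (≤-pred (m<n*o⇒m/o<n (<-≤-trans lt (≤-reflexive (+-comm (q * h) h))))) (*≤⇒≤/ q le)

  quotient-+≤ : ∀ a b → a / h + b / h ≤ (a + b) / h
  quotient-+≤ a b = *≤⇒≤/ (a / h + b / h) (≤-trans (≤-reflexive (*-distribʳ-+ h (a / h) (b / h))) (+-mono-≤ (m/n*n≤m a h) (m/n*n≤m b h)))

  -- Two remainders add up to less than 2h, so rounding loses at most one block. This loss is the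
  -- reason for the double cases in the conditions on gaps.
  quotient-+≥ : ∀ a b → (a + b) / h ≤ suc (a / h + b / h)
  quotient-+≥ a b = ≤-pred (m<n*o⇒m/o<n (<-≤-trans (+-mono-< (<suc-quotient a) (<suc-quotient b)) (≤-reflexive (lemma (a / h) (b / h) h))))
    where
    lemma : ∀ p q h → suc p * h + suc q * h ≡ suc (suc (p + q)) * h
    lemma = solve-∀

-- Found by search: of two levels adding up to 17 or 18, the first is a southern gap or the second a northern one,
-- although every gap of either kind is bridged by two levels outside the gaps of that kind.
southern-gaps northern-gaps : List ℕ
southern-gaps = 4 ∷ 5 ∷ 10 ∷ 11 ∷ 12 ∷ 13 ∷ 14 ∷ 15 ∷ 16 ∷ 17 ∷ 18 ∷ []
northern-gaps = 8 ∷ 9 ∷ 10 ∷ 11 ∷ 12 ∷ 14 ∷ 15 ∷ 16 ∷ 17 ∷ 18 ∷ []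

module Gaps where

  open DecMembership _≟ⁿ_ using (_∈?_; _∉?_) public

  -- A split fixes the block θ of one summand, but because of rounding that of the other may be q -
  -- θ or q - θ - 1, so both have to avoid Γ. Positive blocks lie above the omitted points.
  Bridge : List ℕ → ℕ → ℕ → Set
  Bridge Γ q θ = 1 ≤ θ × θ ∉ Γ × 1 ≤ q ∸ suc θ × q ∸ suc θ ∉ Γ × q ∸ θ ∉ Γ

  Bridge⇒< : ∀ {Γ q θ} → Bridge Γ q θ → suc θ < q
  Bridge⇒< {q = q} {θ} (_ , _ , 1≤ , _) = m∸n≢0⇒n<m (≢-sym (<⇒≢ 1≤))

  Bridge⇒ : ∀ {Γ q θ r} → Bridge Γ q θ → θ + r ≤ q → q ≤ suc (θ + r) → 1 ≤ r × r ∉ Γ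
  Bridge⇒ {Γ} {q} {θ} {r} (_ , _ , 1≤ , ∉Γ , ∉Γ′) lower upper with m≤n⇒m<n∨m≡n upper
  ... | inj₁ lt = ≤-trans 1≤ (≤-trans (∸-monoʳ-≤ q (n≤1+n θ)) (≤-reflexive (sym e))) , subst (_∉ Γ) (sym e) ∉Γ′
    where
    e : r ≡ q ∸ θ
    e = trans (sym (m+n∸m≡n θ r)) (cong (_∸ θ) (≤-antisym lower (≤-pred lt)))
  ... | inj₂ q≡ = ≤-trans 1≤ (≤-reflexive (sym e)) , subst (_∉ Γ) (sym e) ∉Γ
    where
    e : r ≡ q ∸ suc θ
    e = trans (sym (m+n∸m≡n (suc θ) r)) (cong (_∸ suc θ) (sym q≡))

  bridge? : ∀ Γ q θ → Dec (Bridge Γ q θ)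
  bridge? Γ q θ = 1 ≤? θ ×-dec θ ∉? Γ ×-dec 1 ≤? q ∸ suc θ ×-dec q ∸ suc θ ∉? Γ ×-dec q ∸ θ ∉? Γ

  Bridged : List ℕ → Set
  Bridged Γ = All (λ q → q ≤ 18 × Any (Bridge Γ q) (upTo q)) Γ

  bridged? : ∀ Γ → Dec (Bridged Γ)
  bridged? Γ = All.all? (λ q → q ≤? 18 ×-dec Any.any? (bridge? Γ q) (upTo q)) Γ

  southern-bridged : Bridged southern-gaps
  southern-bridged = from-yes (bridged? southern-gaps)

  northern-bridged : Bridged northern-gaps
  northern-bridged = from-yes (bridged? northern-gaps)

  private
    Complementary : ℕ → ℕ → Set
    Complementary a b = ¬ (a + b ≤ 18 × 17 ≤ a + b) ⊎ (a ∈ southern-gaps ⊎ b ∈ northern-gaps)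

    complementary? : ∀ a b → Dec (Complementary a b)
    complementary? a b = ¬? (a + b ≤? 18 ×-dec 17 ≤? a + b) ⊎-dec (a ∈? southern-gaps ⊎-dec b ∈? northern-gaps)

    table : All (λ a → All (Complementary a) (upTo 19)) (upTo 19)
    table = from-yes (All.all? (λ a → All.all? (complementary? a) (upTo 19)) (upTo 19))

  -- If two levels add up to a level in block 18, their blocks add up to 17 or 18. This leaves
  -- finitely many cases, which are checked by computation.
  complementary : ∀ {a b} → a + b ≤ 18 → 17 ≤ a + b → a ∈ southern-gaps ⊎ b ∈ northern-gaps
  complementary {a} {b} a+b≤ ≤a+b = [ contradiction (a+b≤ , ≤a+b) , id ]′
    (All.lookup (All.lookup table (∈-upTo⁺ (s≤s (≤-trans (m≤m+n a b) a+b≤)))) (∈-upTo⁺ (s≤s (≤-trans (m≤n+m b a) a+b≤))))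

-- The excluded points near the poles

module Fringe {D} {V : List (ℤ^ D)} (P : Poles V) (s H n₁ : ℕ) (s<H : s < H) (k+2≤H : length V + 2 ≤ H)
  (large : 38 * (H * Poles.width P) ≤ suc n₁) where

  open Dilates V
  open Poles P
  open Geometry P
  open Decide {D}
  open DecMembership (_≟_ {D}) using (_∈?_)
  private module ℕ∈ = DecMembership _≟ⁿ_

  n h : ℕ
  n = suc n₁
  h = H * width

  u v : ℤ^ D
  u = South.apex
  v = North.apex

  levˢ levⁿ : ℤ^ D → ℕ
  levˢ = South.lev n
  levⁿ = North.lev n

  X : List (ℤ^ D)
  X = points V n₁

  instance
    width≢0 : NonZero width
    width≢0 = ℕ.>-nonZero 0<width

  s*width<h : s * width < h
  s*width<h = *-monoˡ-< width s<H

  k*width<h : k * width < h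
  k*width<h = *-monoˡ-< width (<-≤-trans (m<m+n k (s≤s z≤n)) k+2≤H)

  width<h : width < h
  width<h = <-≤-trans (≤-<-trans (≤-reflexive (sym (*-identityˡ width))) (*-monoˡ-< width (n<1+n 1)))
    (*-monoˡ-≤ width (≤-trans (m≤n+m 2 k) k+2≤H))

  instance
    h≢0 : NonZero h
    h≢0 = ℕ.>-nonZero (≤-<-trans z≤n width<h)

  h≤n : h ≤ n
  h≤n = ≤-trans (m≤n*m h 38) large

  H≤n : H ≤ n
  H≤n = ≤-trans (m≤m*n H width) h≤n

  19h≤n : 19 * h ≤ n
  19h≤n = ≤-trans (*-monoˡ-≤ h (m≤m+n 19 19)) large

  19h+19h≤n*width : 19 * h + 19 * h ≤ n * width
  19h+19h≤n*width = ≤-trans (≤-reflexive (sym (*-distribʳ-+ h 19 19))) (≤-trans large (m≤m*n n width))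

  open Quotients h

  lev-sumⁿ : ∀ {x} → x ∈[ n ] → levˢ x + levⁿ x ≡ n * width
  lev-sumⁿ = lev-sum

  near-apexes : ∀ {a b} → a + b ≡ n * width → a < 19 * h → 19 * h ≤ b
  near-apexes {a} {b} e a< = +-cancelˡ-≤ (19 * h) (19 * h) b
    (≤-trans 19h+19h≤n*width (≤-trans (≤-reflexive (sym e)) (+-monoˡ-≤ b (<⇒≤ a<))))

  private
    point : ℕ → ℤ^ D
    point j = j ×ᵥ v +ᵥ (n ∸ j) ×ᵥ u

  lev-north : ∀ j → South.lev j (j ×ᵥ v) ≡ j * width
  lev-north j = trans (sym (+-identityʳ _)) (trans (cong (South.lev j (j ×ᵥ v) +_) (sym (North.lev-apex j))) (lev-sum (∈[]-× North.apex∈ j)))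

  ∈[]-mixture : ∀ i j → i + j ≡ n → i ×ᵥ v +ᵥ j ×ᵥ u ∈[ n ]
  ∈[]-mixture i j e = ∈[]-cast e (∈[]-+ (∈[]-× North.apex∈ i) (∈[]-× South.apex∈ j))

  levˢ-mixture : ∀ i j → i + j ≡ n → levˢ (i ×ᵥ v +ᵥ j ×ᵥ u) ≡ i * width
  levˢ-mixture i j e = begin
    levˢ (i ×ᵥ v +ᵥ j ×ᵥ u)  ≡⟨ cong (λ m → South.lev m (i ×ᵥ v +ᵥ j ×ᵥ u)) e ⟨
    South.lev (i + j) (i ×ᵥ v +ᵥ j ×ᵥ u)  ≡⟨ South.lev-+ (∈[]-× North.apex∈ i) (∈[]-× South.apex∈ j) ⟩
    South.lev i (i ×ᵥ v) + South.lev j (j ×ᵥ u)  ≡⟨ cong₂ _+_ (lev-north i) (South.lev-apex j) ⟩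
    i * width + 0  ≡⟨ +-identityʳ _ ⟩
    i * width  ∎
    where open ≡-Reasoning

  private
    s≤n : s ≤ n
    s≤n = ≤-trans (<⇒≤ s<H) H≤n

    -- These s points of the segment from nu to nv have levels at most `s * width`, so the s lowest
    -- points obey the same bound, for every n.
    candidates : List (ℤ^ D)
    candidates = List.applyUpTo (point ∘ suc) s

    levˢ-point : ∀ {i} → i < s → levˢ (point (suc i)) ≡ suc i * width
    levˢ-point {i} i<s = levˢ-mixture (suc i) (n ∸ suc i) (m+[n∸m]≡n (≤-trans i<s s≤n))

    candidates-unique : Unique candidates
    candidates-unique = Unique.applyUpTo⁺₁ (point ∘ suc) s λ {i} {j} i<j j<s e →
      <⇒≢ i<j (suc-injective (*-cancelʳ-≡ (suc i) (suc j) width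
        (trans (sym (levˢ-point (<-trans i<j j<s))) (trans (cong levˢ e) (levˢ-point j<s)))))

    X∖nu : List (ℤ^ D)
    X∖nu = filter (λ x → ¬? (x ≟ (n ×ᵥ u))) X

    candidates⊆ : candidates ⊆ X∖nu
    candidates⊆ i∈ with i , i<s , refl ← ∈-applyUpTo⁻ (point ∘ suc) i∈ =
      ∈-filter⁺ (λ x → ¬? (x ≟ (n ×ᵥ u))) (∈-points⁺ (∈[]-mixture (suc i) (n ∸ suc i) (m+[n∸m]≡n (≤-trans i<s s≤n))))
        λ e → contradiction (≤-trans (*-mono-≤ {1} {suc i} (s≤s z≤n) 0<width)
          (≤-reflexive (trans (sym (levˢ-point i<s)) (trans (cong levˢ e) (South.lev-apex n))))) λ ()

    candidates≤ : ∀ {y} → y ∈ candidates → levˢ y ≤ s * width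
    candidates≤ i∈ with i , i<s , refl ← ∈-applyUpTo⁻ (point ∘ suc) i∈ = ≤-trans (≤-reflexive (levˢ-point i<s)) (*-monoˡ-≤ width i<s)

    lowest = least-elements _≟_ levˢ s (Unique.filter⁺ (λ x → ¬? (x ≟ (n ×ᵥ u))) (points-unique V n₁)) candidates-unique candidates⊆ candidates≤
      (≤-reflexive (sym (List.length-applyUpTo (point ∘ suc) s)))

  abstract
    F : List (ℤ^ D)
    F = proj₁ lowest

    F-unique : Unique F
    F-unique = proj₁ (proj₂ lowest)

    length-F : length F ≡ s
    length-F = proj₁ (proj₂ (proj₂ (proj₂ lowest)))

    F⊆ : ∀ {x} → x ∈ F → x ∈[ n ] × x ≢ n ×ᵥ u
    F⊆ x∈ with x∈X , x≢ ← ∈-filter⁻ (λ x → ¬? (x ≟ (n ×ᵥ u))) {xs = X} (proj₁ (proj₂ (proj₂ lowest)) x∈) = ∈-points⁻ x∈X , x≢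

    F≤ : ∀ {x} → x ∈ F → levˢ x ≤ s * width
    F≤ = proj₁ (proj₂ (proj₂ (proj₂ (proj₂ lowest))))

    F-closed : ∀ {x y} → x ∈ F → y ∈[ n ] → y ≢ n ×ᵥ u → levˢ y < levˢ x → y ∈ F
    F-closed x∈ y∈ y≢ = proj₂ (proj₂ (proj₂ (proj₂ (proj₂ lowest)))) x∈ (∈-filter⁺ (λ x → ¬? (x ≟ (n ×ᵥ u))) (∈-points⁺ y∈) y≢)

  data Out (x : ℤ^ D) : Set where
    southern : levˢ x / h ∈ southern-gaps → Out x
    omitted  : x ∈ F → Out x
    northern : levⁿ x / h ∈ northern-gaps → Out x

  abstract
    out? : ∀ x → Dec (Out x)
    out? x = map′ [ southern , [ omitted , northern ]′ ]′ (λ { (southern q) → inj₁ q ; (omitted q) → inj₂ (inj₁ q) ; (northern q) → inj₂ (inj₂ q) })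
      (levˢ x / h ℕ∈.∈? southern-gaps ⊎-dec (x ∈? F ⊎-dec levⁿ x / h ℕ∈.∈? northern-gaps))

  private
    gap≤18 : ∀ {Γ q} → Gaps.Bridged Γ → q ∈ Γ → q ≤ 18
    gap≤18 bridged q∈ = proj₁ (All.lookup bridged q∈)

    gap⇒<19h : ∀ {Γ m} → Gaps.Bridged Γ → m / h ∈ Γ → m < 19 * h
    gap⇒<19h {m = m} bridged q∈ = <-≤-trans (<suc-quotient m) (*-monoˡ-≤ h (s≤s (gap≤18 bridged q∈)))

    ≥19h⇒∉gap : ∀ {Γ m} → Gaps.Bridged Γ → 19 * h ≤ m → m / h ∉ Γ
    ≥19h⇒∉gap bridged le q∈ = <⇒≱ (gap⇒<19h bridged q∈) le

    s*width<19h : s * width < 19 * h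
    s*width<19h = <-≤-trans s*width<h (m≤n*m h 19)

  southern⇒<19h : ∀ {x} → levˢ x / h ∈ southern-gaps → levˢ x < 19 * h
  southern⇒<19h = gap⇒<19h Gaps.southern-bridged

  omitted⇒<19h : ∀ {x} → x ∈ F → levˢ x < 19 * h
  omitted⇒<19h x∈ = ≤-<-trans (F≤ x∈) s*width<19h

  northern⇒<19h : ∀ {x} → levⁿ x / h ∈ northern-gaps → levⁿ x < 19 * h
  northern⇒<19h = gap⇒<19h Gaps.northern-bridged

  private
    southern-¬out : ∀ {x} → x ∈[ n ] → levˢ x < 19 * h → levˢ x / h ∉ southern-gaps → x ∉ F → ¬ Out x
    southern-¬out x∈ low ∉gaps ∉F (southern q∈) = ∉gaps q∈
    southern-¬out x∈ low ∉gaps ∉F (omitted x∈F) = ∉F x∈F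
    southern-¬out x∈ low ∉gaps ∉F (northern q∈) = ≥19h⇒∉gap Gaps.northern-bridged (near-apexes (lev-sumⁿ x∈) low) q∈

    northern-¬out : ∀ {x} → x ∈[ n ] → levⁿ x < 19 * h → levⁿ x / h ∉ northern-gaps → ¬ Out x
    northern-¬out {x} x∈ low ∉gaps = λ
      { (southern q∈) → <⇒≱ (southern⇒<19h q∈) high
      ; (omitted x∈F) → <⇒≱ (omitted⇒<19h x∈F) high
      ; (northern q∈) → ∉gaps q∈ }
      where
      high : 19 * h ≤ levˢ x
      high = near-apexes (trans (+-comm (levⁿ x) (levˢ x)) (lev-sumⁿ x∈)) low

    0∉southern : 0 ∉ southern-gaps
    0∉southern = from-yes (¬? (0 ℕ∈.∈? southern-gaps))

    0∉northern : 0 ∉ northern-gaps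
    0∉northern = from-yes (¬? (0 ℕ∈.∈? northern-gaps))

    0<19h : 0 < 19 * h
    0<19h = ≤-<-trans z≤n s*width<19h

  private
    level-0∉ : ∀ {Γ m} → 0 ∉ Γ → m ≡ 0 → m / h ∉ Γ
    level-0∉ {Γ} 0∉ refl = subst (_∉ Γ) (sym (DivMod.0/n≡0 h)) 0∉

  -- Needed because a sum near 2nw is written as nw plus a point near nw. Away from its own pole, nw
  -- has level at least n, beyond all gaps.
  vertices-in : ∀ {w} → w ∈ V → ¬ Out (n ×ᵥ w)
  vertices-in {w} w∈ with w ≟ u
  ... | yes refl = southern-¬out (∈[]-× w∈ n) (subst (_< 19 * h) (sym (South.lev-apex n)) 0<19h)
    (level-0∉ 0∉southern (South.lev-apex n))
    (λ x∈F → proj₂ (F⊆ x∈F) refl)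
  ... | no w≢u = λ
    { (southern q∈) → <⇒≱ (southern⇒<19h q∈) 19h≤levˢ
    ; (omitted x∈F) → <⇒≱ (omitted⇒<19h x∈F) 19h≤levˢ
    ; (northern q∈) → ∉northern q∈ }
    where
    far : ∀ (Q : Pole V) → w ≢ Pole.apex Q → 19 * h ≤ Pole.lev Q n (n ×ᵥ w)
    far Q w≢ = ≤-trans 19h≤n (≤-trans (≤-reflexive (sym (*-identityʳ n))) (≤-trans (*-monoʳ-≤ n (Pole.0<lev Q w∈ w≢)) (≤-reflexive (sym (Pole.lev-× Q w∈ n)))))
    19h≤levˢ : 19 * h ≤ levˢ (n ×ᵥ w)
    19h≤levˢ = far south w≢u
    ∉northern : levⁿ (n ×ᵥ w) / h ∉ northern-gaps
    ∉northern with w ≟ v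
    ... | yes refl = level-0∉ 0∉northern (North.lev-apex n)
    ... | no w≢v = ≥19h⇒∉gap Gaps.northern-bridged (far north w≢v)

  private
    module Bridging (Q : Pole V) (lev≤ : ∀ {m x} → x ∈[ m ] → Pole.lev Q m x ≤ m * width) {Γ} (bridged : Gaps.Bridged Γ) where
      open Pole Q
      open AtPole Q lev≤

      Middle : ℤ^ D → Set
      Middle a = h ≤ lev n a × lev n a < 19 * h × lev n a / h ∉ Γ

      Bridged : ℤ^ D → Set
      Bridged x = ∃[ a ] ∃[ b ] a ∈[ n ] × b ∈[ n ] × a +ᵥ b ≡ n ×ᵥ apex +ᵥ x × Middle a × Middle b

      private
        h≤ : ∀ {m} → 1 ≤ m → h ≤ m * h
        h≤ 1≤m = ≤-trans (≤-reflexive (sym (*-identityˡ h))) (*-monoˡ-≤ h 1≤m)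

      module _ {x : ℤ^ D} {θ : ℕ} (x∈ : x ∈[ n ]) (q≤18 : lev n x / h ≤ 18) (bridges : Gaps.Bridge Γ (lev n x / h) θ) where

        private
          q = lev n x / h
          x<19h : lev n x < 19 * h
          x<19h = <-≤-trans (<suc-quotient (lev n x)) (*-monoˡ-≤ h (s≤s q≤18))

          θ≤q : θ ≤ q
          θ≤q = <⇒≤ (<-trans (n<1+n θ) (Gaps.Bridge⇒< bridges))

        bridge-from : Split h (θ * h) k*width<h width<h n (n ×ᵥ apex +ᵥ x) → Bridged x
        bridge-from (a , b , a∈ , b∈ , a+b , θ≤ , <θ+1) = a , b , a∈ , b∈ , a+b ,
          (≤-trans (h≤ (proj₁ bridges)) θ≤ , ≤-<-trans a≤x x<19h , subst (_∉ Γ) (sym qa) (proj₁ (proj₂ bridges))) ,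
          (≤-trans (h≤ (proj₁ complement)) (m/n*n≤m (lev n b) h) , ≤-<-trans b≤x x<19h , proj₂ complement)
          where
          levels : lev n a + lev n b ≡ lev n x
          levels = trans (sym (lev-+ a∈ b∈)) (trans (cong (lev (n + n)) a+b)
            (trans (lev-+ (∈[]-× apex∈ n) x∈) (cong (_+ lev n x) (lev-apex n))))
          a≤x : lev n a ≤ lev n x
          a≤x = ≤-trans (m≤m+n (lev n a) (lev n b)) (≤-reflexive levels)
          b≤x : lev n b ≤ lev n x
          b≤x = ≤-trans (m≤n+m (lev n b) (lev n a)) (≤-reflexive levels)
          qa : lev n a / h ≡ θ
          qa = quotient-≡ θ≤ <θ+1
          complement : 1 ≤ lev n b / h × lev n b / h ∉ Γ
          complement = Gaps.Bridge⇒ bridges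
            (subst₂ (λ i j → i + lev n b / h ≤ j / h) qa levels (quotient-+≤ (lev n a) (lev n b)))
            (subst₂ (λ i j → j / h ≤ suc (i + lev n b / h)) qa levels (quotient-+≥ (lev n a) (lev n b)))

        bridge-at : Bridged x
        bridge-at = bridge-from (split h (θ * h) k*width<h width<h x∈ (≤-trans (*-monoˡ-≤ h θ≤q) (m/n*n≤m (lev n x) h)))

      bridge : ∀ {x} → x ∈[ n ] → lev n x / h ∈ Γ → Bridged x
      bridge x∈ q∈ = bridge-at x∈ (proj₁ (All.lookup bridged q∈)) (proj₂ (Any.satisfied (proj₂ (All.lookup bridged q∈))))

    module BridgingS = Bridging south lev-southern≤ Gaps.southern-bridged
    module BridgingN = Bridging north lev-northern≤ Gaps.northern-bridged

  -- Such points turn out to be in the random set whatever the bits are, so sums bridged by them are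
  -- certain.
  Fringed : ℤ^ D → Set
  Fringed x = x ∈[ n ] × ¬ Out x × (levˢ x < 19 * h ⊎ levⁿ x < 19 * h)

  southern-bridge : ∀ {x} → x ∈[ n ] → levˢ x / h ∈ southern-gaps → ∃[ a ] ∃[ b ] a +ᵥ b ≡ n ×ᵥ u +ᵥ x × Fringed a × Fringed b
  southern-bridge {x} x∈ q∈ = conclude (BridgingS.bridge x∈ q∈)
    where
    fringed : ∀ {a} → a ∈[ n ] → BridgingS.Middle a → Fringed a
    fringed a∈ (h≤ , <19h , ∉Γ) = a∈ , southern-¬out a∈ <19h ∉Γ (λ a∈F → <⇒≱ s*width<h (≤-trans h≤ (F≤ a∈F))) , inj₁ <19h
    conclude : BridgingS.Bridged x → ∃[ a ] ∃[ b ] a +ᵥ b ≡ n ×ᵥ u +ᵥ x × Fringed a × Fringed b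
    conclude (a , b , a∈ , b∈ , a+b , a-mid , b-mid) = a , b , a+b , fringed a∈ a-mid , fringed b∈ b-mid

  northern-bridge : ∀ {x} → x ∈[ n ] → levⁿ x / h ∈ northern-gaps → ∃[ a ] ∃[ b ] a +ᵥ b ≡ n ×ᵥ v +ᵥ x × Fringed a × Fringed b
  northern-bridge {x} x∈ q∈ = conclude (BridgingN.bridge x∈ q∈)
    where
    fringed : ∀ {a} → a ∈[ n ] → BridgingN.Middle a → Fringed a
    fringed a∈ (h≤ , <19h , ∉Γ) = a∈ , northern-¬out a∈ <19h ∉Γ , inj₂ <19h
    conclude : BridgingN.Bridged x → ∃[ a ] ∃[ b ] a +ᵥ b ≡ n ×ᵥ v +ᵥ x × Fringed a × Fringed b
    conclude (a , b , a∈ , b∈ , a+b , a-mid , b-mid) = a , b , a+b , fringed a∈ a-mid , fringed b∈ b-mid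

  near-pole : ∀ {x τ} → x ∈[ n ] → levˢ x < 19 * h ⊎ levⁿ x < 19 * h → 19 * h + k ≤ τ → τ ≤ n → Near u n τ x ⊎ Near v n τ x
  near-pole x∈ (inj₁ lt) τ≥ τ≤n = inj₁ (AtPole.low⇒near south lev-southern≤ x∈ (<⇒≤ lt) τ≥ τ≤n)
  near-pole x∈ (inj₂ lt) τ≥ τ≤n = inj₂ (AtPole.low⇒near north lev-northern≤ x∈ (<⇒≤ lt) τ≥ τ≤n)

  out⇒low : ∀ {x} → Out x → levˢ x < 19 * h ⊎ levⁿ x < 19 * h
  out⇒low (southern q∈) = inj₁ (southern⇒<19h q∈)
  out⇒low (omitted x∈F) = inj₁ (omitted⇒<19h x∈F)
  out⇒low (northern q∈) = inj₂ (northern⇒<19h q∈)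

-- The random subset and its chances to attain a sum

module _ {D : ℕ} (X : List (ℤ^ D)) (p : ℤ^ D → Bool) where

  select : Subset (length X)
  select = Vec.tabulate (p ∘ List.lookup X)

  ∈-select⁺ : ∀ {x} → x ∈ X → p x ≡ true → x ∈ elements X select
  ∈-select⁺ {x} x∈ px = subst (_∈ elements X select) (sym x≡) (∈-map⁺ (List.lookup X)
    (∈-filter⁺ _ (∈-allFin i) (Vec.lookup⇒[]= i select (trans (Vec.lookup∘tabulate (p ∘ List.lookup X) i) (trans (cong p (sym x≡)) px)))))
    where
    i = Any.index x∈
    x≡ : x ≡ List.lookup X i
    x≡ = Any.lookup-index x∈

  ∈-select⁻ : ∀ {x} → x ∈ elements X select → x ∈ X × p x ≡ true
  ∈-select⁻ x∈ with i , i∈ , refl ← ∈-map⁻ (List.lookup X) x∈ =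
    ∈-lookup i , trans (sym (Vec.lookup∘tabulate (p ∘ List.lookup X) i)) (Vec.[]=⇒lookup (proj₂ (∈-filter⁻ _ {xs = List.allFin (length X)} i∈)))

module Counting {D} {V : List (ℤ^ D)} (P : Poles V) (s H n₁ : ℕ) (s<H : s < H) (k+2≤H : length V + 2 ≤ H)
  (large : 38 * (H * Poles.width P) ≤ suc n₁) where

  open Dilates V
  open Poles P
  open Geometry P
  open Representations P
  open Decide {D}
  open DecMembership (_≟_ {D}) using (_∈?_)
  open Fringe P s H n₁ s<H k+2≤H large

  O : List (ℤ^ D)
  O = filter out? X

  -- Exclusion concerns 19 blocks at each pole, and points of such low level are near the apex. The
  -- bound does not depend on n.
  length-O : ∀ τ₀ → 19 * h + k ≤ suc τ₀ → suc τ₀ ≤ n → length O ≤ length (points V τ₀) + length (points V τ₀)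
  length-O τ₀ τ₀≥ τ₀≤n = ≤-trans (Unique⇒⊆⇒length≤ (Unique.filter⁺ out? (points-unique V n₁)) O⊆)
    (≤-reflexive (trans (List.length-++ (around u)) (cong₂ _+_ (List.length-map _ (points V τ₀)) (List.length-map _ (points V τ₀)))))
    where
    around : ℤ^ D → List (ℤ^ D)
    around w = map (λ y → (n ∸ suc τ₀) ×ᵥ w +ᵥ y) (points V τ₀)
    near⇒∈around : ∀ {w x} → Near w n (suc τ₀) x → x ∈ around w
    near⇒∈around (y , y∈ , refl) = ∈-map⁺ _ (∈-points⁺ y∈)
    O⊆ : O ⊆ around u ++ around v
    O⊆ x∈O = [ (λ near → ∈-++⁺ˡ (near⇒∈around near)) , (λ near → ∈-++⁺ʳ (around u) (near⇒∈around near)) ]′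
      (near-pole (∈-points⁻ (proj₁ (∈-filter⁻ out? {xs = X} x∈O))) (out⇒low (proj₂ (∈-filter⁻ out? {xs = X} x∈O))) τ₀≥ τ₀≤n)

  -- The random bits decide the points of Free. Of the other points, those in O are always
  -- excluded and those near some multiple nw of a vertex are always included.
  module Random (τ₁ : ℕ) where

    τ : ℕ
    τ = suc τ₁

    nearby : List (ℤ^ D)
    nearby = concatMap (λ w → map (λ y → (n ∸ τ) ×ᵥ w +ᵥ y) (points V τ₁)) V

    length-nearby : length nearby ≡ k * length (points V τ₁)
    length-nearby = lemma V
      where
      lemma : ∀ W → length (concatMap (λ w → map (λ y → (n ∸ τ) ×ᵥ w +ᵥ y) (points V τ₁)) W) ≡ length W * length (points V τ₁)
      lemma [] = refl
      lemma (w ∷ W) = trans (List.length-++ (map (λ y → (n ∸ τ) ×ᵥ w +ᵥ y) (points V τ₁))) (cong₂ _+_ (List.length-map _ (points V τ₁)) (lemma W))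

    near⇒nearby : ∀ {w x} → w ∈ V → Near w n τ x → x ∈ nearby
    near⇒nearby w∈ (y , y∈ , refl) = Any.concat⁺ (Any.map⁺ (Any.map (λ { refl → ∈-map⁺ _ (∈-points⁺ y∈) }) w∈))

    free? : ∀ x → Dec (¬ Out x × x ∉ nearby)
    free? x = ¬? (out? x) ×-dec ¬? (x ∈? nearby)

    Free : List (ℤ^ D)
    Free = filter free? X

    Free-unique : Unique Free
    Free-unique = Unique.filter⁺ free? (points-unique V n₁)

    f : ℕ
    f = length Free

    -- All but boundedly many points are free, so 2 ^ f is a fixed proportion of 2 ^ length X.
    length-X : length X ≤ length O + k * length (points V τ₁) + f
    length-X = ≤-trans (Unique⇒⊆⇒length≤ (points-unique V n₁) X⊆)
      (≤-reflexive (trans (List.length-++ (O ++ nearby)) (cong (_+ f) (trans (List.length-++ O) (cong (length O +_) length-nearby)))))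
      where
      X⊆ : X ⊆ (O ++ nearby) ++ Free
      X⊆ {x} x∈ with out? x | x ∈? nearby
      ... | yes out | _ = ∈-++⁺ˡ (∈-++⁺ˡ (∈-filter⁺ out? x∈ out))
      ... | no ¬out | yes near = ∈-++⁺ˡ (∈-++⁺ʳ O near)
      ... | no ¬out | no ¬near = ∈-++⁺ʳ (O ++ nearby) (∈-filter⁺ free? x∈ (¬out , ¬near))

    private
      literal′ : ∀ {x} → Dec (x ∈ Free) → Literal f
      literal′ (yes x∈) = just (Any.index x∈)
      literal′ (no _) = nothing

      literal′-just : ∀ {x i} (x∈? : Dec (x ∈ Free)) → literal′ x∈? ≡ just i → List.lookup Free i ≡ x
      literal′-just (yes x∈) refl = sym (Any.lookup-index x∈)

      literal′-∉ : ∀ {x} (x∈? : Dec (x ∈ Free)) → x ∉ Free → literal′ x∈? ≡ nothing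
      literal′-∉ (yes x∈) x∉ = contradiction x∈ x∉
      literal′-∉ (no _) _ = refl

      literal′-lookup : ∀ i (x∈? : Dec (List.lookup Free i ∈ Free)) → literal′ x∈? ≡ just i
      literal′-lookup i (yes x∈) = cong just (Unique⇒index-lookup Free-unique i x∈)
      literal′-lookup i (no x∉) = contradiction (∈-lookup i) x∉

    literal : ℤ^ D → Literal f
    literal x = literal′ (x ∈? Free)

    literal-apart : ∀ {x y} → x ≢ y → Apart (literal x) (literal y)
    literal-apart {x} {y} x≢y i ex ey = x≢y (trans (sym (literal′-just (x ∈? Free) ex)) (literal′-just (y ∈? Free) ey))

    χ : Subset f → ℤ^ D → Bool
    χ B x = not (does (out? x)) ∧ holds B (literal x)

    A : Subset f → Subset (length X)
    A B = select X (χ B)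

    private
      χ⁺ : ∀ {B x} → ¬ Out x → holds B (literal x) ≡ true → χ B x ≡ true
      χ⁺ {B} {x} ¬out holds with out? x
      ... | yes out = contradiction out ¬out
      ... | no _ = holds

      χ⁻ : ∀ {B x} → χ B x ≡ true → ¬ Out x
      χ⁻ {B} {x} e with out? x
      ... | no ¬out = ¬out

    A-in : ∀ {B x} → x ∈[ n ] → ¬ Out x → holds B (literal x) ≡ true → x ∈ elements X (A B)
    A-in {B} x∈ ¬out holds = ∈-select⁺ X (χ B) (∈-points⁺ x∈) (χ⁺ {B} ¬out holds)

    A-nearby : ∀ {B x} → x ∈[ n ] → ¬ Out x → x ∈ nearby → x ∈ elements X (A B)
    A-nearby {B} {x} x∈ ¬out near = A-in {B} x∈ ¬out (cong (holds B) (literal′-∉ (x ∈? Free) λ x∈F → proj₂ (proj₂ (∈-filter⁻ free? {xs = X} x∈F)) near))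

    A-out : ∀ {B x} → x ∈ elements X (A B) → x ∈[ n ] × ¬ Out x
    A-out {B} x∈ = ∈-points⁻ (proj₁ (∈-select⁻ X (χ B) x∈)) , χ⁻ {B} (proj₂ (∈-select⁻ X (χ B) x∈))

    -- Each free point shows its own bit. Counting good bit vectors thus counts different subsets.
    A-injective : ∀ {B C} → A B ≡ A C → B ≡ C
    A-injective {B} {C} e = Vec-ext λ i → trans (bit B i) (trans (agree i) (sym (bit C i)))
      where
      Vec-ext : ∀ {m} {B C : Subset m} → (∀ i → lookup B i ≡ lookup C i) → B ≡ C
      Vec-ext {B = []} {[]} h = refl
      Vec-ext {B = b ∷ B} {c ∷ C} h = cong₂ _∷_ (h zero) (Vec-ext (h ∘ suc))
      x : Fin f → ℤ^ D
      x i = List.lookup Free i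
      x∈X : ∀ i → x i ∈ X × ¬ Out (x i)
      x∈X i with x∈ , ¬out , _ ← ∈-filter⁻ free? {xs = X} (∈-lookup i) = x∈ , ¬out
      bit : ∀ B i → lookup B i ≡ χ B (x i)
      bit B i with out? (x i)
      ... | yes out = contradiction out (proj₂ (x∈X i))
      ... | no _ = cong (holds B) (sym (literal′-lookup i (x i ∈? Free)))
      agree : ∀ i → χ B (x i) ≡ χ C (x i)
      agree i = trans (cong (χ B) x≡) (trans (sym (Vec.lookup∘tabulate (χ B ∘ List.lookup X) j))
        (trans (cong (λ S → lookup S j) e) (trans (Vec.lookup∘tabulate (χ C ∘ List.lookup X) j) (cong (χ C) (sym x≡)))))
        where
        j = Any.index (proj₁ (x∈X i))
        x≡ : x i ≡ List.lookup X j
        x≡ = Any.lookup-index (proj₁ (x∈X i))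

    -- The strict inequality chooses one order of each pair x, z - x and excludes equal summands.
    -- Different splittings then share no point, which gives independence.
    Splitting : ℤ^ D → ℤ^ D → Set
    Splitting z x = ¬ Out x × (z -ᵥ x ∈ X × (¬ Out (z -ᵥ x) × levˢ x < levˢ (z -ᵥ x)))

    splitting? : ∀ z x → Dec (Splitting z x)
    splitting? z x = ¬? (out? x) ×-dec ((z -ᵥ x ∈? X) ×-dec (¬? (out? (z -ᵥ x)) ×-dec (levˢ x <? levˢ (z -ᵥ x))))

    splittings : ℤ^ D → List (ℤ^ D)
    splittings z = filter (splitting? z) X

    ∈-splittings⁻ : ∀ {z x} → x ∈ splittings z → x ∈ X × Splitting z x
    ∈-splittings⁻ {z} = ∈-filter⁻ (splitting? z) {xs = X}

    pairs : ℤ^ D → List (Literal f × Literal f)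
    pairs z = map (λ x → literal x , literal (z -ᵥ x)) (splittings z)

    pairs-independent : ∀ z → Independent (pairs z)
    pairs-independent z = independent
      (All.map⁺ (All.tabulate λ x∈ → literal-apart λ x≡ → <⇒≢ (lower x∈) (cong levˢ x≡)))
      (AllPairs.map⁺ (Unique⇒AllPairs (Unique.filter⁺ (splitting? z) (points-unique V n₁)) λ {x} {y} x∈ y∈ x≢y →
        (literal-apart x≢y , literal-apart (crossed x∈ y∈)) ,
        (literal-apart (≢-sym (crossed y∈ x∈)) , literal-apart λ e → x≢y (minus-injective e))))
      where
      lower : ∀ {x} → x ∈ splittings z → levˢ x < levˢ (z -ᵥ x)
      lower x∈ = proj₂ (proj₂ (proj₂ (proj₂ (∈-splittings⁻ {z} x∈))))
      crossed : ∀ {x y} → x ∈ splittings z → y ∈ splittings z → x ≢ z -ᵥ y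
      crossed {x} {y} x∈ y∈ e = <-asym (lower x∈) (subst₂ (λ a b → levˢ a < levˢ b) (sym z-x) (sym e) (lower y∈))
        where
        z-x : z -ᵥ x ≡ y
        z-x = +ᵥ⇒-ᵥ (trans (+ᵥ.comm y x) (-ᵥ⇒+ᵥ e))
      minus-injective : ∀ {x y} → z -ᵥ x ≡ z -ᵥ y → x ≡ y
      minus-injective {x} {y} e = +ᵥ.cancelˡ (z -ᵥ y) x y (trans (-ᵥ⇒+ᵥ (sym e)) (sym (-ᵥ-+ᵥ z y)))

    private
      guarded : ∀ {Q : Set} → Dec Q → ℕ → ℕ
      guarded (yes _) x = x
      guarded (no _) x = 0

      guarded-bound : ∀ {Q : Set} (Q? : Dec Q) (g : Subset f → ℕ) c → (Q → ∑ₛ f g * 2 ^ c ≤ 2 ^ f) → ∑ₛ f (λ B → guarded Q? (g B)) * 2 ^ c ≤ 2 ^ f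
      guarded-bound (yes q) g c bound = bound q
      guarded-bound (no _) g c _ = ≤-trans (≤-reflexive (cong (_* 2 ^ c) (∑ₛ-0 f))) z≤n

      guarded≡0 : ∀ {Q : Set} (Q? : Dec Q) {x} → Q → guarded Q? x ≡ 0 → x ≡ 0
      guarded≡0 (yes _) _ e = e
      guarded≡0 (no ¬q) q _ = contradiction q ¬q

    -- The guard makes the bound hold for all parameters, including those in the box that assemble
    -- to a vector with too few splittings.
    term : ℤ^ D → ℕ → Subset f → ℕ
    term z c B = guarded (3 * c ≤? length (splittings z)) (misses (pairs z) B)

    term-bound : ∀ z c → ∑ₛ f (term z c) * 2 ^ c ≤ 2 ^ f
    term-bound z c = guarded-bound (3 * c ≤? length (splittings z)) (misses (pairs z)) c λ enough →
      misses-bound-2^ (pairs-independent z) c (≤-trans enough (≤-reflexive (sym (List.length-map _ (splittings z)))))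

    private
      ∧-true⁻ : ∀ {a b} → a ∧ b ≡ true → a ≡ true × b ≡ true
      ∧-true⁻ {true} e = refl , e

      misses≡0 : ∀ {m} (B : Subset m) ps → misses ps B ≡ 0 → Any (λ (p , q) → holds B p ≡ true × holds B q ≡ true) ps
      misses≡0 B ((p , q) ∷ ps) e with holds B p ∧ holds B q in eq
      ... | true = here (∧-true⁻ eq)
      ... | false = there (misses≡0 B ps (trans (sym (+-identityʳ _)) e))

    Hit : Subset f → ℤ^ D → Set
    Hit B z = ∃[ x ] ∃[ y ] x ∈ elements X (A B) × y ∈ elements X (A B) × x +ᵥ y ≡ z

    term≡0⇒hit : ∀ {z c B} → term z c B ≡ 0 → 3 * c ≤ length (splittings z) → Hit B z
    term≡0⇒hit {z} {c} {B} e enough = conclude (find (Any.map⁻ (misses≡0 B (pairs z) (guarded≡0 (3 * c ≤? length (splittings z)) enough e))))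
      where
      conclude : ∃[ x ] x ∈ splittings z × (holds B (literal x) ≡ true × holds B (literal (z -ᵥ x)) ≡ true) → Hit B z
      conclude (x , x∈ , holds-x , holds-y) with x∈X , ¬out-x , y∈X , ¬out-y , _ ← ∈-splittings⁻ {z} x∈ =
        x , z -ᵥ x , A-in {B} (∈-points⁻ x∈X) ¬out-x holds-x , A-in {B} (∈-points⁻ y∈X) ¬out-y holds-y ,
        trans (+ᵥ.comm x (z -ᵥ x)) (-ᵥ-+ᵥ z x)

    -- All levels on the chain of summands are different, and at most one of them is half the level of z.
    spread-bound : ∀ {z} (ρ : Representation n z) → Representation.spread ρ ≤ 2 * length (splittings z) + 2 * length O
    spread-bound {z} ρ = ≤-pred (begin
      suc spread  ≡⟨ length-xs ⟨
      length xs  ≡⟨ List.length-map double xs ⟨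
      length (map double xs)  ≤⟨ Unique⇒⊆⇒length≤ unique covered ⟩
      length targets  ≡⟨ cong suc lengths ⟩
      suc (2 * size + 2 * length O)  ∎)
      where
      open ≤-Reasoning
      open Representation ρ
      -- Levels are doubled because half the level of z need not be an integer.
      double : ℤ^ D → ℕ
      double x = levˢ x + levˢ x
      size = length (splittings z)
      R = splittings z
      opposite : ℤ^ D → ℕ
      opposite x = double (z -ᵥ x)
      targets : List ℕ
      targets = South.lev (n + n) z ∷ (map double R ++ map opposite R) ++ (map double O ++ map opposite O)
      lengths : length ((map double R ++ map opposite R) ++ (map double O ++ map opposite O)) ≡ 2 * size + 2 * length O
      lengths = trans (List.length-++ (map double R ++ map opposite R)) (cong₂ _+_ (two R) (two O))
        where
        two : ∀ ys → length (map double ys ++ map opposite ys) ≡ 2 * length ys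
        two ys = trans (List.length-++ (map double ys)) (cong₂ _+_ (List.length-map double ys) (trans (List.length-map opposite ys) (sym (+-identityʳ _))))
      unique : Unique (map double xs)
      unique = AllPairs.map⁺ (AllPairs.map (λ lt → <⇒≢ (+-mono-< lt lt)) distinct)
      place : ∀ {x} → Summand n z x → double x ∈ targets
      place {x} (x∈ , y , y∈ , x+y) with refl ← +ᵥ⇒-ᵥ (trans (+ᵥ.comm y x) x+y) with out? x | out? (z -ᵥ x)
      ... | yes out | _ = there (∈-++⁺ʳ (map double R ++ map opposite R) (∈-++⁺ˡ (∈-map⁺ double (∈-filter⁺ out? (∈-points⁺ x∈) out))))
      ... | no _ | yes out = there (∈-++⁺ʳ (map double R ++ map opposite R) (∈-++⁺ʳ (map double O)
        (subst (_∈ map opposite O) (cong double (+ᵥ⇒-ᵥ x+y)) (∈-map⁺ opposite (∈-filter⁺ out? (∈-points⁺ y∈) out)))))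
      ... | no ¬out-x | no ¬out-y with <-cmp (levˢ x) (levˢ (z -ᵥ x))
      ... | tri< lt _ _ = there (∈-++⁺ˡ (∈-++⁺ˡ (∈-map⁺ double (∈-filter⁺ (splitting? z) (∈-points⁺ x∈) (¬out-x , ∈-points⁺ y∈ , ¬out-y , lt)))))
      ... | tri≈ _ e _ = here (trans (cong (levˢ x +_) e) (trans (sym (South.lev-+ x∈ y∈)) (cong (South.lev (n + n)) x+y)))
      ... | tri> _ _ gt = there (∈-++⁺ˡ (∈-++⁺ʳ (map double R)
        (subst (_∈ map opposite R) (cong double x≡) (∈-map⁺ opposite (∈-filter⁺ (splitting? z) (∈-points⁺ y∈)
          (¬out-y , subst (_∈ X) (sym x≡) (∈-points⁺ x∈) , subst (¬_ ∘ Out) (sym x≡) ¬out-x , subst (λ x → levˢ (z -ᵥ _) < levˢ x) (sym x≡) gt))))))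
        where
        x≡ : z -ᵥ (z -ᵥ x) ≡ x
        x≡ = +ᵥ⇒-ᵥ x+y
      covered : map double xs ⊆ targets
      covered i with x , x∈ , refl ← ∈-map⁻ double i = place (All.lookup summands x∈)

-- Attained sums, omitted sums and blocked differences

-ᵥ≡-ᵥ⇒+ᵥ≡+ᵥ : ∀ {D} {a b c d : ℤ^ D} → a -ᵥ b ≡ c -ᵥ d → a +ᵥ d ≡ b +ᵥ c
-ᵥ≡-ᵥ⇒+ᵥ≡+ᵥ {a = a} {b} {c} {d} e = begin
  a +ᵥ d  ≡⟨ cong (_+ᵥ d) (-ᵥ-+ᵥ a b) ⟨
  (a -ᵥ b) +ᵥ b +ᵥ d  ≡⟨ cong (λ x → x +ᵥ b +ᵥ d) e ⟩
  (c -ᵥ d) +ᵥ b +ᵥ d  ≡⟨ +ᵥ.solve 3 (λ x b d → (x ⊞ b) ⊞ d ⊜ b ⊞ (x ⊞ d)) refl (c -ᵥ d) b d ⟩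
  b +ᵥ ((c -ᵥ d) +ᵥ d)  ≡⟨ cong (b +ᵥ_) (-ᵥ-+ᵥ c d) ⟩
  b +ᵥ c  ∎
  where open ≡-Reasoning

module _ {D : ℕ} where

  open DecMembership (_≟_ {D}) using (_∈?_)

  ∣∣-≤ : ∀ {xs ys : List (ℤ^ D)} → xs ⊆ ys → ∣ xs ∣ ≤ length ys
  ∣∣-≤ {xs} xs⊆ys = Unique⇒⊆⇒length≤ (UniqueDec.deduplicate-! _≟_ xs) (xs⊆ys ∘ ∈-deduplicate⁻ _≟_ xs)

  ≤-∣∣ : ∀ {xs ys : List (ℤ^ D)} → Unique xs → xs ⊆ ys → length xs ≤ ∣ ys ∣
  ≤-∣∣ u xs⊆ys = Unique⇒⊆⇒length≤ u (∈-deduplicate⁺ _≟_ ∘ xs⊆ys)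

  ∈-∖⁺ : ∀ {xs ys : List (ℤ^ D)} {z} → z ∈ xs → z ∉ ys → z ∈ xs ∖ ys
  ∈-∖⁺ {ys = ys} = ∈-filter⁺ (λ z → ¬? (z ∈? ys))

  ∈-∖⁻ : ∀ {xs ys : List (ℤ^ D)} {z} → z ∈ xs ∖ ys → z ∈ xs × z ∉ ys
  ∈-∖⁻ {xs} {ys} = ∈-filter⁻ (λ z → ¬? (z ∈? ys)) {xs = xs}

-- The radius `suc τ₁` covers the gap zones, by `suc τ₀`, and every sum of too small a spread. By
-- `n≥`, neighbourhoods of other vertices stay above the 19 blocks of a pole; `E≥` pays for the
-- choices of w, r, r′ and the geometric series.
module Conclusion {D} {V : List (ℤ^ D)} (P : Poles V) (s H n₁ : ℕ) (s<H : s < H) (k+2≤H : length V + 2 ≤ H)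
  (large : 38 * (H * Poles.width P) ≤ suc n₁) (τ₀ τ₁ E : ℕ)
  (τ₀≥ : 19 * (H * Poles.width P) + length V ≤ suc τ₀)
  (τ₁≥ : suc τ₀ + (24 * E + 8 * (length (Decide.points V τ₀) + length (Decide.points V τ₀)) + (length V + length V)) ≤ suc τ₁)
  (n≥ : suc τ₁ + 19 * (H * Poles.width P) ≤ suc n₁)
  (E≥ : 2 * (length V * (length (Decide.points V (ℕ.pred (length V))) * (length (Decide.points V (ℕ.pred (length V))) * 48 ^ length V))) ≤ 2 ^ E) where

  open Dilates V
  open Poles P
  open Geometry P
  open Representations P
  open Decide {D}
  open Fringe P s H n₁ s<H k+2≤H large
  open Counting P s H n₁ s<H k+2≤H large
  open Random τ₁
  open Quotients h

  τ≤n : τ ≤ n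
  τ≤n = ≤-trans (m≤m+n τ (19 * h)) n≥

  o : ℕ
  o = length (points V τ₀) + length (points V τ₀)

  spread-threshold : ℕ
  spread-threshold = 24 * E + 8 * o

  τ₀≤τ : suc τ₀ ≤ τ
  τ₀≤τ = ≤-trans (m≤m+n (suc τ₀) _) τ₁≥

  threshold≤τ : spread-threshold + (k + k) ≤ τ
  threshold≤τ = ≤-trans (m≤n+m _ (suc τ₀)) τ₁≥

  length-O≤o : length O ≤ o
  length-O≤o = length-O τ₀ τ₀≥ (≤-trans τ₀≤τ τ≤n)

  fringed∈A : ∀ {B x} → Fringed x → x ∈ elements X (A B)
  fringed∈A {B} {x} (x∈ , ¬out , low) = A-nearby {B} x∈ ¬out
    ([ near⇒nearby South.apex∈ , near⇒nearby North.apex∈ ]′ (near-pole x∈ low (≤-trans τ₀≥ τ₀≤τ) τ≤n))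

  private
    Rest : List (ℤ^ D)
    Rest = points V (ℕ.pred k)

    0<k : 0 < k
    0<k = lemma South.apex∈
      where
      lemma : ∀ {W : List (ℤ^ D)} {w} → w ∈ W → 0 < length W
      lemma (here _) = s≤s z≤n
      lemma (there _) = s≤s z≤n

    ∈-Rest : ∀ {r} → r ∈[ k ] → r ∈ Rest
    ∈-Rest r∈ = ∈-points⁺ (∈[]-cast (sym (suc-pred k {{ℕ.>-nonZero 0<k}})) r∈)

    -- The multiplicities sum to twice the spread, hence to at most 2n.
    K : ℕ
    K = suc (2 * n)

    cost : ℤ^ D → ℤ^ D → ℤ^ D → Vec ℕ k → Subset f → ℕ
    cost w r r′ m = term (assemble n w r r′ m) (E + weight m)

  -- Counts failures over all parameters. A vector assembled from several of them is counted
  -- repeatedly, which only enlarges the upper bound.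
  total : Subset f → ℕ
  total B = Σ[ V ] λ w → Σ[ Rest ] λ r → Σ[ Rest ] λ r′ → Σ[ box K k ] λ m → cost w r r′ m B

  private
    Σ-scaled-≤ : ∀ {A : Set} (xs : List A) g c {b} → (∀ x → g x * c ≤ b) → Σ[ xs ] g * c ≤ length xs * b
    Σ-scaled-≤ xs g c h = ≤-trans (≤-reflexive (sym (Σ-*ʳ xs g c))) (Σ-≤ {xs = xs} λ {x} _ → h x)

    W₀ : ℤ^ D → ℤ^ D → ℤ^ D → ℕ
    W₀ w r r′ = Σ[ box K k ] λ m → ∑ₛ f (cost w r r′ m)

    W₁ : ℤ^ D → ℤ^ D → ℕ
    W₁ w r = Σ[ Rest ] W₀ w r

    W₂ : ℤ^ D → ℕ
    W₂ w = Σ[ Rest ] W₁ w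

    ρ : ℕ
    ρ = length Rest

    W₀≤ : ∀ w r r′ → W₀ w r r′ * 2 ^ E ≤ 48 ^ k * 2 ^ f
    W₀≤ w r r′ = ≤-trans (≤-reflexive (sym (Σ-*ʳ (box K k) (λ m → ∑ₛ f (cost w r r′ m)) (2 ^ E))))
      (Σ-box-≤ K k (λ m → ∑ₛ f (cost w r r′ m) * 2 ^ E) (2 ^ f) λ m →
        ≤-trans (≤-reflexive (trans (*-assoc (∑ₛ f (cost w r r′ m)) (2 ^ E) (2 ^ weight m)) (cong (∑ₛ f (cost w r r′ m) *_) (sym (^-distribˡ-+-* 2 E (weight m))))))
          (term-bound (assemble n w r r′ m) (E + weight m)))

    ∑ₛ-total : ∑ₛ f total ≡ Σ[ V ] W₂
    ∑ₛ-total = trans (∑ₛ-Σ f V _) (cong-Σ V λ w → trans (∑ₛ-Σ f Rest _) (cong-Σ Rest λ r → trans (∑ₛ-Σ f Rest _)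
      (cong-Σ Rest λ r′ → ∑ₛ-Σ f (box K k) (cost w r r′))))
      where
      cong-Σ : ∀ {A : Set} (xs : List A) {g h : A → ℕ} → (∀ x → g x ≡ h x) → Σ[ xs ] g ≡ Σ[ xs ] h
      cong-Σ xs e = cong Σℕ (List.map-cong e xs)

  total-bound : 2 * ∑ₛ f total ≤ 2 ^ f
  total-bound = *-cancelʳ-≤ (2 * ∑ₛ f total) (2 ^ f) (2 ^ E) {{m^n≢0 2 E}} (begin
    2 * ∑ₛ f total * 2 ^ E  ≡⟨ cong (λ t → 2 * t * 2 ^ E) ∑ₛ-total ⟩
    2 * Σ[ V ] W₂ * 2 ^ E  ≡⟨ *-assoc 2 (Σ[ V ] W₂) (2 ^ E) ⟩
    2 * (Σ[ V ] W₂ * 2 ^ E)  ≤⟨ *-monoʳ-≤ 2 (Σ-scaled-≤ V W₂ (2 ^ E) λ w → Σ-scaled-≤ Rest (W₁ w) (2 ^ E) λ r → Σ-scaled-≤ Rest (W₀ w r) (2 ^ E) (W₀≤ w r)) ⟩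
    2 * (k * (ρ * (ρ * (48 ^ k * 2 ^ f))))  ≡⟨ rearrange k ρ (48 ^ k) (2 ^ f) ⟩
    2 * (k * (ρ * (ρ * 48 ^ k))) * 2 ^ f  ≤⟨ *-monoˡ-≤ (2 ^ f) E≥ ⟩
    2 ^ E * 2 ^ f  ≡⟨ *-comm (2 ^ E) (2 ^ f) ⟩
    2 ^ f * 2 ^ E  ∎)
    where
    open ≤-Reasoning
    rearrange : ∀ k r q g → 2 * (k * (r * (r * (q * g)))) ≡ 2 * (k * (r * (r * q))) * g
    rearrange = solve-∀

  module _ (B : Subset f) (good : total B ≡ 0) where

    private
      cost≡0 : ∀ {w r r′} m → w ∈ V → r ∈[ k ] → r′ ∈[ k ] → Vec.sum m < K → cost w r r′ m B ≡ 0
      cost≡0 {w} {r} {r′} m w∈ r∈ r′∈ m< = n≤0⇒n≡0 (begin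
        cost w r r′ m B  ≤⟨ Σ-member (λ m → cost w r r′ m B) (∈-box m m<) ⟩
        T₀ w r r′  ≤⟨ Σ-member (T₀ w r) (∈-Rest r′∈) ⟩
        T₁ w r  ≤⟨ Σ-member (T₁ w) (∈-Rest r∈) ⟩
        T₂ w  ≤⟨ Σ-member T₂ w∈ ⟩
        total B  ≡⟨ good ⟩
        0  ∎)
        where
        open ≤-Reasoning
        T₀ : ℤ^ D → ℤ^ D → ℤ^ D → ℕ
        T₀ w r r′ = Σ[ box K k ] λ m → cost w r r′ m B
        T₁ : ℤ^ D → ℤ^ D → ℕ
        T₁ w r = Σ[ Rest ] T₀ w r
        T₂ : ℤ^ D → ℕ
        T₂ w = Σ[ Rest ] T₁ w

      far : ∀ {z} (π : Representation n z) → spread-threshold ≤ 2 * Representation.spread π → Hit B z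
      far {z} π spread-out = subst (Hit B) (sym z≡) (term≡0⇒hit {assemble n w r r′ m} {E + weight m} {B} (cost≡0 m w∈ r∈ r′∈ m<K)
        (subst (λ z → 3 * (E + weight m) ≤ length (splittings z)) z≡ enough))
        where
        open Representation π
        t = length (splittings z)
        m<K : Vec.sum m < K
        m<K = s≤s (≤-trans (≤-reflexive sum-m) (*-monoʳ-≤ 2 (≤-trans spread≤ (m∸n≤m n k))))
        enough : 3 * (E + weight m) ≤ t
        -- By `spread-bound`, 4 · spread is at most 8t + 8o. One half of it pays for the threshold
        -- 24 E + 8 o, the other equals the sum of m and pays for 24 · weight m. As three pairs are
        -- needed per factor 1/2, this fixes 24 = 8 · 3.
        enough = *-cancelˡ-≤ 8 (+-cancelʳ-≤ (8 * o) _ _ (begin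
          8 * (3 * (E + weight m)) + 8 * o  ≡⟨ lemma₁ E (weight m) (8 * o) ⟩
          spread-threshold + weight m * 24  ≤⟨ +-mono-≤ spread-out (≤-trans (weight≤ m) (≤-reflexive sum-m)) ⟩
          2 * spread + 2 * spread  ≡⟨ lemma₂ spread ⟩
          4 * spread  ≤⟨ *-monoʳ-≤ 4 (spread-bound π) ⟩
          4 * (2 * t + 2 * length O)  ≤⟨ *-monoʳ-≤ 4 (+-monoʳ-≤ (2 * t) (*-monoʳ-≤ 2 length-O≤o)) ⟩
          4 * (2 * t + 2 * o)  ≡⟨ lemma₃ t o ⟩
          8 * t + 8 * o  ∎))
          where
          open ≤-Reasoning
          lemma₁ : ∀ e w q → 8 * (3 * (e + w)) + q ≡ 24 * e + q + w * 24
          lemma₁ = solve-∀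
          lemma₂ : ∀ s → 2 * s + 2 * s ≡ 4 * s
          lemma₂ = solve-∀
          lemma₃ : ∀ t o → 4 * (2 * t + 2 * o) ≡ 8 * t + 8 * o
          lemma₃ = solve-∀

    Represented : ℤ^ D → Set
    Represented z = Hit B z ⊎ ∃[ g ] g ∈ F × z ≡ n ×ᵥ u +ᵥ g

    private
      -- Near nw with another vertex w, the level at this pole is at least n - τ, hence at least
      -- 19h.
      apex-of : ∀ (Q : Pole V) {w y} → w ∈ V → Near w n τ y → Pole.lev Q n y < 19 * h → w ≡ Pole.apex Q
      apex-of Q {w} {y} w∈ near low = [ id , (λ w≢ → contradiction low (≤⇒≯ (high w≢))) ]′ (cases (w ≟ Pole.apex Q))
        where
        cases : ∀ {A : Set} → Dec A → A ⊎ ¬ A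
        cases (yes a) = inj₁ a
        cases (no ¬a) = inj₂ ¬a
        high : w ≢ Pole.apex Q → 19 * h ≤ Pole.lev Q n y
        high w≢ = begin
          19 * h  ≡⟨ m+n∸m≡n τ (19 * h) ⟨
          τ + 19 * h ∸ τ  ≤⟨ ∸-monoˡ-≤ τ n≥ ⟩
          n ∸ τ  ≡⟨ *-identityʳ (n ∸ τ) ⟨
          (n ∸ τ) * 1  ≤⟨ *-monoʳ-≤ (n ∸ τ) (Pole.0<lev Q w∈ w≢) ⟩
          (n ∸ τ) * Pole.lev Q 1 w  ≤⟨ near-lev Q w∈ τ≤n near ⟩
          Pole.lev Q n y  ∎
          where open ≤-Reasoning

      bridged : ∀ {z} → ∃[ a ] ∃[ b ] a +ᵥ b ≡ z × Fringed a × Fringed b → Hit B z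
      bridged (a , b , a+b , a-fringed , b-fringed) = a , b , fringed∈A {B} a-fringed , fringed∈A {B} b-fringed , a+b

      -- The pair nw, y itself is available unless y is excluded. In that case `apex-of` identifies
      -- w with the pole whose rule excludes y, and the bridges of that pole apply.
      close : ∀ {w y} → w ∈ V → y ∈[ n ] → Near w n τ y → Dec (Out y) → Represented (n ×ᵥ w +ᵥ y)
      close {w} {y} w∈ y∈ near (no ¬out) = inj₁ (n ×ᵥ w , y ,
        A-nearby {B} (∈[]-× w∈ n) (vertices-in w∈) (near⇒nearby w∈ (near-apex w∈ τ≤n)) , A-nearby {B} y∈ ¬out (near⇒nearby w∈ near) , refl)
      close {w} {y} w∈ y∈ near (yes (southern q∈)) = subst (λ w → Represented (n ×ᵥ w +ᵥ y)) (sym (apex-of south w∈ near (southern⇒<19h q∈)))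
        (inj₁ (bridged (southern-bridge y∈ q∈)))
      close {w} {y} w∈ y∈ near (yes (omitted y∈F)) = inj₂ (y , y∈F , cong (λ w → n ×ᵥ w +ᵥ y) (apex-of south w∈ near (omitted⇒<19h y∈F)))
      close {w} {y} w∈ y∈ near (yes (northern q∈)) = subst (λ w → Represented (n ×ᵥ w +ᵥ y)) (sym (apex-of north w∈ near (northern⇒<19h q∈)))
        (inj₁ (bridged (northern-bridge y∈ q∈)))

      near-or-far : ∀ {z} (π : Representation n z) → Dec (2 * Representation.spread π + (k + k) ≤ τ) → Represented z
      near-or-far {z} π (yes small) = conclude (Representation.z≡near π small τ≤n)
        where
        conclude : ∃[ y ] Near (Representation.w π) n τ y × z ≡ n ×ᵥ Representation.w π +ᵥ y → Represented z
        conclude (y , near , z≡) = subst Represented (sym z≡)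
          (close (Representation.w∈ π) (near-∈ (Representation.w∈ π) τ≤n near) near (out? y))
      near-or-far π (no ¬small) = inj₁ (far π (+-cancelʳ-≤ (k + k) _ _ (≤-trans threshold≤τ (≰⇒≥ ¬small))))

    represented : ∀ {x y} → x ∈[ n ] → y ∈[ n ] → Represented (x +ᵥ y)
    represented x∈ y∈ = near-or-far π (2 * Representation.spread π + (k + k) ≤? τ)
      where
      π = represent (≤-trans (≤-trans (m≤m+n k k) (m≤n+m (k + k) spread-threshold)) (≤-trans threshold≤τ τ≤n)) x∈ y∈

  -- If neither summand is nu, both have positive level, so x lies strictly below g and was omitted
  -- as well. If one of them is nu, the other is g.
  omitted-unrepresented : ∀ {B g} → g ∈ F → ¬ Hit B (n ×ᵥ u +ᵥ g)
  omitted-unrepresented {B} {g} g∈ (x , y , x∈A , y∈A , x+y) = cases (x ≟ (n ×ᵥ u)) (y ≟ (n ×ᵥ u))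
    where
    x∈ = proj₁ (A-out {B} x∈A)
    y∈ = proj₁ (A-out {B} y∈A)
    levels : levˢ x + levˢ y ≡ levˢ g
    levels = trans (sym (South.lev-+ x∈ y∈)) (trans (cong (South.lev (n + n)) x+y)
      (trans (South.lev-+ (∈[]-× South.apex∈ n) (proj₁ (F⊆ g∈))) (cong (_+ levˢ g) (South.lev-apex n))))
    cases : Dec (x ≡ n ×ᵥ u) → Dec (y ≡ n ×ᵥ u) → ⊥
    cases (yes x≡) _ = proj₂ (A-out {B} y∈A) (omitted (subst (_∈ F) (+ᵥ.cancelˡ (n ×ᵥ u) g y (trans (sym x+y) (cong (_+ᵥ y) x≡))) g∈))
    cases (no _) (yes y≡) = proj₂ (A-out {B} x∈A) (omitted (subst (_∈ F)
      (+ᵥ.cancelˡ (n ×ᵥ u) g x (trans (sym x+y) (trans (cong (x +ᵥ_) y≡) (+ᵥ.comm x (n ×ᵥ u))))) g∈))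
    cases (no x≢) (no y≢) = proj₂ (A-out {B} x∈A) (omitted (F-closed g∈ x∈ x≢
      (<-≤-trans (m<m+n (levˢ x) (n≢0⇒n>0 λ e → y≢ (South.lev≡0⇒ y∈ e))) (≤-reflexive levels))))

  -- If y - x = (n - j) (v - u), then the levels of x above u and of y below v add up to j times the width.
  module _ {B : Subset f} (j : ℕ) (j≤n : j ≤ n) (18h≤ : 18 * h ≤ j * width) (<19h : j * width < 19 * h) where

    unattained-difference : ∀ {x y} → x ∈ elements X (A B) → y ∈ elements X (A B) →
      (n ∸ j) ×ᵥ v +ᵥ j ×ᵥ u +ᵥ x ≢ n ×ᵥ u +ᵥ y
    unattained-difference {x} {y} x∈A y∈A e =
      [ (λ q∈ → proj₂ (A-out {B} x∈A) (southern q∈)) , (λ q∈ → proj₂ (A-out {B} y∈A) (northern q∈)) ]′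
        (Gaps.complementary (≤-trans (quotient-+≤ (levˢ x) (levⁿ y)) quotient≤18) (≤-pred (≤-trans 18≤quotient (quotient-+≥ (levˢ x) (levⁿ y)))))
      where
      x∈ = proj₁ (A-out {B} x∈A)
      y∈ = proj₁ (A-out {B} y∈A)
      i+j : n ∸ j + j ≡ n
      i+j = m∸n+n≡m j≤n
      levels : (n ∸ j) * width + levˢ x ≡ levˢ y
      levels = begin
        (n ∸ j) * width + levˢ x  ≡⟨ cong (_+ levˢ x) (levˢ-mixture (n ∸ j) j i+j) ⟨
        levˢ ((n ∸ j) ×ᵥ v +ᵥ j ×ᵥ u) + levˢ x  ≡⟨ South.lev-+ (∈[]-mixture (n ∸ j) j i+j) x∈ ⟨
        South.lev (n + n) ((n ∸ j) ×ᵥ v +ᵥ j ×ᵥ u +ᵥ x)  ≡⟨ cong (South.lev (n + n)) e ⟩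
        South.lev (n + n) (n ×ᵥ u +ᵥ y)  ≡⟨ South.lev-+ (∈[]-× South.apex∈ n) y∈ ⟩
        levˢ (n ×ᵥ u) + levˢ y  ≡⟨ cong (_+ levˢ y) (South.lev-apex n) ⟩
        levˢ y  ∎
        where open ≡-Reasoning
      sum : levˢ x + levⁿ y ≡ j * width
      sum = +-cancelˡ-≡ ((n ∸ j) * width) _ _ (begin
        (n ∸ j) * width + (levˢ x + levⁿ y)  ≡⟨ +-assoc ((n ∸ j) * width) (levˢ x) (levⁿ y) ⟨
        (n ∸ j) * width + levˢ x + levⁿ y  ≡⟨ cong (_+ levⁿ y) levels ⟩
        levˢ y + levⁿ y  ≡⟨ lev-sumⁿ y∈ ⟩
        n * width  ≡⟨ cong (_* width) i+j ⟨
        (n ∸ j + j) * width  ≡⟨ *-distribʳ-+ width (n ∸ j) j ⟩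
        (n ∸ j) * width + j * width  ∎)
        where open ≡-Reasoning
      quotient≤18 : (levˢ x + levⁿ y) / h ≤ 18
      quotient≤18 = ≤-pred (m<n*o⇒m/o<n (≤-<-trans (≤-reflexive sum) <19h))
      18≤quotient : 18 ≤ (levˢ x + levⁿ y) / h
      18≤quotient = *≤⇒≤/ 18 (≤-trans 18h≤ (≤-reflexive (sym sum)))

  -- Counting the missing sums and differences

  module Missing (d : ℕ) (d≤H : d ≤ H) where

    module _ (B : Subset f) (good : total B ≡ 0) where

      private
        A′ : List (ℤ^ D)
        A′ = elements X (A B)

        hit⇒∈ : ∀ {z} → Hit B z → z ∈ A′ ⊕ A′
        hit⇒∈ (x , y , x∈ , y∈ , refl) = ∈-cartesianProductWith⁺ (Vec.zipWith ℤ._+_) x∈ y∈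

        ∈⇒hit : ∀ {z} → z ∈ A′ ⊕ A′ → Hit B z
        ∈⇒hit z∈ = conclude (∈-cartesianProductWith⁻ (Vec.zipWith ℤ._+_) A′ A′ z∈)
          where
          conclude : ∀ {z} → ∃[ x ] ∃[ y ] x ∈ A′ × y ∈ A′ × z ≡ x +ᵥ y → Hit B z
          conclude (x , y , x∈ , y∈ , z≡) = x , y , x∈ , y∈ , sym z≡

        omitted-sums : List (ℤ^ D)
        omitted-sums = map (n ×ᵥ u +ᵥ_) F

        missing⊆ : (X ⊕ X) ∖ (A′ ⊕ A′) ⊆ omitted-sums
        missing⊆ z∈ = conclude (∈-cartesianProductWith⁻ (Vec.zipWith ℤ._+_) X X (proj₁ (∈-∖⁻ {xs = X ⊕ X} z∈))) (proj₂ (∈-∖⁻ {xs = X ⊕ X} z∈))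
          where
          classify : ∀ {z} → Represented B good z → z ∉ A′ ⊕ A′ → z ∈ omitted-sums
          classify (inj₁ hit) z∉ = contradiction (hit⇒∈ hit) z∉
          classify (inj₂ (g , g∈ , refl)) _ = ∈-map⁺ (n ×ᵥ u +ᵥ_) g∈
          conclude : ∀ {z} → ∃[ x ] ∃[ y ] x ∈ X × y ∈ X × z ≡ x +ᵥ y → z ∉ A′ ⊕ A′ → z ∈ omitted-sums
          conclude (x , y , x∈ , y∈ , refl) = classify (represented B good (∈-points⁻ x∈) (∈-points⁻ y∈))

        ⊆missing : omitted-sums ⊆ (X ⊕ X) ∖ (A′ ⊕ A′)
        ⊆missing z∈ = conclude (∈-map⁻ (n ×ᵥ u +ᵥ_) z∈)
          where
          conclude : ∀ {z} → ∃[ g ] g ∈ F × z ≡ n ×ᵥ u +ᵥ g → z ∈ (X ⊕ X) ∖ (A′ ⊕ A′)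
          conclude (g , g∈ , refl) = ∈-∖⁺ {xs = X ⊕ X} (∈-cartesianProductWith⁺ (Vec.zipWith ℤ._+_) (∈-points⁺ (∈[]-× South.apex∈ n)) (∈-points⁺ (proj₁ (F⊆ g∈))))
            (λ i → omitted-unrepresented {B} g∈ (∈⇒hit i))

      missing-sums : ∣ (X ⊕ X) ∖ (A′ ⊕ A′) ∣ ≡ s
      missing-sums = ≤-antisym (≤-trans (∣∣-≤ missing⊆) (≤-reflexive length-omitted))
        (≤-trans (≤-reflexive (sym length-omitted)) (≤-∣∣ (Unique.map⁺ (+ᵥ.cancelˡ (n ×ᵥ u) _ _) F-unique) ⊆missing))
        where
        length-omitted : length omitted-sums ≡ s
        length-omitted = trans (List.length-map _ F) length-F

      private
        -- As i < d ≤ H, every `j i * width` lies in block 18, where the gap systems are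
        -- complementary.
        j : ℕ → ℕ
        j i = 18 * H + i

        j<19H : ∀ {i} → i < d → j i < 19 * H
        j<19H {i} i<d = <-≤-trans (+-monoʳ-< (18 * H) (<-≤-trans i<d d≤H)) (≤-reflexive (+-comm (18 * H) H))

        j<n : ∀ {i} → i < d → j i < n
        j<n i<d = <-≤-trans (j<19H i<d) (≤-trans (*-monoʳ-≤ 19 (m≤m*n H width)) 19h≤n)

        point : ℕ → ℤ^ D
        point i = (n ∸ j i) ×ᵥ v +ᵥ j i ×ᵥ u

        point∈ : ∀ {i} → i < d → point i ∈[ n ]
        point∈ {i} i<d = ∈[]-mixture (n ∸ j i) (j i) (m∸n+n≡m (<⇒≤ (j<n i<d)))

        lev-point : ∀ {i} → i < d → levˢ (point i) ≡ (n ∸ j i) * width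
        lev-point {i} i<d = levˢ-mixture (n ∸ j i) (j i) (m∸n+n≡m (<⇒≤ (j<n i<d)))

        forward backward : ℕ → ℤ^ D
        forward i = point i -ᵥ n ×ᵥ u
        backward i = n ×ᵥ u -ᵥ point i

        unattained : ∀ {i x y} → i < d → x ∈ A′ → y ∈ A′ → point i +ᵥ x ≢ n ×ᵥ u +ᵥ y
        unattained {i} i<d x∈ y∈ = unattained-difference {B} (j i) (<⇒≤ (j<n i<d))
          (≤-trans (≤-reflexive (sym (*-assoc 18 H width))) (*-monoˡ-≤ width (m≤m+n (18 * H) i)))
          (<-≤-trans (*-monoˡ-< width (j<19H i<d)) (≤-reflexive (*-assoc 19 H width))) x∈ y∈

        point-injective : ∀ {i i′} → i < i′ → i′ < d → point i ≢ point i′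
        point-injective {i} {i′} i<i′ i′<d e = <⇒≢ (∸-monoʳ-< (+-monoʳ-< (18 * H) i<i′) (<⇒≤ (j<n i′<d)))
          (*-cancelʳ-≡ (n ∸ j i′) (n ∸ j i) width (trans (sym (lev-point i′<d)) (trans (cong levˢ (sym e)) (lev-point (<-trans i<i′ i′<d)))))

        -- Equality would give point i + point i′ = 2nu, of level 0, although these points have
        -- positive levels.
        opposite-directions : ∀ {i i′} → i < d → i′ < d → forward i ≢ backward i′
        opposite-directions {i} {i′} i<d i′<d e = <⇒≢ positive (sym zero-level)
          where
          zero-level : levˢ (point i) + levˢ (point i′) ≡ 0
          zero-level = trans (sym (South.lev-+ (point∈ i<d) (point∈ i′<d))) (trans (cong (South.lev (n + n)) (-ᵥ≡-ᵥ⇒+ᵥ≡+ᵥ e))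
            (trans (South.lev-+ (∈[]-× South.apex∈ n) (∈[]-× South.apex∈ n)) (cong₂ _+_ (South.lev-apex n) (South.lev-apex n))))
          positive : 0 < levˢ (point i) + levˢ (point i′)
          positive = <-≤-trans (<-≤-trans (*-mono-< {0} {n ∸ j i} {0} {width} (m<n⇒0<n∸m (j<n i<d)) 0<width) (≤-reflexive (sym (lev-point i<d)))) (m≤m+n _ _)

        forwards backwards : List (ℤ^ D)
        forwards = List.applyUpTo forward d
        backwards = List.applyUpTo backward d

        differences-unique : Unique (forwards ++ backwards)
        differences-unique = Unique.++⁺
          (Unique.applyUpTo⁺₁ forward d λ {i} {i′} i<i′ i′<d e → point-injective i<i′ i′<d
            (+ᵥ.cancelʳ (n ×ᵥ u) _ _ (trans (-ᵥ≡-ᵥ⇒+ᵥ≡+ᵥ e) (+ᵥ.comm (n ×ᵥ u) (point i′)))))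
          (Unique.applyUpTo⁺₁ backward d λ {i} {i′} i<i′ i′<d e → point-injective i<i′ i′<d
            (sym (+ᵥ.cancelˡ (n ×ᵥ u) _ _ (trans (-ᵥ≡-ᵥ⇒+ᵥ≡+ᵥ e) (+ᵥ.comm (point i) (n ×ᵥ u))))))
          disjoint
          where
          disjoint : ∀ {z} → ¬ (z ∈ forwards × z ∈ backwards)
          disjoint (z∈ , z∈′) with i , i<d , refl ← ∈-applyUpTo⁻ forward z∈ with i′ , i′<d , e ← ∈-applyUpTo⁻ backward z∈′ =
            opposite-directions i<d i′<d e

        minus∈ : ∀ {xs ys : List (ℤ^ D)} {x y} → x ∈ xs → y ∈ ys → x -ᵥ y ∈ xs ⊖ ys
        minus∈ = ∈-cartesianProductWith⁺ (Vec.zipWith ℤ._-_)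

        ∉minus : ∀ {z} → (∀ {x y} → x ∈ A′ → y ∈ A′ → z ≢ x -ᵥ y) → z ∉ A′ ⊖ A′
        ∉minus h z∈ with x , y , x∈ , y∈ , z≡ ← ∈-cartesianProductWith⁻ (Vec.zipWith ℤ._-_) A′ A′ z∈ = h x∈ y∈ z≡

        nu∈X : n ×ᵥ u ∈ X
        nu∈X = ∈-points⁺ (∈[]-× South.apex∈ n)

        forward∈ : ∀ {i} → i < d → forward i ∈ (X ⊖ X) ∖ (A′ ⊖ A′)
        forward∈ {i} i<d = ∈-∖⁺ {xs = X ⊖ X} (minus∈ (∈-points⁺ (point∈ i<d)) nu∈X)
          (∉minus λ {x} {y} x∈ y∈ e → unattained i<d y∈ x∈ (-ᵥ≡-ᵥ⇒+ᵥ≡+ᵥ e))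

        backward∈ : ∀ {i} → i < d → backward i ∈ (X ⊖ X) ∖ (A′ ⊖ A′)
        backward∈ {i} i<d = ∈-∖⁺ {xs = X ⊖ X} (minus∈ nu∈X (∈-points⁺ (point∈ i<d)))
          (∉minus λ {x} {y} x∈ y∈ e → unattained i<d x∈ y∈ (sym (-ᵥ≡-ᵥ⇒+ᵥ≡+ᵥ e)))

        differences⊆ : forwards ++ backwards ⊆ (X ⊖ X) ∖ (A′ ⊖ A′)
        differences⊆ z∈ with ∈-++⁻ forwards z∈
        ... | inj₁ i∈ with i , i<d , refl ← ∈-applyUpTo⁻ forward i∈ = forward∈ i<d
        ... | inj₂ i∈ with i , i<d , refl ← ∈-applyUpTo⁻ backward i∈ = backward∈ i<d

      missing-differences : 2 * d ≤ ∣ (X ⊖ X) ∖ (A′ ⊖ A′) ∣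
      missing-differences = ≤-trans (≤-reflexive (sym lengths)) (≤-∣∣ differences-unique differences⊆)
        where
        lengths : length (forwards ++ backwards) ≡ 2 * d
        lengths = trans (List.length-++ forwards) (cong₂ _+_ (List.length-applyUpTo forward d)
          (trans (List.length-applyUpTo backward d) (sym (+-identityʳ d))))

    good? : ∀ B → Dec (total B ≡ 0)
    good? B = total B ≟ⁿ 0

    𝒜 : List (Subset (length X))
    𝒜 = map A (filter good? (subsets f))

    𝒜-unique : Unique 𝒜
    𝒜-unique = Unique.map⁺ A-injective (Unique.filter⁺ good? (subsets-unique f))

    𝒜-missing : All (MissingSumsDiffs X s d) 𝒜
    𝒜-missing = All.map⁺ (All.map (λ {B} good → missing-sums B good , missing-differences B good) (All.all-filter good? (subsets f)))

    length-𝒜 : 2 ^ length X ≤ 2 ^ suc (o + k * length (points V τ₁)) * length 𝒜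
    length-𝒜 = begin
      2 ^ length X  ≤⟨ ^-monoʳ-≤ 2 (≤-trans length-X (+-monoˡ-≤ f (+-monoˡ-≤ (k * length (points V τ₁)) length-O≤o))) ⟩
      2 ^ (b + f)  ≡⟨ ^-distribˡ-+-* 2 b f ⟩
      2 ^ b * 2 ^ f  ≤⟨ *-monoʳ-≤ (2 ^ b) (half-zeros f total total-bound) ⟩
      2 ^ b * (2 * length (filter good? (subsets f)))  ≡⟨ cong (λ l → 2 ^ b * (2 * l)) (List.length-map A (filter good? (subsets f))) ⟨
      2 ^ b * (2 * length 𝒜)  ≡⟨ rearrange (2 ^ b) (length 𝒜) ⟩
      2 * 2 ^ b * length 𝒜  ∎
      where
      open ≤-Reasoning
      b = o + k * length (points V τ₁)
      rearrange : ∀ p l → p * (2 * l) ≡ 2 * p * l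
      rearrange = solve-∀

theorem2 : ∀ (D : ℕ) (V : List (ℤ^ D)) →
    (∃[ u ] ∃[ v ] u ∈ V × v ∈ V × u ≢ v) →
    ∀ (s d : ℕ) →
    ∃[ c ] 0ℚ ℚ.< c × (∃[ N ] ∀ n → N ≤ n →
    ∃[ X ] Enumerates X (L (dilate n (conv V))) ×
    (∃[ 𝒜 ] Unique 𝒜 × All (MissingSumsDiffs X s d) 𝒜 ×
    c ℚ.* ℕ→ℚ (2 ^ length X) ℚ.≤ ℕ→ℚ (length 𝒜)))
theorem2 D V V≢ s d = c , 0<r , N , large-n
  where
  open Decide {D}
  P = ∃-poles V V≢
  k = length V
  -- A common bound: s < H keeps the omitted points in block 0, d ≤ H fits d values of j into block
  -- 18, and k + 2 ≤ H makes a block longer than `width` and `k * width`.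
  H = s + d + (k + 2)
  h = H * Poles.width P
  ρ = length (points V (ℕ.pred k))
  -- Any exponent with this number below 2 ^ E would do; the number itself is one.
  E = 2 * (k * (ρ * (ρ * 48 ^ k)))
  -- Below level 19h there are at most 19h parts other than the apex, and the remainder takes up to
  -- k more.
  τ₀ = 19 * h + k
  o = length (points V τ₀) + length (points V τ₀)
  τ₁ = suc τ₀ + (24 * E + 8 * o + (k + k))
  -- At most this many points less one are not free; the additional one accounts for the half of the
  -- bit vectors that may be bad.
  C = suc (o + k * length (points V τ₁))
  -- The outer successor excludes n = 0, so that n is the successor of some `n₁`.
  N = suc (suc τ₁ + 19 * h + 38 * h)
  pair = positivePair {ℕ→ℚ (2 ^ C)} (0<2^ C)
    where
    0<2^ : ∀ m → 0ℚ ℚ.< ℕ→ℚ (2 ^ m)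
    0<2^ m = subst (λ p → 0ℚ ℚ.< ℕ→ℚ p) (suc-pred (2 ^ m) {{m^n≢0 2 m}}) (0<ℕ→ℚ-suc (ℕ.pred (2 ^ m)))
  c = proj₁ pair
  open PositivePair (proj₂ pair) using (0<r; r*[c*x])

  large-n : ∀ n → N ≤ n → ∃[ X ] Enumerates X (L (dilate n (conv V))) ×
    (∃[ 𝒜 ] Unique 𝒜 × All (MissingSumsDiffs X s d) 𝒜 × c ℚ.* ℕ→ℚ (2 ^ length X) ℚ.≤ ℕ→ℚ (length 𝒜))
  large-n (suc n₁) (s≤s N≤n) = points V n₁ , points-enumerate V n₁ , 𝒜 , 𝒜-unique , 𝒜-missing , proportion
    where
    open Conclusion P s H n₁
      (≤-<-trans (m≤m+n s d) (m<m+n (s + d) (≤-trans (s≤s z≤n) (m≤n+m 2 k))))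
      (m≤n+m (k + 2) (s + d))
      (m≤n⇒m≤1+n (≤-trans (m≤n+m (38 * h) (suc τ₁ + 19 * h)) N≤n))
      τ₀ τ₁ E (n≤1+n τ₀) (n≤1+n τ₁)
      (m≤n⇒m≤1+n (≤-trans (m≤m+n (suc τ₁ + 19 * h) (38 * h)) N≤n))
      (n≤2^n E)
    open Missing d (≤-trans (m≤n+m d s) (m≤m+n (s + d) (k + 2)))
    proportion : c ℚ.* ℕ→ℚ (2 ^ length (points V n₁)) ℚ.≤ ℕ→ℚ (length 𝒜)
    proportion = ℚ.≤-trans
      (ℚ.*-monoˡ-≤-nonNeg c {{ℚ.nonNegative (ℚ.<⇒≤ 0<r)}} (ℤ→ℚ-mono-≤ {ℤ.+ (2 ^ length (points V n₁))} {ℤ.+ (2 ^ C * length 𝒜)} (ℤ.+≤+ length-𝒜)))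
      (ℚ.≤-reflexive (trans (cong (ℚ._*_ c) (ℕ→ℚ-* (2 ^ C) (length 𝒜))) (r*[c*x] (ℕ→ℚ (length 𝒜)))))
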